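{- Let $n\ge 1$ and let $w$ be a Kreweras word of length $3n$. Then (a) $W_{\mathrm{pro}(w)}=\mathrm{rot}(W_w)$, and (b) $W_{\mathrm{evac}(w)}=\mathrm{flip}(W_w)$.
   Context: A Kreweras word of length $3n$ is a word $w=(w_1,\dots,w_{3n})$ in letters $\mathsf A,\mathsf B,\mathsf C$ with exactly $n$ of each letter such that every prefix has at least as many $\mathsf A$'s as $\mathsf B$'s and at least as many $\mathsf A$'s as $\mathsf C$'s. Promotion: let $\iota(w)$ be the smallest $\iota\ge1$ such that $(w_1,\dots,w_\iota)$ has as many $\mathsf A$'s as $\mathsf B$'s or as many $\mathsf A$'s as $\mathsf C$'s; $\mathrm{pro}(w)=(w_2,\dots,w_{\iota(w)-1},\mathsf A,w_{\iota(w)+1},\dots,w_{3n},w_{\iota(w)})$. Evacuation: for $1\le i\le 3n-1$ let $\tau_i(w)$ be the word obtained by swapping $w_i$ and $w_{i+1}$ if the result is a Kreweras word, and $\tau_i(w)=w$ otherwise; then $\mathrm{evac}=(\tau_1)\circ(\tau_2\circ\tau_1)\circ\cdots\circ(\tau_{3n-1}\circ\cdots\circ\tau_2\circ\tau_1)$ (maps applied right to left). Kreweras bump diagram: for $\varepsilon\in\{\mathsf B,\mathsf C\}$ let $M^\varepsilon_w$ be the unique noncrossing perfect matching of $\{i: w_i\in\{\mathsf A,\varepsilon\}\}$ by arcs $(i,j)$, $i<j$, with $w_i=\mathsf A$, $w_j=\varepsilon$ (noncrossing: no two arcs $(i,j),(k,l)$ with $i<k<j<l$). Two arcs $(a,b),(c,d)$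 of $M^{\mathsf B}_w\cup M^{\mathsf C}_w$ cross if $a\le c<b<d$ (this happens only for arcs from different matchings). The diagram $D_w$ places $1,\dots,3n$ in order on a horizontal line and draws each arc as a curve in the upper half plane joining its endpoints, such that two arcs meet iff they cross, and then exactly once (arcs $(a,b),(a,d)$ meet at the point $a$). The web $W_w$: replace each meeting point of crossing arcs $(a,b),(c,d)$ with $a<c<b<d$ by a white vertex and a black vertex joined by a new edge, the white vertex being incident to the two arc-segments leading towards $a$ and $c$, the black vertex incident to the two arc-segments leading towards $b$ and $d$; for crossing arcs $(a,b),(a,d)$ sharing the left endpoint $a$, join the point $a$ by a new edge to a new black vertex which is incident to the two arc-segments leading to $b$ and $d$. The points $1,\dots,3n$ become white boundary vertices (with these labels) placed counterclockwise on the boundary of a disk, and the resulting planar bipartite graph embedded in the disk is $W_w$ (an $\mathfrak{sl}_3$-web: planar graph in a disk, boundary vertices of degree one labeled $1,\dots,m$ counterclockwise on the rim, internal vertices of degree three, vertices properly 2-colored black/white). Webs are considered up to isotopy of the disk fixing the labeled boundary. For a web $W$ with $m$ boundary vertices: $\mathrm{rot}(W)$ is obtained by relabeling the boundary vertex labeled $i$ by $i-1$ for $i\ge2$ and the one labeled $1$ by $m$; $\mathrm{flip}(W)$ is obtained by reflecting $W$ across a chord of the disk separating boundary vertices $1$ and $m$ and then relabeling the boundary vertex labeled $i$ by $m+1-i$ (vertex colors unchanged). -}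

module Defs where

open import Data.Nat using (ℕ; zero; suc; _+_; _*_; _∸_; _≤_; _<_; _<?_; _≡ᵇ_; _<ᵇ_; _≤ᵇ_; _%_)
open import Data.Nat.DivMod using (m%n<n)
open import Data.Bool using (Bool; true; false; _∧_; _∨_; not; if_then_else_; T)
open import Data.List using (List; []; _∷_; _++_; take; drop; upTo; filterᵇ; foldr)
open import Data.Fin using (Fin; toℕ; fromℕ<; opposite) renaming (zero to fz; suc to fs)
open import Data.Sum using (_⊎_; inj₁; inj₂; map₁)
open import Data.Product using (Σ; _×_; _,_; proj₁; proj₂)
open import Data.Maybe using (Maybe; just; nothing)
open import Relation.Nullary using (yes; no)
open import Relation.Nullary.Decidable using (T?)
open import Relation.Binary.PropositionalEquality using (_≡_)

data Letter : Set where
  A B C : Letter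

_==L_ : Letter → Letter → Bool
A ==L A = true
B ==L B = true
C ==L C = true
_ ==L _ = false

count : Letter → List Letter → ℕ
count x [] = 0
count x (y ∷ ys) = if x ==L y then suc (count x ys) else count x ys

record IsKreweras (n : ℕ) (w : List Letter) : Set where
  field
    countA : count A w ≡ n
    countB : count B w ≡ n
    countC : count C w ≡ n
    prefB  : ∀ k → count B (take k w) ≤ count A (take k w)
    prefC  : ∀ k → count C (take k w) ≤ count A (take k w)

ballot : ℕ → ℕ → ℕ → List Letter → Bool
ballot a b c [] = true
ballot a b c (A ∷ xs) = ballot (suc a) b c xs
ballot a b c (B ∷ xs) = (suc b ≤ᵇ a) ∧ ballot a (suc b) c xs
ballot a b c (C ∷ xs) = (suc c ≤ᵇ a) ∧ ballot a b (suc c) xs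

isKrewB : ℕ → List Letter → Bool
isKrewB n w = (count A w ≡ᵇ n) ∧ (count B w ≡ᵇ n) ∧ (count C w ≡ᵇ n) ∧ ballot 0 0 0 w

-- 0-based letter lookup (default A, never used on valid indices)
nth : List Letter → ℕ → Letter
nth [] _ = A
nth (x ∷ xs) zero = x
nth (x ∷ xs) (suc k) = nth xs k

iotaGo : ℕ → ℕ → ℕ → ℕ → List Letter → ℕ
iotaGo k a b c [] = k
iotaGo k a b c (x ∷ xs) =
  let a' = if x ==L A then suc a else a
      b' = if x ==L B then suc b else b
      c' = if x ==L C then suc c else c
  in if (a' ≡ᵇ b') ∨ (a' ≡ᵇ c') then suc k else iotaGo (suc k) a' b' c' xs

iota : List Letter → ℕ
iota w = iotaGo 0 0 0 0 w

-- pro(w) = (w_2,...,w_{ι-1}, A, w_{ι+1},...,w_{3n}, w_ι)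
pro : List Letter → List Letter
pro w = drop 1 (take (iota w ∸ 1) w) ++ (A ∷ drop (iota w) w) ++ (nth w (iota w ∸ 1) ∷ [])

swapAt : ℕ → List Letter → List Letter
swapAt zero (x ∷ y ∷ xs) = y ∷ x ∷ xs
swapAt zero xs = xs
swapAt (suc j) [] = []
swapAt (suc j) (x ∷ xs) = x ∷ swapAt j xs

-- τ_i (i is 1-based), for words of length 3n
tau : ℕ → ℕ → List Letter → List Letter
tau n i w = if isKrewB n (swapAt (i ∸ 1) w) then swapAt (i ∸ 1) w else w

sweep : ℕ → ℕ → List Letter → List Letter
sweep n zero w = w
sweep n (suc k) w = tau n (suc k) (sweep n k w)

evacGo : ℕ → ℕ → List Letter → List Letter
evacGo n zero w = w
evacGo n (suc k) w = evacGo n k (sweep n (suc k) w)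

evac : ℕ → List Letter → List Letter
evac n w = evacGo n (3 * n ∸ 1) w

-- Webs (combinatorial maps in a disk with m labelled boundary vertices)
--
-- Boundary vertices are the elements of Fin m (index j = label j+1),
-- they are white and of degree one.  Internal vertices form the type Vtx,
-- each has a colour and its three neighbours listed in counterclockwise
-- order (nbr v 0, nbr v 1, nbr v 2), up to cyclic shift.

record Web (m : ℕ) : Set₁ where
  field
    Vtx   : Set
    black : Vtx → Bool
    nbr   : Vtx → Fin 3 → Fin m ⊎ Vtx
    bnd   : Fin m → Fin m ⊎ Vtx

open Web public

shiftF : ∀ {m} → ℕ → Fin m → Fin m
shiftF {zero} s ()
shiftF {suc k} s j = fromℕ< (m%n<n (toℕ j + s) (suc k))

-- equivalence of webs (isotopy rel boundary): an isomorphism of the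
-- underlying rotation systems fixing the labelled boundary and colours.
record _≅_ {m : ℕ} (W W' : Web m) : Set where
  field
    f     : Vtx W → Vtx W'
    g     : Vtx W' → Vtx W
    gf    : ∀ v → g (f v) ≡ v
    fg    : ∀ v → f (g v) ≡ v
    col   : ∀ v → black W' (f v) ≡ black W v
    bndEq : ∀ j → bnd W' j ≡ Data.Sum.map₂ f (bnd W j)
    nbrEq : ∀ v → Σ (Fin 3) λ s → ∀ k →
              nbr W' (f v) (shiftF (toℕ s) k) ≡ Data.Sum.map₂ f (nbr W v k)

rotW : ∀ {m} → Web m → Web m
rotW {m} W = record
  { Vtx = Vtx W
  ; black = black W
  ; nbr = λ v k → map₁ ρ (nbr W v k)
  ; bnd = λ k → map₁ ρ (bnd W (shiftF 1 k))
  }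
  where
  ρ : Fin m → Fin m
  ρ = shiftF (m ∸ 1)

revF : Fin 3 → Fin 3
revF fz = fz
revF (fs fz) = fs (fs fz)
revF (fs (fs fz)) = fs fz

-- flip: mirror image (reverses all cyclic orders), label i ↦ m+1-i
flipW : ∀ {m} → Web m → Web m
flipW W = record
  { Vtx = Vtx W
  ; black = black W
  ; nbr = λ v k → map₁ opposite (nbr W v (revF k))
  ; bnd = λ k → map₁ opposite (bnd W (opposite k))
  }

-- The web W_w of a Kreweras word, built from the bump diagram drawn with
-- semicircles (positions are 0-based: position p has label p+1).

data ROut : Set where
  bdy : ℕ → ROut
  nd  : Bool × ℕ × ℕ → ROut

module WebCon (n : ℕ) (w : List Letter) where

  N : ℕ
  N = 3 * n

  L : ℕ → Letter
  L = nth w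

  isAb : ℕ → Bool
  isAb p = (L p ==L A) ∧ (p <ᵇ N)

  -- right endpoint of the arc of M^ε starting at the A in position a
  matchGo : Letter → ℕ → ℕ → List Letter → ℕ
  matchGo ε d p [] = p
  matchGo ε d p (x ∷ xs) =
    if x ==L A then matchGo ε (suc d) (suc p) xs
    else (if x ==L ε then (if d ≡ᵇ 1 then p else matchGo ε (d ∸ 1) (suc p) xs)
          else matchGo ε d (suc p) xs)

  R : Letter → ℕ → ℕ
  R ε a = matchGo ε 1 (suc a) (drop (suc a) w)

  -- B-arc starting at i and C-arc starting at j cross in the interior
  inter : ℕ → ℕ → Bool
  inter i j = ((i <ᵇ j) ∧ (j <ᵇ R B i) ∧ (R B i <ᵇ R C j))
            ∨ ((j <ᵇ i) ∧ (i <ᵇ R C j) ∧ (R C j <ᵇ R B i))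

  -- x-coordinate (as numerator, denominator) of the intersection point of
  -- the semicircles over [a,b] and [c,d], a < c < b < d : (cd-ab)/(c+d-a-b)
  key : ℕ → ℕ → ℕ × ℕ
  key i j = if i <ᵇ j
    then ((j * R C j ∸ i * R B i) , ((j + R C j) ∸ (i + R B i)))
    else ((i * R B i ∸ j * R C j) , ((i + R B i) ∸ (j + R C j)))

  ltK : ℕ × ℕ → ℕ × ℕ → Bool
  ltK (p , q) (r , s) = p * s <ᵇ r * q

  -- internal vertices: (true , i , j) is the black vertex and
  -- (false , i , j) the white vertex at the crossing of the B-arc starting
  -- at i with the C-arc starting at j; (true , a , a) is the black vertex
  -- attached to boundary vertex a (arcs sharing the left endpoint a).
  Raw : Set
  Raw = Bool × ℕ × ℕ

  valid : Raw → Bool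
  valid (c , i , j) = isAb i ∧ isAb j ∧ (if c then (i ≡ᵇ j) ∨ inter i j else inter i j)

  V : Set
  V = Σ Raw (λ r → T (valid r))

  pairOf : Letter → ℕ → ℕ → ℕ × ℕ
  pairOf ε a q = if ε ==L B then (a , q) else (q , a)

  keyOn : Letter → ℕ → ℕ → ℕ × ℕ
  keyOn ε a q = key (proj₁ (pairOf ε a q)) (proj₂ (pairOf ε a q))

  crossings : Letter → ℕ → List ℕ
  crossings ε a = filterᵇ (λ q → isAb q ∧ not (q ≡ᵇ a)
                     ∧ inter (proj₁ (pairOf ε a q)) (proj₂ (pairOf ε a q))) (upTo N)

  nextOn : Letter → ℕ → ℕ × ℕ → Maybe ℕ
  nextOn ε a k = foldr step nothing (crossings ε a)
    where
    step : ℕ → Maybe ℕ → Maybe ℕ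
    step q nothing = if ltK k (keyOn ε a q) then just q else nothing
    step q (just q') = if ltK k (keyOn ε a q) ∧ ltK (keyOn ε a q) (keyOn ε a q')
                       then just q else just q'

  prevOn : Letter → ℕ → ℕ × ℕ → Maybe ℕ
  prevOn ε a k = foldr step nothing (crossings ε a)
    where
    step : ℕ → Maybe ℕ → Maybe ℕ
    step q nothing = if ltK (keyOn ε a q) k then just q else nothing
    step q (just q') = if ltK (keyOn ε a q) k ∧ ltK (keyOn ε a q') (keyOn ε a q)
                       then just q else just q'

  afterArc : Letter → ℕ → ℕ × ℕ → ROut
  afterArc ε a k with nextOn ε a k
  ... | just q  = nd (false , pairOf ε a q)
  ... | nothing = bdy (R ε a)

  beforeArc : Letter → ℕ → ℕ × ℕ → ROut
  beforeArc ε a k with prevOn ε a k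
  ... | just q  = nd (true , pairOf ε a q)
  ... | nothing = nd (true , a , a)

  arcX arcY : ℕ → ℕ → Letter × ℕ
  arcX i j = if i <ᵇ j then (B , i) else (C , j)
  arcY i j = if i <ᵇ j then (C , j) else (B , i)

  nbrRaw : Raw → Fin 3 → ROut
  nbrRaw (false , i , j) fz = beforeArc (proj₁ (arcX i j)) (proj₂ (arcX i j)) (key i j)
  nbrRaw (false , i , j) (fs fz) = beforeArc (proj₁ (arcY i j)) (proj₂ (arcY i j)) (key i j)
  nbrRaw (false , i , j) (fs (fs fz)) = nd (true , i , j)
  nbrRaw (true , i , j) k = if i ≡ᵇ j then start k else cross k
    where
    inner outer : Letter
    inner = if R B i <ᵇ R C i then B else C
    outer = if R B i <ᵇ R C i then C else B
    start : Fin 3 → ROut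
    start fz = bdy i
    start (fs fz) = afterArc inner i (i , 1)
    start (fs (fs fz)) = afterArc outer i (i , 1)
    cross : Fin 3 → ROut
    cross fz = afterArc (proj₁ (arcX i j)) (proj₂ (arcX i j)) (key i j)
    cross (fs fz) = afterArc (proj₁ (arcY i j)) (proj₂ (arcY i j)) (key i j)
    cross (fs (fs fz)) = nd (false , i , j)

  leftEnd : Letter → ℕ → Maybe ℕ
  leftEnd ε p = foldr (λ a r → if isAb a ∧ (R ε a ≡ᵇ p) then just a else r) nothing (upTo N)

  lastOn : Letter → ℕ → ROut
  lastOn ε p with leftEnd ε p
  ... | nothing = bdy p
  ... | just a  = beforeArc ε a (p , 1)

  bndRaw : ℕ → ROut
  bndRaw p with L p
  ... | A = nd (true , p , p)
  ... | B = lastOn B p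
  ... | C = lastOn C p

  -- conversion to actual vertices (the fallback `dflt` never occurs for
  -- Kreweras words)
  conv : (Fin N ⊎ V) → ROut → Fin N ⊎ V
  conv dflt (bdy p) with p <? N
  ... | yes pr = inj₁ (fromℕ< pr)
  ... | no _   = dflt
  conv dflt (nd r) with T? (valid r)
  ... | yes t = inj₂ (r , t)
  ... | no _  = dflt

  theWeb : Web N
  theWeb = record
    { Vtx = V
    ; black = λ v → proj₁ (proj₁ v)
    ; nbr = λ v k → conv (inj₂ v) (nbrRaw (proj₁ v) k)
    ; bnd = λ j → conv (inj₁ j) (bndRaw (toℕ j))
    }

web : (n : ℕ) → List Letter → Web (3 * n)
web n w = WebCon.theWeb n w

{-# OPTIONS --safe #-}

-- Colour the pieces of arcs of M^B by B, those of M^C by C and all other edges of W_w by A.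
-- This is a proper 3-edge-colouring whose boundary word is w, and the arc of M^ε from a to b
-- becomes the Kempe chain in the colours A, ε joining a to b.
-- The web therefore makes sense for any pair of noncrossing matchings on a circle
-- (crossing chords contribute an edge joining the sides of their A-ends), and in this
-- generality rotations and reflections of the disk act on it evidently.  Exchanging A and ε
-- along the chain of a chord a → b does not change the web, and if every chord of the other
-- family meeting it goes from (a , b) to the complement, then the recoloured web is
-- again the web of a pair of noncrossing matchings.  Promotion is such a switch
-- at the first letter followed by a rotation.  Each sweep of evacuation is at most such a
-- switch, carried out in the interval not yet evacuated; after the last one all chords run
-- backwards, so that the reflected matchings are those of evac w.
module Submission where

open import Defs
open import Data.Nat using (ℕ; zero; suc; _+_; _*_; _∸_; _≤_; _<_; _<ᵇ_; _≤ᵇ_; _≡ᵇ_; _%_; _<?_;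
  nonZero; z≤n; s≤s)
open import Data.Nat.Properties
open import Data.Nat.DivMod using (m%n<n; m<n⇒m%n≡m; [m+n]%n≡m%n; n%n≡0)
open import Data.Nat.Tactic.RingSolver using (solve-∀)
open import Data.Bool using (Bool; true; false; _∧_; _∨_; not; _xor_; if_then_else_; T)
open import Data.Bool.Properties using (T-irrelevant) renaming (_≟_ to _≟ᵇ_)
open import Data.Fin using (Fin; toℕ; fromℕ<; opposite) renaming (zero to fz; suc to fs)
open import Data.Fin.Properties using (toℕ-injective; toℕ-fromℕ<; toℕ<n; opposite-prop)
open import Data.List using (List; []; _∷_; _++_; length; take; drop; foldr; upTo)
open import Data.List.Properties using (length-++; ++-assoc; ++-identityʳ)
open import Data.List.Membership.Propositional using (_∈_)
open import Data.List.Membership.Propositional.Properties using (∈-filter⁺; ∈-filter⁻; ∈-upTo⁺)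
open import Data.List.Relation.Unary.All using (All; []; _∷_)
import Data.List.Relation.Unary.All as All
open import Data.List.Relation.Unary.Any using (here; there)
open import Data.Maybe using (Maybe; just; nothing)
open import Data.Product using (Σ; _×_; _,_; proj₁; proj₂)
open import Data.Sum using (_⊎_; inj₁; inj₂; map₁; map₂)
open import Data.Empty using (⊥; ⊥-elim)
open import Data.Unit using (⊤; tt)
open import Data.Vec using (Vec; tabulate)
open import Data.Vec.N-ary using (N-ary; _$ⁿ_)
open import Relation.Nullary using (¬_; Dec; yes; no)
open import Relation.Nullary.Decidable using (T?; _×-dec_; _⊎-dec_)
open import Relation.Binary using (tri<; tri≈; tri>)
open import Relation.Binary.PropositionalEquality

-- Linear and cyclic order

-- Crossing, order along a chord and orientation at a vertex are therefore expressed by the cyclic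
-- order of endpoints alone. The order along the chord from p makes sense because the chords of the
-- other family do not cross: x is met before z when the chord from x separates p from z, and it
-- does not matter which end of z is tested. Coordinates return only for the two words, where this
-- order is matched with the comparison of fractions in `nextOn` and `prevOn`. Recolouring alone
-- does not say to which crossing a vertex belongs afterwards; this bookkeeping is the bulk of the
-- work. It is organised by whether a chord lies within the interval from a to b, lies beyond it, or
-- leaves it, and it rests on statements about the order of at most six points, which `solve`
-- decides. Only B-chords are switched directly; for C-chords the two colours are exchanged first.

abstract
  -- u lies in the open arc running counterclockwise from p to q
  cyc : ℕ → ℕ → ℕ → Bool
  cyc p u q = ((p <ᵇ u) ∧ (u <ᵇ q)) ∨ ((u <ᵇ q) ∧ (q <ᵇ p)) ∨ ((q <ᵇ p) ∧ (p <ᵇ u))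

  -- `cyc` is opaque so that goals stay small and keep the shape that `solve` produces; outside this
  -- block the equation is the only way to open it.
  cyc-unfold : ∀ p u q → cyc p u q ≡ ((p <ᵇ u) ∧ (u <ᵇ q)) ∨ ((u <ᵇ q) ∧ (q <ᵇ p)) ∨
      ((q <ᵇ p) ∧ (p <ᵇ u))
  cyc-unfold p u q = refl

-- A decision procedure for linear and cyclic order.

module OrderSolver where

  infix 9 _<′_
  infixr 6 _∧′_
  infixr 5 _∨′_
  infixr 5 _xor′_
  infix 4 _≺_ _≼_ _≄_ _≐_ _≈_
  infix 3 ⊢_
  infixr 2 _⊢_

  data Formula : Set where
    _<′_ : ℕ → ℕ → Formula
    true′ : Formula
    not′ : Formula → Formula
    _∧′_ _∨′_ _xor′_ : Formula → Formula → Formula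
    cyc′ : ℕ → ℕ → ℕ → Formula

  at : List ℕ → ℕ → ℕ
  at [] _ = 0
  at (x ∷ _) zero = x
  at (_ ∷ xs) (suc i) = at xs i

  ⟦_⟧ : Formula → List ℕ → Bool
  ⟦ i <′ j ⟧ ρ = at ρ i <ᵇ at ρ j
  ⟦ true′ ⟧ ρ = true
  ⟦ not′ φ ⟧ ρ = not (⟦ φ ⟧ ρ)
  ⟦ φ ∧′ ψ ⟧ ρ = ⟦ φ ⟧ ρ ∧ ⟦ ψ ⟧ ρ
  ⟦ φ ∨′ ψ ⟧ ρ = ⟦ φ ⟧ ρ ∨ ⟦ ψ ⟧ ρ
  ⟦ φ xor′ ψ ⟧ ρ = ⟦ φ ⟧ ρ xor ⟦ ψ ⟧ ρ
  ⟦ cyc′ i j k ⟧ ρ = cyc (at ρ i) (at ρ j) (at ρ k)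

  expand : Formula → Formula
  expand (i <′ j) = i <′ j
  expand true′ = true′
  expand (not′ φ) = not′ (expand φ)
  expand (φ ∧′ ψ) = expand φ ∧′ expand ψ
  expand (φ ∨′ ψ) = expand φ ∨′ expand ψ
  expand (φ xor′ ψ) = expand φ xor′ expand ψ
  expand (cyc′ p u q) = (p <′ u ∧′ u <′ q) ∨′ (u <′ q ∧′ q <′ p) ∨′ (q <′ p ∧′ p <′ u)

  expand-correct : ∀ ρ φ → ⟦ expand φ ⟧ ρ ≡ ⟦ φ ⟧ ρ
  expand-correct ρ (i <′ j) = refl
  expand-correct ρ true′ = refl
  expand-correct ρ (not′ φ) = cong not (expand-correct ρ φ)
  expand-correct ρ (φ ∧′ ψ) = cong₂ _∧_ (expand-correct ρ φ) (expand-correct ρ ψ)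
  expand-correct ρ (φ ∨′ ψ) = cong₂ _∨_ (expand-correct ρ φ) (expand-correct ρ ψ)
  expand-correct ρ (φ xor′ ψ) = cong₂ _xor_ (expand-correct ρ φ) (expand-correct ρ ψ)
  expand-correct ρ (cyc′ p u q) = sym (cyc-unfold (at ρ p) (at ρ u) (at ρ q))

  data Relation : Set where
    _≺_ _≼_ _≄_ _≐_ : ℕ → ℕ → Relation
    _≈_ : Formula → Formula → Relation

  ⟦_⟧ᴿ : Relation → List ℕ → Set
  ⟦ i ≺ j ⟧ᴿ ρ = at ρ i < at ρ j
  ⟦ i ≼ j ⟧ᴿ ρ = at ρ i ≤ at ρ j
  ⟦ i ≄ j ⟧ᴿ ρ = at ρ i ≢ at ρ j
  ⟦ i ≐ j ⟧ᴿ ρ = at ρ i ≡ at ρ j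
  ⟦ φ ≈ ψ ⟧ᴿ ρ = ⟦ φ ⟧ ρ ≡ ⟦ ψ ⟧ ρ

  data Sequent : Set where
    ⊢_ : Relation → Sequent
    _⊢_ : Relation → Sequent → Sequent

  ⟦_⟧ˢ : Sequent → List ℕ → Set
  ⟦ ⊢ r ⟧ˢ ρ = ⟦ r ⟧ᴿ ρ
  ⟦ r ⊢ s ⟧ˢ ρ = ⟦ r ⟧ᴿ ρ → ⟦ s ⟧ˢ ρ

  formulaᴿ : Relation → Formula
  formulaᴿ (i ≺ j) = i <′ j
  formulaᴿ (i ≼ j) = not′ (j <′ i)
  formulaᴿ (i ≄ j) = i <′ j ∨′ j <′ i
  formulaᴿ (i ≐ j) = not′ (i <′ j) ∧′ not′ (j <′ i)
  formulaᴿ (φ ≈ ψ) = not′ (φ xor′ ψ)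

  formulaˢ : Sequent → Formula
  formulaˢ (⊢ r) = formulaᴿ r
  formulaˢ (r ⊢ s) = not′ (formulaᴿ r) ∨′ formulaˢ s

  -- (i , true , j) records i < j and (i , false , j) records i ≤ j.
  Fact : Set
  Fact = ℕ × Bool × ℕ

  Holds : List ℕ → Fact → Set
  Holds ρ (i , true , j) = at ρ i < at ρ j
  Holds ρ (i , false , j) = at ρ i ≤ at ρ j

  AllHold : List ℕ → List Fact → Set
  AllHold ρ [] = ⊤
  AllHold ρ (f ∷ Γ) = Holds ρ f × AllHold ρ Γ

  implied : List Fact → Fact → Bool
  implied [] _ = false
  implied ((i , s , j) ∷ Γ) f@(i′ , s′ , j′) =
    ((i ≡ᵇ i′) ∧ (j ≡ᵇ j′) ∧ (s ∨ not s′)) ∨ implied Γ f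

  insert : Fact → List Fact → List Fact
  insert f Γ = if implied Γ f then Γ else f ∷ Γ

  extendʳ : Fact → List Fact → List Fact → List Fact
  extendʳ f [] acc = acc
  extendʳ f@(i , s , j) ((k , t , l) ∷ Γ) acc =
    if j ≡ᵇ k then insert (i , s ∨ t , l) (extendʳ f Γ acc) else extendʳ f Γ acc

  extendˡ : Fact → List Fact → List Fact → List Fact → List Fact
  extendˡ f [] all acc = acc
  extendˡ f@(i , s , j) ((k , t , l) ∷ Γ) all acc =
    if l ≡ᵇ i
    then extendʳ (k , t ∨ s , j) all (insert (k , t ∨ s , j) (extendˡ f Γ all acc))
    else extendˡ f Γ all acc

  -- Keeps the list of facts closed under composition.
  assume : Fact → List Fact → List Fact
  assume f Γ = extendˡ f Γ Γ (extendʳ f Γ (insert f Γ))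

  data Outcome : Set where
    yea nay : Outcome
    stuck : ℕ → ℕ → Outcome

  -- Three-valued: `stuck i j` names a comparison that the facts leave open and on which the value
  -- depends so far. Conjunctions and disjunctions stop at a left argument that decides them, so a
  -- false hypothesis of a sequent closes a branch without any look at the rest.
  evaluate : List Fact → Formula → Outcome
  evaluate Γ (i <′ j) =
    if i ≡ᵇ j then nay
    else (if implied Γ (i , true , j) then yea
          else (if implied Γ (j , false , i) then nay else stuck i j))
  evaluate Γ true′ = yea
  evaluate Γ (not′ φ) with evaluate Γ φ
  ... | yea = nay
  ... | nay = yea
  ... | stuck i j = stuck i j
  evaluate Γ (φ ∧′ ψ) with evaluate Γ φ
  ... | yea = evaluate Γ ψ
  ... | nay = nay
  ... | stuck i j = stuck i j
  evaluate Γ (φ ∨′ ψ) with evaluate Γ φ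
  ... | yea = yea
  ... | nay = evaluate Γ ψ
  ... | stuck i j = stuck i j
  evaluate Γ (φ xor′ ψ) with evaluate Γ φ | evaluate Γ ψ
  ... | stuck i j | _ = stuck i j
  ... | yea | yea = nay
  ... | yea | nay = yea
  ... | yea | stuck i j = stuck i j
  ... | nay | r = r

  -- `solve` expands every `cyc′` beforehand; the answer `stuck` is sound because `Correct` then
  -- asserts nothing.
  evaluate Γ (cyc′ i j k) = stuck i j

  -- Exhausted fuel yields `false`, so the fuel limits what can be proved but does not enter
  -- soundness.
  decide : ℕ → List Fact → Formula → Bool
  decide zero Γ φ = false
  decide (suc fuel) Γ φ with evaluate Γ φ
  ... | yea = true
  ... | nay = false
  ... | stuck i j = decide fuel (assume (i , true , j) Γ) φ ∧ decide fuel (assume (j , false , i) Γ) φ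

  private
    ∧-true : ∀ {x y} → x ∧ y ≡ true → x ≡ true × y ≡ true
    ∧-true {true} e = refl , e

    T-≡ : ∀ {x} → x ≡ true → T x
    T-≡ refl = tt

    ≡-T : ∀ {x} → T x → x ≡ true
    ≡-T {true} _ = refl

    <ᵇ-true : ∀ {m n} → m < n → (m <ᵇ n) ≡ true
    <ᵇ-true p = ≡-T (<⇒<ᵇ p)

    <ᵇ-false : ∀ {m n} → n ≤ m → (m <ᵇ n) ≡ false
    <ᵇ-false {m} {n} n≤m with m <ᵇ n in e
    ... | false = refl
    ... | true = ⊥-elim (<⇒≱ (<ᵇ⇒< m n (T-≡ e)) n≤m)

    true-<ᵇ : ∀ {m n} → (m <ᵇ n) ≡ true → m < n
    true-<ᵇ {m} {n} e = <ᵇ⇒< m n (T-≡ e)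

    false-<ᵇ : ∀ {m n} → (m <ᵇ n) ≡ false → n ≤ m
    false-<ᵇ {m} {n} e = ≮⇒≥ λ p → case (trans (sym e) (<ᵇ-true p))
      where case : false ≡ true → ⊥
            case ()

    weaken : ∀ ρ i j s s′ → (s ∨ not s′) ≡ true → Holds ρ (i , s , j) → Holds ρ (i , s′ , j)
    weaken ρ i j true true _ h = h
    weaken ρ i j true false _ h = <⇒≤ h
    weaken ρ i j false false _ h = h

    compose : ∀ ρ i j l s t → Holds ρ (i , s , j) → Holds ρ (j , t , l) → Holds ρ (i , s ∨ t , l)
    compose ρ i j l true true p q = <-trans p q
    compose ρ i j l true false p q = <-≤-trans p q
    compose ρ i j l false true p q = ≤-<-trans p q
    compose ρ i j l false false p q = ≤-trans p q

  implied-sound : ∀ ρ Γ f → implied Γ f ≡ true → AllHold ρ Γ → Holds ρ f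
  implied-sound ρ ((i , s , j) ∷ Γ) f@(i′ , s′ , j′) e (h , hs)
    with (i ≡ᵇ i′) ∧ (j ≡ᵇ j′) ∧ (s ∨ not s′) in e′
  ... | false = implied-sound ρ Γ f e hs
  ... | true with ∧-true {i ≡ᵇ i′} e′
  ... | p , q with ∧-true {j ≡ᵇ j′} q
  ... | q₁ , q₂ with ≡ᵇ⇒≡ i i′ (T-≡ p) | ≡ᵇ⇒≡ j j′ (T-≡ q₁)
  ... | refl | refl = weaken ρ i j s s′ q₂ h

  insert-sound : ∀ ρ f Γ → Holds ρ f → AllHold ρ Γ → AllHold ρ (insert f Γ)
  insert-sound ρ f Γ h hs with implied Γ f
  ... | true = hs
  ... | false = h , hs

  extendʳ-sound : ∀ ρ f Γ acc → Holds ρ f → AllHold ρ Γ → AllHold ρ acc → AllHold ρ (extendʳ f Γ acc)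
  extendʳ-sound ρ f [] acc h hs ha = ha
  extendʳ-sound ρ f@(i , s , j) ((k , t , l) ∷ Γ) acc h (h′ , hs) ha with j ≡ᵇ k in e
  ... | false = extendʳ-sound ρ f Γ acc h hs ha
  ... | true with ≡ᵇ⇒≡ j k (T-≡ e)
  ... | refl = insert-sound ρ (i , s ∨ t , l) (extendʳ f Γ acc) (compose ρ i j l s t h h′)
      (extendʳ-sound ρ f Γ acc h hs ha)

  extendˡ-sound : ∀ ρ f Γ all acc → Holds ρ f → AllHold ρ Γ → AllHold ρ all → AllHold ρ acc →
                  AllHold ρ (extendˡ f Γ all acc)
  extendˡ-sound ρ f [] all acc h hs hall ha = ha
  extendˡ-sound ρ f@(i , s , j) ((k , t , l) ∷ Γ) all acc h (h′ , hs) hall ha with l ≡ᵇ i in e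
  ... | false = extendˡ-sound ρ f Γ all acc h hs hall ha
  ... | true with ≡ᵇ⇒≡ l i (T-≡ e)
  ... | refl = extendʳ-sound ρ (k , t ∨ s , j) all _ c hall
                 (insert-sound ρ (k , t ∨ s , j) (extendˡ f Γ all acc) c
                     (extendˡ-sound ρ f Γ all acc h hs hall ha))
    where c = compose ρ k i j t s h′ h

  assume-sound : ∀ ρ f Γ → Holds ρ f → AllHold ρ Γ → AllHold ρ (assume f Γ)
  assume-sound ρ f Γ h hs = extendˡ-sound ρ f Γ Γ _ h hs hs
    (extendʳ-sound ρ f Γ _ h hs (insert-sound ρ f Γ h hs))

  Correct : Outcome → Bool → Set
  Correct yea b = b ≡ true
  Correct nay b = b ≡ false
  Correct (stuck _ _) b = ⊤

  evaluate-sound : ∀ ρ Γ φ → AllHold ρ Γ → Correct (evaluate Γ φ) (⟦ φ ⟧ ρ)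
  evaluate-sound ρ Γ (i <′ j) hs with i ≡ᵇ j in e₁
  ... | true with ≡ᵇ⇒≡ i j (T-≡ e₁)
  ... | refl = <ᵇ-false {at ρ i} ≤-refl
  evaluate-sound ρ Γ (i <′ j) hs | false with implied Γ (i , true , j) in e₂
  ... | true = <ᵇ-true (implied-sound ρ Γ (i , true , j) e₂ hs)
  ... | false with implied Γ (j , false , i) in e₃
  ... | true = <ᵇ-false (implied-sound ρ Γ (j , false , i) e₃ hs)
  ... | false = tt
  evaluate-sound ρ Γ true′ hs = refl
  evaluate-sound ρ Γ (not′ φ) hs with evaluate Γ φ | evaluate-sound ρ Γ φ hs
  ... | yea | h = cong not h
  ... | nay | h = cong not h
  ... | stuck _ _ | h = tt
  evaluate-sound ρ Γ (φ ∧′ ψ) hs with evaluate Γ φ | evaluate-sound ρ Γ φ hs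
  ... | yea | h rewrite h = evaluate-sound ρ Γ ψ hs
  ... | nay | h rewrite h = refl
  ... | stuck _ _ | h = tt
  evaluate-sound ρ Γ (φ ∨′ ψ) hs with evaluate Γ φ | evaluate-sound ρ Γ φ hs
  ... | yea | h rewrite h = refl
  ... | nay | h rewrite h = evaluate-sound ρ Γ ψ hs
  ... | stuck _ _ | h = tt
  evaluate-sound ρ Γ (φ xor′ ψ) hs
    with evaluate Γ φ | evaluate Γ ψ | evaluate-sound ρ Γ φ hs | evaluate-sound ρ Γ ψ hs
  ... | stuck _ _ | _ | h | h′ = tt
  ... | yea | yea | h | h′ rewrite h | h′ = refl
  ... | yea | nay | h | h′ rewrite h | h′ = refl
  ... | yea | stuck _ _ | h | h′ = tt
  ... | nay | r | h | h′ rewrite h = h′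

  evaluate-sound ρ Γ (cyc′ i j k) hs = tt

  decide-sound : ∀ ρ fuel Γ φ → decide fuel Γ φ ≡ true → AllHold ρ Γ → ⟦ φ ⟧ ρ ≡ true
  decide-sound ρ (suc fuel) Γ φ e hs with evaluate Γ φ | evaluate-sound ρ Γ φ hs
  ... | yea | h = h
  ... | stuck i j | h with ∧-true {decide fuel (assume (i , true , j) Γ) φ} e
  ... | e₁ , e₂ with <-≤-connex (at ρ i) (at ρ j)
  ... | inj₁ i<j = decide-sound ρ fuel (assume (i , true , j) Γ) φ e₁
      (assume-sound ρ (i , true , j) Γ i<j hs)
  ... | inj₂ j≤i = decide-sound ρ fuel (assume (j , false , i) Γ) φ e₂
      (assume-sound ρ (j , false , i) Γ j≤i hs)

  formulaᴿ-complete : ∀ ρ r → ⟦ r ⟧ᴿ ρ → ⟦ formulaᴿ r ⟧ ρ ≡ true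
  formulaᴿ-complete ρ (i ≺ j) h = <ᵇ-true h
  formulaᴿ-complete ρ (i ≼ j) h = cong not (<ᵇ-false h)
  formulaᴿ-complete ρ (i ≄ j) h with at ρ i <ᵇ at ρ j in e
  ... | true = refl
  ... | false = <ᵇ-true (≤∧≢⇒< (false-<ᵇ e) (λ q → h (sym q)))
  formulaᴿ-complete ρ (i ≐ j) h
    rewrite h | <ᵇ-false {at ρ j} ≤-refl = refl
  formulaᴿ-complete ρ (φ ≈ ψ) h rewrite h with ⟦ ψ ⟧ ρ
  ... | true = refl
  ... | false = refl

  formulaᴿ-sound : ∀ ρ r → ⟦ formulaᴿ r ⟧ ρ ≡ true → ⟦ r ⟧ᴿ ρ
  formulaᴿ-sound ρ (i ≺ j) h = true-<ᵇ h
  formulaᴿ-sound ρ (i ≼ j) h with at ρ j <ᵇ at ρ i in e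
  ... | false = false-<ᵇ e
  formulaᴿ-sound ρ (i ≄ j) h q rewrite q | <ᵇ-false {at ρ j} ≤-refl with h
  ... | ()
  formulaᴿ-sound ρ (i ≐ j) h with at ρ i <ᵇ at ρ j in e | at ρ j <ᵇ at ρ i in e′
  ... | false | false = ≤-antisym (false-<ᵇ e′) (false-<ᵇ e)
  formulaᴿ-sound ρ (φ ≈ ψ) h with ⟦ φ ⟧ ρ | ⟦ ψ ⟧ ρ
  ... | true | true = refl
  ... | false | false = refl

  formulaˢ-sound : ∀ ρ s → ⟦ formulaˢ s ⟧ ρ ≡ true → ⟦ s ⟧ˢ ρ
  formulaˢ-sound ρ (⊢ r) h = formulaᴿ-sound ρ r h
  formulaˢ-sound ρ (r ⊢ s) h p rewrite formulaᴿ-complete ρ r p = formulaˢ-sound ρ s h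

  vars : ∀ k → Vec ℕ k
  vars k = tabulate toℕ

  -- The sequent is a function of its points and is applied to the indices 0, 1, ..., so that the
  -- hypothesis is a closed Boolean computation, proved by `refl`. The fuel 60 is ample: a branch
  -- splits on each pair of points at most twice, and no sequent below involves more than six
  -- points.
  solve : ∀ k (s : N-ary k ℕ Sequent) → decide 60 [] (expand (formulaˢ (s $ⁿ vars k))) ≡ true →
          ∀ ρ → ⟦ s $ⁿ vars k ⟧ˢ ρ
  solve k s e ρ = formulaˢ-sound ρ (s $ⁿ vars k) 
    (trans (sym (expand-correct ρ (formulaˢ (s $ⁿ vars k))))
        (decide-sound ρ 60 [] (expand (formulaˢ (s $ⁿ vars k))) e tt))

open OrderSolver using (solve; _<′_; true′; not′; _∧′_; _∨′_; _xor′_; cyc′; _≺_; _≼_; _≄_; _≐_; _≈_; ⊢_;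
    _⊢_)

-- Diagrams of chords and their webs

-- A reflection of the disk negates each side of a chord, and this cancels when two sides are
-- compared. `Crosses` and `Before` are such comparisons and hence survive reflections.
xor-shift : ∀ o a b → (o xor a) xor (o xor b) ≡ a xor b
xor-shift false a b = refl
xor-shift true false false = refl
xor-shift true false true = refl
xor-shift true true false = refl
xor-shift true true true = refl

xor-cancel : ∀ o a → o xor (o xor a) ≡ a
xor-cancel false a = refl
xor-cancel true false = refl
xor-cancel true true = refl

swapLetter : Letter → Letter
swapLetter A = A
swapLetter B = C
swapLetter C = B

data ArcColour : Letter → Set where
  isB : ArcColour B
  isC : ArcColour C

swapColour : ∀ {ε} → ArcColour ε → ArcColour (swapLetter ε)
swapColour isB = isC
swapColour isC = isB

swapLetter-involutive : ∀ ε → swapLetter (swapLetter ε) ≡ ε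
swapLetter-involutive A = refl
swapLetter-involutive B = refl
swapLetter-involutive C = refl

A≢arc : ∀ {ε} → ArcColour ε → A ≢ ε
A≢arc isB ()
A≢arc isC ()

ε≢swap : ∀ {ε} → ArcColour ε → ε ≢ swapLetter ε
ε≢swap isB ()
ε≢swap isC ()

Vertex : Set
Vertex = Bool × ℕ × ℕ

-- The boundary points of a disk carry letters, and two noncrossing families of
-- chords R ε join the A-points to the ε-points, for ε = B, C.
record Diagram : Set where
  field
    ℓ : ℕ → Letter
    R : Letter → ℕ → ℕ
open Diagram public

side : Diagram → Letter → ℕ → ℕ → Bool
side D ε p u = cyc p u (R D ε p)

-- Separation of the two ends of the other chord, which makes sense for chords running in either
-- direction. Two chords from the same A-point are excluded; their meeting is the hub
-- `(true , p , p)`.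
Crosses : Diagram → Letter → ℕ → ℕ → Set
Crosses D ε p x = p ≢ x × (side D ε p x xor side D ε p (R D (swapLetter ε) x)) ≡ true

-- The order in which the chord from p meets the chords of the other family:
-- x comes before z when the chord from x separates p from z.
Before : Diagram → Letter → ℕ → ℕ → ℕ → Set
Before D ε p x z =
  x ≡ p ⊎ (x ≢ z × (side D (swapLetter ε) x p xor side D (swapLetter ε) x z) ≡ true)

-- The colour following a given one in the cyclic order A, B, C for `false` and A, C, B for `true`.
orient : Bool → Letter → Letter
orient false A = B
orient false B = C
orient false C = A
orient true A = C
orient true B = A
orient true C = B

-- false when the edges coloured A, B, C occur in this counterclockwise order
sign : Diagram → Vertex → Bool
-- One formula serves both vertices of a crossing: the ends of the two chords alternate around it,
-- so the B-piece and the C-piece follow the A-edge in the same order at the white vertex and at the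
-- black one. At a hub i and j coincide.
sign D (_ , i , j) = side D B i (R D C j)

place : Letter → ℕ → ℕ → ℕ × ℕ
place ε p x = if ε ==L B then (p , x) else (x , p)

module Diagrams (N : ℕ) where

  IsA : Diagram → ℕ → Set
  IsA D p = p < N × ℓ D p ≡ A

  On : Diagram → Letter → ℕ → ℕ → Set
  On D ε p x = IsA D x × Crosses D ε p x

  Valid : Diagram → Vertex → Set
  Valid D (c , i , j) = IsA D i × IsA D j × ((c ≡ true × i ≡ j) ⊎ Crosses D B i j)

  record Succ (D : Diagram) (ε : Letter) (p x z : ℕ) : Set where
    constructor mkSucc
    field
      isA : IsA D p
      start : x ≡ p ⊎ On D ε p x
      on : On D ε p z
      before : Before D ε p x z
      immediate : ∀ w → On D ε p w → Before D ε p x w → Before D ε p w z → ⊥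

  record Last (D : Diagram) (ε : Letter) (p x : ℕ) : Set where
    constructor mkLast
    field
      isA : IsA D p
      start : x ≡ p ⊎ On D ε p x
      maximal : ∀ w → On D ε p w → Before D ε p x w → ⊥

  -- The web of a diagram as a relation: its edges are 3-coloured, colour A for
  -- the edges created at crossings and at the A-points, colour ε for the pieces of
  -- ε-chords.
  data Edge (D : Diagram) : Vertex → Letter → ℕ ⊎ Vertex → Set where
    hub  : ∀ {p} → Edge D (true , p , p) A (inj₁ p)
    out  : ∀ {p x} → p ≢ x → Edge D (false , p , x) A (inj₂ (true , p , x))
    into : ∀ {p x} → p ≢ x → Edge D (true , p , x) A (inj₂ (false , p , x))
    fwd  : ∀ {ε p x z} → ArcColour ε → Succ D ε p x z →
           Edge D (true , place ε p x) ε (inj₂ (false , place ε p z))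
    bwd  : ∀ {ε p x z} → ArcColour ε → Succ D ε p x z →
           Edge D (false , place ε p z) ε (inj₂ (true , place ε p x))
    end  : ∀ {ε p x} → ArcColour ε → Last D ε p x →
           Edge D (true , place ε p x) ε (inj₁ (R D ε p))

  data BoundaryEdge (D : Diagram) : ℕ → Vertex → Set where
    atA : ∀ {p} → IsA D p → BoundaryEdge D p (true , p , p)
    atEnd : ∀ {ε p x} → ArcColour ε → Last D ε p x → BoundaryEdge D (R D ε p) (true , place ε p x)

  record Matching (D : Diagram) (ε : Letter) : Set where
    field
      target : ∀ {p} → IsA D p → R D ε p < N × ℓ D (R D ε p) ≡ ε
      source : ∀ {j} → j < N → ℓ D j ≡ ε → Σ ℕ λ p → IsA D p × R D ε p ≡ j
      noncrossing : ∀ {p r} → IsA D p → IsA D r → p ≢ r → side D ε p r ≡ side D ε p (R D ε r)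

  WellFormed : Diagram → Set
  WellFormed D = ∀ {ε} → ArcColour ε → Matching D ε

  mapTarget : (ℕ → ℕ) → (Vertex → Vertex) → ℕ ⊎ Vertex → ℕ ⊎ Vertex
  mapTarget ρ f (inj₁ p) = inj₁ (ρ p)
  mapTarget ρ f (inj₂ v) = inj₂ (f v)

  -- o tells whether the isomorphism reverses the orientation of the disk
  record Iso (ρ : ℕ → ℕ) (o : Bool) (D D′ : Diagram) : Set where
    field
      f g : Vertex → Vertex
      f-valid : ∀ v → Valid D v → Valid D′ (f v)
      g-valid : ∀ v → Valid D′ v → Valid D (g v)
      gf : ∀ v → Valid D v → g (f v) ≡ v
      fg : ∀ v → Valid D′ v → f (g v) ≡ v
      colour : ∀ v → proj₁ (f v) ≡ proj₁ v
      π : Vertex → Letter → Letter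
      turn : ∀ v → Valid D v → ∀ c → π v (orient (sign D v) c) ≡ orient (o xor sign D′ (f v)) (π v c)
      -- One direction is enough: every slot of a vertex of a word's web has an edge of its colour,
      -- and in the diagram of a word vertex and colour determine the target. An edge carried over
      -- from the source is therefore the edge of the target web.
      edge : ∀ v → Valid D v → ∀ c t → Edge D v c t → Edge D′ (f v) (π v c) (mapTarget ρ f t)
      boundary : ∀ j v → BoundaryEdge D j v → BoundaryEdge D′ (ρ j) (f v)

  idIso : ∀ D → Iso (λ p → p) false D D
  idIso D = record
    { f = λ v → v ; g = λ v → v ; f-valid = λ _ h → h ; g-valid = λ _ h → h
    ; gf = λ _ _ → refl ; fg = λ _ _ → refl ; colour = λ _ → refl
    ; π = λ _ c → c ; turn = λ _ _ _ → refl
    ; edge = λ { v h c (inj₁ _) e → e ; v h c (inj₂ _) e → e }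
    ; boundary = λ _ _ e → e }

  infixr 5 _⊙_
  _⊙_ : ∀ {ρ ρ′ o D D′ D″} → Iso ρ false D D′ → Iso ρ′ o D′ D″ → Iso (λ p → ρ′ (ρ p)) o D D″
  _⊙_ {o = o} {D} {D′} {D″} I J = record
    { f = λ v → J.f (I.f v)
    ; g = λ v → I.g (J.g v)
    ; f-valid = λ v h → J.f-valid _ (I.f-valid v h)
    ; g-valid = λ v h → I.g-valid _ (J.g-valid v h)
    ; gf = λ v h → trans (cong I.g (J.gf _ (I.f-valid v h))) (I.gf v h)
    ; fg = λ v h → trans (cong J.f (I.fg _ (J.g-valid v h))) (J.fg v h)
    ; colour = λ v → trans (J.colour _) (I.colour v)
    ; π = λ v c → J.π (I.f v) (I.π v c)
    ; turn = λ v h c → trans (cong (J.π (I.f v)) (I.turn v h c)) (J.turn (I.f v) (I.f-valid v h)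
        (I.π v c))
    ; edge = λ { v h c (inj₁ t) e → J.edge _ (I.f-valid v h) _ _ (I.edge v h c _ e)
               ; v h c (inj₂ t) e → J.edge _ (I.f-valid v h) _ _ (I.edge v h c _ e) }
    ; boundary = λ j v e → J.boundary _ _ (I.boundary j v e)
    }
    where module I = Iso I
          module J = Iso J

  module WellFormedProperties {D : Diagram} (wf : WellFormed D) where

    R<N : ∀ {ε p} → ArcColour ε → IsA D p → R D ε p < N
    R<N e h = proj₁ (Matching.target (wf e) h)

    ℓR : ∀ {ε p} → ArcColour ε → IsA D p → ℓ D (R D ε p) ≡ ε
    ℓR e h = proj₂ (Matching.target (wf e) h)

    A≢R : ∀ {ε p r} → ArcColour ε → IsA D p → IsA D r → r ≢ R D ε p
    A≢R e hp hr refl = A≢arc e (trans (sym (proj₂ hr)) (ℓR e hp))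

    R≢R : ∀ {ε p r} → ArcColour ε → IsA D p → IsA D r → R D ε p ≢ R D (swapLetter ε) r
    R≢R {ε} e hp hr q = ε≢swap e (trans (sym (ℓR e hp)) (trans (cong (ℓ D) q) (ℓR (swapColour e) hr)))

    -- A consequence of noncrossing: if p and r shared the end q, both `cyc p r q` and `cyc r p q`
    -- would equal values of `cyc` with a repeated point, which are false, whereas for distinct
    -- points exactly one of the two holds.
    R-injective : ∀ {ε p r} → ArcColour ε → IsA D p → IsA D r → R D ε p ≡ R D ε r → p ≡ r
    R-injective {ε} {p} {r} e hp hr q with p ≟ r
    ... | yes p≡r = p≡r
    ... | no p≢r = solve 3 (λ p r q → cyc′ p r q ≈ cyc′ p q q ⊢ cyc′ r p q ≈ cyc′ r q q ⊢ p ≄ q ⊢ r ≄ q ⊢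
        ⊢ p ≐ r) refl
        (p ∷ r ∷ R D ε p ∷ [])
        (subst (λ z → cyc p r (R D ε p) ≡ cyc p z (R D ε p)) (sym q)
            (Matching.noncrossing (wf e) hp hr p≢r))
        (subst (λ z → cyc r p z ≡ cyc r (R D ε p) z) (sym q) (Matching.noncrossing (wf e) hr hp
            (λ q → p≢r (sym q))))
        (A≢R e hp hp) (A≢R e hp hr)

    crosses-sym : ∀ {ε p x} → ArcColour ε → IsA D p → IsA D x → Crosses D ε p x →
        Crosses D (swapLetter ε) x p
    crosses-sym {ε} {p} {x} e hp hx (p≢x , c) rewrite swapLetter-involutive ε =
      (λ q → p≢x (sym q)) ,
      solve 4 (λ p q x y → (cyc′ p x q xor′ cyc′ p y q) ≈ true′ ⊢ p ≄ x ⊢ p ≄ q ⊢ x ≄ q ⊢ x ≄ y ⊢ p ≄ y ⊢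
          q ≄ y ⊢
                 ⊢ (cyc′ x p y xor′ cyc′ x q y) ≈ true′) refl
        (p ∷ R D ε p ∷ x ∷ R D (swapLetter ε) x ∷ []) c p≢x (A≢R e hp hp) (A≢R e hp hx)
        (A≢R (swapColour e) hx hx) (A≢R (swapColour e) hx hp) (R≢R e hp hx)

    -- `sign` is computed from the side of the B-chord. Exchanging the families computes it from the
    -- C-chord, which sees the far end of the other chord on the opposite hand.
    crossing-sign : ∀ {p x} → IsA D p → IsA D x → Crosses D B p x →
                    cyc x (R D B p) (R D C x) ≡ not (cyc p (R D C x) (R D B p))
    crossing-sign {p} {x} hp hx (p≢x , c) =
      solve 4 (λ p q x y → (cyc′ p x q xor′ cyc′ p y q) ≈ true′ ⊢ p ≄ x ⊢ p ≄ q ⊢ x ≄ q ⊢ x ≄ y ⊢ p ≄ y ⊢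
          q ≄ y ⊢
                 ⊢ cyc′ x q y ≈ not′ (cyc′ p y q)) refl
        (p ∷ R D B p ∷ x ∷ R D C x ∷ []) c p≢x (A≢R isB hp hp) (A≢R isB hp hx)
        (A≢R isC hx hx) (A≢R isC hx hp) (R≢R isB hp hx)

    hub-sign : ∀ {p} → IsA D p → cyc p (R D B p) (R D C p) ≡ not (cyc p (R D C p) (R D B p))
    hub-sign {p} hp =
      solve 3 (λ p q y → p ≄ q ⊢ p ≄ y ⊢ q ≄ y ⊢ ⊢ cyc′ p q y ≈ not′ (cyc′ p y q)) refl
        (p ∷ R D B p ∷ R D C p ∷ []) (A≢R isB hp hp) (A≢R isC hp hp) (R≢R isB hp hp)

  swapDiagram : Diagram → Diagram
  swapDiagram D = record { ℓ = λ p → swapLetter (ℓ D p) ; R = λ ε → R D (swapLetter ε) }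

  module Swap {D : Diagram} where

    swap-IsA : ∀ {p} → IsA D p → IsA (swapDiagram D) p
    swap-IsA (h , e) = h , cong swapLetter e

    unswap-IsA : ∀ {p} → IsA (swapDiagram D) p → IsA D p
    unswap-IsA (h , e) = h , trans (sym (swapLetter-involutive _)) (cong swapLetter e)

    swap-On : ∀ {ε p x} → ArcColour ε → On D ε p x → On (swapDiagram D) (swapLetter ε) p x
    swap-On isB (h , c) = swap-IsA h , c
    swap-On isC (h , c) = swap-IsA h , c

    unswap-On : ∀ {ε p x} → ArcColour ε → On (swapDiagram D) (swapLetter ε) p x → On D ε p x
    unswap-On isB (h , c) = unswap-IsA h , c
    unswap-On isC (h , c) = unswap-IsA h , c

    swap-Before : ∀ {ε p x z} → ArcColour ε → Before D ε p x z →
        Before (swapDiagram D) (swapLetter ε) p x z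
    swap-Before isB b = b
    swap-Before isC b = b

    unswap-Before : ∀ {ε p x z} → ArcColour ε → Before (swapDiagram D) (swapLetter ε) p x z →
        Before D ε p x z
    unswap-Before isB b = b
    unswap-Before isC b = b

    swap-start : ∀ {ε p x} → ArcColour ε → x ≡ p ⊎ On D ε p x →
        x ≡ p ⊎ On (swapDiagram D) (swapLetter ε) p x
    swap-start e (inj₁ q) = inj₁ q
    swap-start e (inj₂ o) = inj₂ (swap-On e o)

    swap-Succ : ∀ {ε p x z} → ArcColour ε → Succ D ε p x z → Succ (swapDiagram D) (swapLetter ε) p x z
    swap-Succ e (mkSucc h s o b i) = mkSucc (swap-IsA h) (swap-start e s) (swap-On e o) (swap-Before e b)
      λ w o b b′ → i w (unswap-On e o) (unswap-Before e b) (unswap-Before e b′)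

    swap-Last : ∀ {ε p x} → ArcColour ε → Last D ε p x → Last (swapDiagram D) (swapLetter ε) p x
    swap-Last e (mkLast h s m) = mkLast (swap-IsA h) (swap-start e s) λ w o b →
        m w (unswap-On e o) (unswap-Before e b)

  swap-wellFormed : ∀ {D} → WellFormed D → WellFormed (swapDiagram D)
  swap-wellFormed {D} wf e = record
    { target = λ h → proj₁ (M.target (unswap-IsA h)) ,
        trans (cong swapLetter (proj₂ (M.target (unswap-IsA h)))) (swapLetter-involutive _)
    ; source = λ h q → let p , h′ , q′ = M.source h (trans (sym (swapLetter-involutive _)) (cong swapLetter q))
                       in p , swap-IsA h′ , q′
    ; noncrossing = λ hp hr → M.noncrossing (unswap-IsA hp) (unswap-IsA hr) }
    where open Swap {D}
          module M = Matching (wf (swapColour e))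

  swapVertex : Vertex → Vertex
  swapVertex (c , i , j) = (c , j , i)

  -- The disk is not reflected: renaming B and C reverses the cyclic order of the colours, and
  -- `sign` is negated at the same time, by `crossing-sign` at crossings and by `hub-sign` at hubs.
  swapIso : ∀ {D} → WellFormed D → Iso (λ p → p) false D (swapDiagram D)
  swapIso {D} wf = record
    { f = swapVertex ; g = swapVertex ; f-valid = f-valid ; g-valid = g-valid
    ; gf = λ _ _ → refl ; fg = λ _ _ → refl ; colour = λ _ → refl
    ; π = λ _ → swapLetter
    ; turn = turn ; edge = edge ; boundary = boundary }
    where
    open Swap {D}
    open WellFormedProperties wf
    f-valid : ∀ v → Valid D v → Valid (swapDiagram D) (swapVertex v)
    f-valid v (hi , hj , inj₁ (c , e)) = swap-IsA hj , swap-IsA hi , inj₁ (c , sym e)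
    f-valid v (hi , hj , inj₂ c) = swap-IsA hj , swap-IsA hi , inj₂ (crosses-sym isB hi hj c)
    g-valid : ∀ v → Valid (swapDiagram D) v → Valid D (swapVertex v)
    g-valid v (hi , hj , inj₁ (c , e)) = unswap-IsA hj , unswap-IsA hi , inj₁ (c , sym e)
    g-valid v (hi , hj , inj₂ c) =
      unswap-IsA hj , unswap-IsA hi , inj₂ (crosses-sym isC (unswap-IsA hi) (unswap-IsA hj) c)
    orient-swap : ∀ s c → swapLetter (orient s c) ≡ orient (not s) (swapLetter c)
    orient-swap false A = refl
    orient-swap false B = refl
    orient-swap false C = refl
    orient-swap true A = refl
    orient-swap true B = refl
    orient-swap true C = refl
    turn : ∀ v → Valid D v → ∀ c →
        swapLetter (orient (sign D v) c) ≡ orient (sign (swapDiagram D) (swapVertex v)) (swapLetter c)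
    turn (_ , i , .i) (hi , hj , inj₁ (_ , refl)) c =
      trans (orient-swap _ c) (cong (λ s → orient s (swapLetter c)) (sym (hub-sign hi)))
    turn (_ , i , j) (hi , hj , inj₂ x) c =
      trans (orient-swap _ c) (cong (λ s → orient s (swapLetter c)) (sym (crossing-sign hi hj x)))
    edge : ∀ v → Valid D v → ∀ c t → Edge D v c t → Edge (swapDiagram D) (swapVertex v) (swapLetter c)
        (mapTarget (λ p → p) swapVertex t)
    edge v h c t hub = hub
    edge v h c t (out n) = out (λ q → n (sym q))
    edge v h c t (into n) = into (λ q → n (sym q))
    edge v h c t (fwd isB s) = fwd isC (swap-Succ isB s)
    edge v h c t (fwd isC s) = fwd isB (swap-Succ isC s)
    edge v h c t (bwd isB s) = bwd isC (swap-Succ isB s)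
    edge v h c t (bwd isC s) = bwd isB (swap-Succ isC s)
    edge v h c t (end isB s) = end isC (swap-Last isB s)
    edge v h c t (end isC s) = end isB (swap-Last isC s)
    boundary : ∀ j v → BoundaryEdge D j v → BoundaryEdge (swapDiagram D) j (swapVertex v)
    boundary j v (atA h) = atA (swap-IsA h)
    boundary j v (atEnd isB s) = atEnd isC (swap-Last isB s)
    boundary j v (atEnd isC s) = atEnd isB (swap-Last isC s)

  -- Transport along a symmetry of the boundary circle.

  record Relabelling (ρ ρ⁻¹ : ℕ → ℕ) (o : Bool) (D D′ : Diagram) : Set where
    field
      ρ<N : ∀ {p} → p < N → ρ p < N
      ρ⁻¹<N : ∀ {p} → p < N → ρ⁻¹ p < N
      ρ⁻¹ρ : ∀ {p} → p < N → ρ⁻¹ (ρ p) ≡ p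
      ρρ⁻¹ : ∀ {p} → p < N → ρ (ρ⁻¹ p) ≡ p
      -- Distinctness matters for a reversal: with a repeated point `cyc` is false before and after,
      -- so it cannot be negated.
      cyc-ρ : ∀ {x y z} → x < N → y < N → z < N → x ≢ y → x ≢ z → y ≢ z →
              cyc (ρ x) (ρ y) (ρ z) ≡ o xor cyc x y z
      letter : ∀ {p} → p < N → ℓ D′ (ρ p) ≡ ℓ D p
      chord : ∀ {ε p} → ArcColour ε → IsA D p → R D′ ε (ρ p) ≡ ρ (R D ε p)

  module Relabel {ρ ρ⁻¹ o D D′} (rl : Relabelling ρ ρ⁻¹ o D D′) (wf : WellFormed D) where
    open Relabelling rl
    open WellFormedProperties wf

    ρ-injective : ∀ {p q} → p < N → q < N → ρ p ≡ ρ q → p ≡ q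
    ρ-injective hp hq e = trans (sym (ρ⁻¹ρ hp)) (trans (cong ρ⁻¹ e) (ρ⁻¹ρ hq))

    ρ-IsA : ∀ {p} → IsA D p → IsA D′ (ρ p)
    ρ-IsA (h , e) = ρ<N h , trans (letter h) e

    ρ⁻¹-IsA : ∀ {p} → IsA D′ p → IsA D (ρ⁻¹ p)
    ρ⁻¹-IsA (h , e) = ρ⁻¹<N h , trans (sym (letter (ρ⁻¹<N h))) (trans (cong (ℓ D′) (ρρ⁻¹ h)) e)

    side-ρ : ∀ {ε p u} → ArcColour ε → IsA D p → u < N → p ≢ u → u ≢ R D ε p →
             side D′ ε (ρ p) (ρ u) ≡ o xor side D ε p u
    side-ρ {ε} {p} {u} e hp hu p≢u u≢R = trans (cong (cyc (ρ p) (ρ u)) (chord e hp))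
      (cyc-ρ (proj₁ hp) hu (R<N e hp) p≢u (A≢R e hp hp) u≢R)

    side-ρ-R : ∀ {ε p x} → ArcColour ε → IsA D p → IsA D x →
               side D′ ε (ρ p) (R D′ (swapLetter ε) (ρ x)) ≡ o xor side D ε p (R D (swapLetter ε) x)
    side-ρ-R {ε} {p} {x} e hp hx = trans (cong (side D′ ε (ρ p)) (chord (swapColour e) hx))
      (side-ρ e hp (R<N (swapColour e) hx) (A≢R (swapColour e) hx hp) (λ q → R≢R e hp hx (sym q)))

    sep-ρ : ∀ {ε p u v} → ArcColour ε → IsA D p → IsA D u → IsA D v → p ≢ u → p ≢ v →
            (side D′ ε (ρ p) (ρ u) xor side D′ ε (ρ p) (ρ v)) ≡ (side D ε p u xor side D ε p v)
    sep-ρ {ε} {p} {u} {v} e hp hu hv p≢u p≢v =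
      trans (cong₂ _xor_ (side-ρ e hp (proj₁ hu) p≢u (A≢R e hp hu))
          (side-ρ e hp (proj₁ hv) p≢v (A≢R e hp hv)))
            (xor-shift o _ _)

    cross-ρ : ∀ {ε p x} → ArcColour ε → IsA D p → IsA D x → p ≢ x →
      (side D′ ε (ρ p) (ρ x) xor side D′ ε (ρ p) (R D′ (swapLetter ε) (ρ x))) ≡
      (side D ε p x xor side D ε p (R D (swapLetter ε) x))
    cross-ρ {ε} {p} {x} e hp hx p≢x =
      trans (cong₂ _xor_ (side-ρ e hp (proj₁ hx) p≢x (A≢R e hp hx)) (side-ρ-R e hp hx)) (xor-shift o _ _)

    ρ-Crosses : ∀ {ε p x} → ArcColour ε → IsA D p → IsA D x → Crosses D ε p x → Crosses D′ ε (ρ p) (ρ x)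
    ρ-Crosses e hp hx (n , c) =
        (λ q → n (ρ-injective (proj₁ hp) (proj₁ hx) q)) , trans (cross-ρ e hp hx n) c

    unρ-Crosses : ∀ {ε p x} → ArcColour ε → IsA D p → IsA D x → Crosses D′ ε (ρ p) (ρ x) →
        Crosses D ε p x
    unρ-Crosses {p = p} e hp hx (n , c) = n′ , trans (sym (cross-ρ e hp hx n′)) c
      where n′ = λ q → n (cong ρ q)

    ρ-On : ∀ {ε p x} → ArcColour ε → IsA D p → On D ε p x → On D′ ε (ρ p) (ρ x)
    ρ-On e hp (hx , c) = ρ-IsA hx , ρ-Crosses e hp hx c

    ρ-Before : ∀ {ε p x z} → ArcColour ε → IsA D p → IsA D x → IsA D z →
               Before D ε p x z → Before D′ ε (ρ p) (ρ x) (ρ z)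
    ρ-Before e hp hx hz (inj₁ q) = inj₁ (cong ρ q)
    ρ-Before {ε} {p} {x} e hp hx hz (inj₂ (n , b)) with x ≟ p
    ... | yes q = inj₁ (cong ρ q)
    ... | no n′ = inj₂ ((λ q → n (ρ-injective (proj₁ hx) (proj₁ hz) q)) ,
                        trans (sep-ρ (swapColour e) hx hp hz n′ n) b)

    unρ-Before : ∀ {ε p x z} → ArcColour ε → IsA D p → IsA D x → IsA D z →
                 Before D′ ε (ρ p) (ρ x) (ρ z) → Before D ε p x z
    unρ-Before e hp hx hz (inj₁ q) = inj₁ (ρ-injective (proj₁ hx) (proj₁ hp) q)
    unρ-Before {ε} {p} {x} e hp hx hz (inj₂ (n , b)) with x ≟ p
    ... | yes q = inj₁ q
    ... | no n′ = inj₂ ((λ q → n (cong ρ q)) , trans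
        (sym (sep-ρ (swapColour e) hx hp hz n′ (λ q → n (cong ρ q)))) b)

    start-IsA : ∀ {ε p x} → IsA D p → x ≡ p ⊎ On D ε p x → IsA D x
    start-IsA hp (inj₁ refl) = hp
    start-IsA hp (inj₂ (hx , _)) = hx

    ρ-start : ∀ {ε p x} → ArcColour ε → IsA D p → x ≡ p ⊎ On D ε p x → ρ x ≡ ρ p ⊎ On D′ ε (ρ p) (ρ x)
    ρ-start e hp (inj₁ q) = inj₁ (cong ρ q)
    ρ-start e hp (inj₂ q) = inj₂ (ρ-On e hp q)

    unρ-On : ∀ {ε p} → ArcColour ε → IsA D p → ∀ w → On D′ ε (ρ p) w → Σ ℕ λ u → w ≡ ρ u × On D ε p u
    unρ-On {ε} {p} e hp w (hw , c) = ρ⁻¹ w , sym (ρρ⁻¹ (proj₁ hw)) , ρ⁻¹-IsA hw ,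
      unρ-Crosses e hp (ρ⁻¹-IsA hw) (subst (Crosses D′ ε (ρ p)) (sym (ρρ⁻¹ (proj₁ hw))) c)

    ρ-Succ : ∀ {ε p x z} → ArcColour ε → Succ D ε p x z → Succ D′ ε (ρ p) (ρ x) (ρ z)
    ρ-Succ {ε} {p} {x} {z} e (mkSucc hp s o b i) =
      mkSucc (ρ-IsA hp) (ρ-start e hp s) (ρ-On e hp o) (ρ-Before e hp hx hz b) imm
      where
      hx = start-IsA hp s
      hz = proj₁ o
      imm : ∀ w → On D′ ε (ρ p) w → Before D′ ε (ρ p) (ρ x) w → Before D′ ε (ρ p) w (ρ z) → ⊥
      imm w ow bw bw′ with unρ-On e hp w ow
      ... | u , refl , ou = i u ou (unρ-Before e hp hx (proj₁ ou) bw) (unρ-Before e hp (proj₁ ou) hz bw′)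

    ρ-Last : ∀ {ε p x} → ArcColour ε → Last D ε p x → Last D′ ε (ρ p) (ρ x)
    ρ-Last {ε} {p} {x} e (mkLast hp s m) = mkLast (ρ-IsA hp) (ρ-start e hp s) mx
      where
      mx : ∀ w → On D′ ε (ρ p) w → Before D′ ε (ρ p) (ρ x) w → ⊥
      mx w ow bw with unρ-On e hp w ow
      ... | u , refl , ou = m u ou (unρ-Before e hp (start-IsA hp s) (proj₁ ou) bw)

    ρV ρ⁻¹V : Vertex → Vertex
    ρV (c , i , j) = (c , ρ i , ρ j)
    ρ⁻¹V (c , i , j) = (c , ρ⁻¹ i , ρ⁻¹ j)

    ρV-place : ∀ {ε} c p x → ArcColour ε → ρV (c , place ε p x) ≡ (c , place ε (ρ p) (ρ x))
    ρV-place c p x isB = refl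
    ρV-place c p x isC = refl

    relabelIso : Iso ρ o D D′
    relabelIso = record
      { f = ρV ; g = ρ⁻¹V ; f-valid = f-valid ; g-valid = g-valid
      ; gf = λ { (c , i , j) (hi , hj , _) →
          cong₂ (λ i j → c , i , j) (ρ⁻¹ρ (proj₁ hi)) (ρ⁻¹ρ (proj₁ hj)) }
      ; fg = λ { (c , i , j) (hi , hj , _) →
          cong₂ (λ i j → c , i , j) (ρρ⁻¹ (proj₁ hi)) (ρρ⁻¹ (proj₁ hj)) }
      ; colour = λ _ → refl ; π = λ _ c → c
      ; turn = λ { (b , i , j) (hi , hj , _) c →
          cong (λ s → orient s c) (sym (trans (cong (o xor_) (side-ρ-R isB hi hj)) (xor-cancel o _))) }
      ; edge = edge ; boundary = boundary }
      where
      f-valid : ∀ v → Valid D v → Valid D′ (ρV v)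
      f-valid v (hi , hj , inj₁ (c , q)) = ρ-IsA hi , ρ-IsA hj , inj₁ (c , cong ρ q)
      f-valid v (hi , hj , inj₂ c) = ρ-IsA hi , ρ-IsA hj , inj₂ (ρ-Crosses isB hi hj c)
      g-valid : ∀ v → Valid D′ v → Valid D (ρ⁻¹V v)
      g-valid v (hi , hj , inj₁ (c , q)) = ρ⁻¹-IsA hi , ρ⁻¹-IsA hj , inj₁ (c , cong ρ⁻¹ q)
      g-valid v (hi , hj , inj₂ c) =
          ρ⁻¹-IsA hi , ρ⁻¹-IsA hj , inj₂ (unρ-Crosses isB (ρ⁻¹-IsA hi) (ρ⁻¹-IsA hj)
        (subst₂ (Crosses D′ B) (sym (ρρ⁻¹ (proj₁ hi))) (sym (ρρ⁻¹ (proj₁ hj))) c))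
      edge : ∀ v → Valid D v → ∀ c t → Edge D v c t → Edge D′ (ρV v) c (mapTarget ρ ρV t)
      edge v h c t hub = hub
      edge v (hi , hj , _) c t (out n) = out (λ q → n (ρ-injective (proj₁ hi) (proj₁ hj) q))
      edge v (hi , hj , _) c t (into n) = into (λ q → n (ρ-injective (proj₁ hi) (proj₁ hj) q))
      edge v h c t (fwd {p = p} {x} {z} e s) rewrite ρV-place true p x e | ρV-place false p z e =
          fwd e (ρ-Succ e s)
      edge v h c t (bwd {p = p} {x} {z} e s) rewrite ρV-place true p x e | ρV-place false p z e =
          bwd e (ρ-Succ e s)
      edge v h c t (end {p = p} {x} e s) rewrite ρV-place true p x e | sym (chord e (Last.isA s)) =
          end e (ρ-Last e s)
      boundary : ∀ j v → BoundaryEdge D j v → BoundaryEdge D′ (ρ j) (ρV v)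
      boundary j v (atA h) = atA (ρ-IsA h)
      boundary j v (atEnd {p = p} {x} e s) rewrite ρV-place true p x e | sym (chord e (Last.isA s)) =
          atEnd e (ρ-Last e s)

    relabelled-wellFormed : WellFormed D′
    relabelled-wellFormed {ε} e = record { target = target ; source = source ; noncrossing =
        noncrossing }
      where
      module M = Matching (wf e)
      target : ∀ {p} → IsA D′ p → R D′ ε p < N × ℓ D′ (R D′ ε p) ≡ ε
      target {p} h = subst (λ q → q < N × ℓ D′ q ≡ ε)
        (trans (sym (chord e h′)) (cong (R D′ ε) (ρρ⁻¹ (proj₁ h))))
        (ρ<N (R<N e h′) , trans (letter (R<N e h′)) (ℓR e h′))
        where h′ = ρ⁻¹-IsA h
      source : ∀ {j} → j < N → ℓ D′ j ≡ ε → Σ ℕ λ p → IsA D′ p × R D′ ε p ≡ j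
      source {j} h q with M.source (ρ⁻¹<N h) (trans (sym (letter (ρ⁻¹<N h)))
          (trans (cong (ℓ D′) (ρρ⁻¹ h)) q))
      ... | p , hp , r = ρ p , ρ-IsA hp , trans (chord e hp) (trans (cong ρ r) (ρρ⁻¹ h))
      noncrossing′ : ∀ {p r} → IsA D p → IsA D r → p ≢ r →
          side D′ ε (ρ p) (ρ r) ≡ side D′ ε (ρ p) (R D′ ε (ρ r))
      noncrossing′ {p} {r} hp hr n = trans (side-ρ e hp (proj₁ hr) n (A≢R e hp hr))
        (trans (cong (o xor_) (M.noncrossing hp hr n))
        (trans (sym (side-ρ e hp (R<N e hr) (A≢R e hr hp) (λ q → n (sym (R-injective e hr hp q)))))
               (cong (side D′ ε (ρ p)) (sym (chord e hr)))))
      noncrossing : ∀ {p r} → IsA D′ p → IsA D′ r → p ≢ r → side D′ ε p r ≡ side D′ ε p (R D′ ε r)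
      noncrossing {p} {r} hp hr n =
        subst₂ (λ p r → side D′ ε p r ≡ side D′ ε p (R D′ ε r)) (ρρ⁻¹ (proj₁ hp)) (ρρ⁻¹ (proj₁ hr))
          (noncrossing′ (ρ⁻¹-IsA hp) (ρ⁻¹-IsA hr)
            (λ q → n (trans (sym (ρρ⁻¹ (proj₁ hp))) (trans (cong ρ q) (ρρ⁻¹ (proj₁ hr))))))

-- Switching a chord

isA? : ∀ c → Dec (c ≡ A)
isA? A = yes refl
isA? B = no λ ()
isA? C = no λ ()

-- By `a-far` and `forward` every C-chord from a or across a → b leads from the interval to its
-- complement. Switching permutes the A-ends of these chords within the interval; a chord entering
-- the interval would have its A-end on the wrong side.
record Switchable (N : ℕ) (D : Diagram) (a b : ℕ) : Set where
  open Diagrams N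
  field
    wf : WellFormed D
    a-isA : IsA D a
    Ra : R D B a ≡ b
    a<b : a < b
    a-far : ((R D C a <ᵇ a) ∨ (b <ᵇ R D C a)) ≡ true
    forward : ∀ {x} → IsA D x → a < R D C x → R D C x < b → a < x × x < b

module Switch {N D a b} (sw : Switchable N D a b) where
  open Diagrams N
  open Switchable sw
  open WellFormedProperties wf public

  b<N : b < N
  b<N = subst (_< N) Ra (R<N isB a-isA)

  ℓb : ℓ D b ≡ B
  ℓb = trans (cong (ℓ D) (sym Ra)) (ℓR isB a-isA)

  -- `Outside` is a Boolean equation because a disjunction can then be given to `solve` as a single
  -- hypothesis.
  Inside Outside : ℕ → Set
  Inside u = a < u × u < b
  Outside u = ((u <ᵇ a) ∨ (b <ᵇ u)) ≡ true

  inside? : ∀ u → Dec (Inside u)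
  inside? u = (a <? u) ×-dec (u <? b)

  outside? : ∀ u → Dec (Outside u)
  outside? u = ((u <ᵇ a) ∨ (b <ᵇ u)) ≟ᵇ true

  Closed Coclosed : ℕ → Set
  Closed u = a ≤ u × u ≤ b
  Coclosed u = ((a <ᵇ u) ∧ (u <ᵇ b)) ≡ false

  inside-closed : ∀ {u} → Inside u → Closed u
  inside-closed (h , h′) = <⇒≤ h , <⇒≤ h′

  a-closed : Closed a
  a-closed = ≤-refl , <⇒≤ a<b

  b-closed : Closed b
  b-closed = <⇒≤ a<b , ≤-refl

  outside-coclosed : ∀ {u} → Outside u → Coclosed u
  outside-coclosed {u} = solve 3 (λ a b u → a ≺ b ⊢ (u <′ a ∨′ b <′ u) ≈ true′ ⊢ ⊢
      (a <′ u ∧′ u <′ b) ≈ not′ true′) refl (a ∷ b ∷ u ∷ []) a<b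

  a-coclosed : Coclosed a
  a-coclosed = solve 2 (λ a b → ⊢ (a <′ a ∧′ a <′ b) ≈ not′ true′) refl (a ∷ b ∷ [])

  b-coclosed : Coclosed b
  b-coclosed = solve 2 (λ a b → ⊢ (a <′ b ∧′ b <′ b) ≈ not′ true′) refl (a ∷ b ∷ [])

  outside-not-inside : ∀ {u} → Outside u → Inside u → ⊥
  outside-not-inside {u} o (h , h′) = <-irrefl refl
    (solve 3 (λ a b u → (u <′ a ∨′ b <′ u) ≈ true′ ⊢ a ≺ u ⊢ u ≺ b ⊢ ⊢ a ≺ a) refl (a ∷ b ∷ u ∷ []) o h
        h′)

  outside-not-closed : ∀ {u} → Outside u → Closed u → ⊥
  outside-not-closed {u} o (h , h′) = <-irrefl refl
    (solve 3 (λ a b u → (u <′ a ∨′ b <′ u) ≈ true′ ⊢ a ≼ u ⊢ u ≼ b ⊢ ⊢ a ≺ a) refl (a ∷ b ∷ u ∷ []) o h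
        h′)

  data Location (u : ℕ) : Set where
    at-a : u ≡ a → Location u
    at-b : u ≡ b → Location u
    inside : Inside u → Location u
    outside : Outside u → Location u

  locate : ∀ u → Location u
  locate u with u ≟ a | u ≟ b | inside? u
  ... | yes q | _ | _ = at-a q
  ... | no _ | yes q | _ = at-b q
  ... | no _ | no _ | yes h = inside h
  ... | no u≢a | no u≢b | no h with a <? u | u <? b
  ... | yes p | yes q = ⊥-elim (h (p , q))
  ... | no p | _ = outside (solve 3 (λ a b u → u ≼ a ⊢ u ≄ a ⊢ ⊢ (u <′ a ∨′ b <′ u) ≈ true′) refl
      (a ∷ b ∷ u ∷ []) (≮⇒≥ p) u≢a)
  ... | yes _ | no p = outside (solve 3 (λ a b u → b ≼ u ⊢ u ≄ b ⊢ ⊢ (u <′ a ∨′ b <′ u) ≈ true′) refl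
      (a ∷ b ∷ u ∷ []) (≮⇒≥ p) u≢b)

  inside-cyc : ∀ {u} → Inside u → cyc a u b ≡ true
  inside-cyc {u} (h , h′) = solve 3 (λ a b u → a ≺ u ⊢ u ≺ b ⊢ ⊢ cyc′ a u b ≈ true′) refl
      (a ∷ b ∷ u ∷ []) h h′

  outside-cyc : ∀ {u} → Outside u → cyc a u b ≡ false
  outside-cyc {u} = solve 3 (λ a b u → a ≺ b ⊢ (u <′ a ∨′ b <′ u) ≈ true′ ⊢ ⊢
      cyc′ a u b ≈ not′ true′) refl (a ∷ b ∷ u ∷ []) a<b

  inside-cyc′ : ∀ {u} → Inside u → cyc b u a ≡ false
  inside-cyc′ {u} (h , h′) = solve 3 (λ a b u → a ≺ u ⊢ u ≺ b ⊢ ⊢ cyc′ b u a ≈ not′ true′) refl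
      (a ∷ b ∷ u ∷ []) h h′

  outside-cyc′ : ∀ {u} → Outside u → cyc b u a ≡ true
  outside-cyc′ {u} = solve 3 (λ a b u → a ≺ b ⊢ (u <′ a ∨′ b <′ u) ≈ true′ ⊢ ⊢ cyc′ b u a ≈ true′) refl
      (a ∷ b ∷ u ∷ []) a<b

  -- The complement of the open interval is connected on the circle and contains no end of the
  -- chord, so it lies on one side; which side depends only on the direction of the chord.
  inside-chord : ∀ {p q u v} → p ≢ q → Inside p → Inside q → Coclosed u → Coclosed v →
      cyc p u q ≡ cyc p v q
  inside-chord {p} {q} {u} {v} n (h₁ , h₂) (h₃ , h₄) =
    λ hu hv → trans (value u hu) (sym (value v hv))
    where
    value : ∀ u → Coclosed u → cyc p u q ≡ (q <ᵇ p)
    value u hu = solve 5 (λ a b p q u → p ≄ q ⊢ a ≺ p ⊢ p ≺ b ⊢ a ≺ q ⊢ q ≺ b ⊢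
        (a <′ u ∧′ u <′ b) ≈ not′ true′ ⊢
               ⊢ cyc′ p u q ≈ q <′ p) refl (a ∷ b ∷ p ∷ q ∷ u ∷ []) n h₁ h₂ h₃ h₄ hu

  outside-chord : ∀ {p q u v} → p ≢ q → Outside p → Outside q → Closed u → Closed v →
      cyc p u q ≡ cyc p v q
  outside-chord {p} {q} {u} {v} n hp hq hu hv = trans (value u hu) (sym (value v hv))
    where
    value : ∀ u → Closed u → cyc p u q ≡ cyc p a q
    value u (h , h′) = solve 5 (λ a b p q u → a ≺ b ⊢ p ≄ q ⊢ (p <′ a ∨′ b <′ p) ≈ true′ ⊢
        (q <′ a ∨′ b <′ q) ≈ true′ ⊢
               a ≼ u ⊢ u ≼ b ⊢ ⊢ cyc′ p u q ≈ cyc′ p a q) refl (a ∷ b ∷ p ∷ q ∷ u ∷ []) a<b n hp hq h h′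

  -- For a chord leaving the interval, the position of its far end is invisible from inside;
  -- `through-outer` says that the position of its near end is invisible from outside. This is why
  -- the A-ends can be shifted independently of the far ends.
  through-inner : ∀ {x u y} → Closed x → Closed u → Outside y → cyc x u y ≡ (x <ᵇ u)
  through-inner {x} {u} {y} (h₁ , h₂) (h₃ , h₄) hy =
    solve 5 (λ a b x u y → a ≼ x ⊢ x ≼ b ⊢ a ≼ u ⊢ u ≼ b ⊢ (y <′ a ∨′ b <′ y) ≈ true′ ⊢ ⊢
        cyc′ x u y ≈ x <′ u) refl
      (a ∷ b ∷ x ∷ u ∷ y ∷ []) h₁ h₂ h₃ h₄ hy

  through-outer : ∀ {x x′ u y} → Closed x → Closed x′ → Outside u → Outside y → cyc x u y ≡ cyc x′ u y
  through-outer {x} {x′} {u} {y} hx hx′ hu hy = trans (value x hx) (sym (value x′ hx′))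
    where
    value : ∀ x → Closed x → cyc x u y ≡ cyc b u y
    value x (h₁ , h₂) = solve 5 (λ a b x u y → a ≼ x ⊢ x ≼ b ⊢ (u <′ a ∨′ b <′ u) ≈ true′ ⊢
        (y <′ a ∨′ b <′ y) ≈ true′ ⊢
      ⊢ cyc′ x u y ≈ cyc′ b u y) refl (a ∷ b ∷ x ∷ u ∷ y ∷ []) h₁ h₂ hu hy

  Through : ℕ → Set
  Through x = IsA D x × Inside x × Outside (R D C x)

  through? : ∀ x → Dec (Through x)
  through? x = ((x <? N) ×-dec isA? (ℓ D x)) ×-dec (inside? x ×-dec outside? (R D C x))

  Source Target : ℕ → Set
  Source x = x ≡ a ⊎ Through x
  Target x = x ≡ b ⊎ Through x

  source? : ∀ x → Dec (Source x)
  source? x = (x ≟ a) ⊎-dec through? x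

  target? : ∀ x → Dec (Target x)
  target? x = (x ≟ b) ⊎-dec through? x

  -- Switching replaces the C-chords x₁ = a < x₂ < … < x_k meeting a → b, with other ends
  -- y₁, …, y_k, by the chords from x₂, …, x_k, b to y₁, …, y_k. Step is this shift of the A-ends.
  record Step (x z : ℕ) : Set where
    constructor mkStep
    field
      source : Source x
      target : Target z
      x<z : x < z
      gap : ∀ w → x < w → w < z → Through w → ⊥

  source-isA : ∀ {x} → Source x → IsA D x
  source-isA (inj₁ refl) = a-isA
  source-isA (inj₂ (h , _)) = h

  source-closed : ∀ {x} → Source x → Closed x
  source-closed (inj₁ refl) = a-closed
  source-closed (inj₂ (_ , h , _)) = inside-closed h

  target-closed : ∀ {x} → Target x → Closed x
  target-closed (inj₁ refl) = b-closed
  target-closed (inj₂ (_ , h , _)) = inside-closed h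

  source-far : ∀ {x} → Source x → Outside (R D C x)
  source-far (inj₁ refl) = a-far
  source-far (inj₂ (_ , _ , h)) = h

  source<b : ∀ {x} → Source x → x < b
  source<b (inj₁ refl) = a<b
  source<b (inj₂ (_ , (_ , h) , _)) = h

  a<target : ∀ {x} → Target x → a < x
  a<target (inj₁ refl) = a<b
  a<target (inj₂ (_ , (h , _) , _)) = h

  step-functional : ∀ {x z z′} → Step x z → Step x z′ → z ≡ z′
  step-functional {x} {z} {z′} (mkStep s t l g) (mkStep s′ t′ l′ g′) with <-cmp z z′
  ... | tri≈ _ q _ = q
  step-functional (mkStep s (inj₂ t) l g) (mkStep s′ t′ l′ g′) | tri< h _ _ = ⊥-elim (g′ _ l h t)
  step-functional (mkStep s (inj₁ refl) l g) (mkStep s′ t′ l′ g′) | tri< h _ _ =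
      ⊥-elim (<⇒≱ h (proj₂ (target-closed t′)))
  step-functional (mkStep s t l g) (mkStep s′ (inj₂ t′) l′ g′) | tri> _ _ h = ⊥-elim (g _ l′ h t′)
  step-functional (mkStep s t l g) (mkStep s′ (inj₁ refl) l′ g′) | tri> _ _ h =
      ⊥-elim (<⇒≱ h (proj₂ (target-closed t)))

  step-injective : ∀ {x x′ z} → Step x z → Step x′ z → x ≡ x′
  step-injective {x} {x′} {z} (mkStep s t l g) (mkStep s′ t′ l′ g′) with <-cmp x x′
  ... | tri≈ _ q _ = q
  step-injective (mkStep s t l g) (mkStep (inj₂ s′) t′ l′ g′) | tri< h _ _ = ⊥-elim (g _ h l′ s′)
  step-injective (mkStep s t l g) (mkStep (inj₁ refl) t′ l′ g′) | tri< h _ _ =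
      ⊥-elim (<⇒≱ h (proj₁ (source-closed s)))
  step-injective (mkStep (inj₂ s) t l g) (mkStep s′ t′ l′ g′) | tri> _ _ h = ⊥-elim (g′ _ h l s)
  step-injective (mkStep (inj₁ refl) t l g) (mkStep s′ t′ l′ g′) | tri> _ _ h =
      ⊥-elim (<⇒≱ h (proj₁ (source-closed s′)))

  abstract
    -- The search runs upwards from `suc x`, and d is the distance left to b; it succeeds at the
    -- latest at b, which is itself a target. `prev` searches downwards to a in the same way.
    next : ∀ d {x} → suc x + d ≡ b → Σ ℕ λ z → Target z × x < z × (∀ w → x < w → w < z → Through w → ⊥)
    next zero {x} e = suc x , inj₁ (trans (sym (+-identityʳ _)) e) , ≤-refl , λ w h h′ _ →
        <⇒≱ h (≤-pred h′)
    next (suc d) {x} e with through? (suc x)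
    ... | yes t = suc x , inj₂ t , ≤-refl , λ w h h′ _ → <⇒≱ h (≤-pred h′)
    ... | no ¬t with next d {suc x} (trans (sym (+-suc (suc x) d)) e)
    ... | z , t , l , g = z , t , <-trans (n<1+n x) l , λ w h h′ t′ → gap w h h′ t′ (m≤n⇒m<n∨m≡n h)
      where gap : ∀ w → x < w → w < z → Through w → suc x < w ⊎ suc x ≡ w → ⊥
            gap w h h′ t′ (inj₁ h″) = g w h″ h′ t′
            gap w h h′ t′ (inj₂ refl) = ¬t t′

    prev : ∀ d {z} → z ≡ suc a + d → Σ ℕ λ x → Source x × x < z × (∀ w → x < w → w < z → Through w → ⊥)
    prev zero {z} e = a , inj₁ refl , ≤-reflexive (sym e′) , λ w h h′ _ →
        <⇒≱ h (≤-pred (subst (w <_) e′ h′))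
      where e′ : z ≡ suc a
            e′ = trans e (+-identityʳ _)
    prev (suc d) {zero} e = ⊥-elim (absurd e)
      where absurd : 0 ≡ suc a + suc d → ⊥
            absurd ()
    prev (suc d) {suc z} e with through? z
    ... | yes t = z , inj₂ t , ≤-refl , λ w h h′ _ → <⇒≱ h (≤-pred h′)
    ... | no ¬t with prev d {z} (suc-injective (trans e (+-suc (suc a) d)))
    ... | x , s , l , g = x , s , <-trans l (n<1+n z) , λ w h h′ t′ →
        gap w h t′ (m≤n⇒m<n∨m≡n (≤-pred h′))
      where gap : ∀ w → x < w → Through w → w < z ⊎ w ≡ z → ⊥
            gap w h t′ (inj₁ h″) = g w h h″ t′
            gap w h t′ (inj₂ refl) = ¬t t′

    σ τ : ℕ → ℕ
    σ x with source? x
    ... | yes s = proj₁ (next (b ∸ suc x) (m+[n∸m]≡n (source<b s)))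
    ... | no _ = x
    τ z with target? z
    ... | yes t = proj₁ (prev (z ∸ suc a) (sym (m+[n∸m]≡n (a<target t))))
    ... | no _ = z

    σ-step : ∀ {x} → Source x → Step x (σ x)
    σ-step {x} s with source? x
    ... | no ¬s = ⊥-elim (¬s s)
    ... | yes s′ with next (b ∸ suc x) (m+[n∸m]≡n (source<b s′))
    ... | z , t , l , g = mkStep s t l g

    τ-step : ∀ {z} → Target z → Step (τ z) z
    τ-step {z} t with target? z
    ... | no ¬t = ⊥-elim (¬t t)
    ... | yes t′ with prev (z ∸ suc a) (sym (m+[n∸m]≡n (a<target t′)))
    ... | x , s , l , g = mkStep s t l g

    σ-id : ∀ {x} → ¬ Source x → σ x ≡ x
    σ-id {x} ¬s with source? x
    ... | yes s = ⊥-elim (¬s s)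
    ... | no _ = refl

    τ-id : ∀ {x} → ¬ Target x → τ x ≡ x
    τ-id {x} ¬s with target? x
    ... | yes s = ⊥-elim (¬s s)
    ... | no _ = refl

  σ-target : ∀ {x} → Source x → Target (σ x)
  σ-target s = Step.target (σ-step s)

  τ-source : ∀ {x} → Target x → Source (τ x)
  τ-source s = Step.source (τ-step s)

  σ-closed : ∀ {x} → Source x → Closed (σ x)
  σ-closed s = target-closed (σ-target s)

  σ-unique : ∀ {x z} → Step x z → σ x ≡ z
  σ-unique s = step-functional (σ-step (Step.source s)) s

  b-notA : IsA D b → ⊥
  b-notA h = A≢arc isB (trans (sym (proj₂ h)) ℓb)

  isA-not-b : ∀ {x} → IsA D x → x ≢ b
  isA-not-b h refl = b-notA h

  τσ : ∀ {x} → IsA D x → τ (σ x) ≡ x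
  τσ {x} h = helper (source? x)
    where
    helper : Dec (Source x) → τ (σ x) ≡ x
    helper (yes s) = step-injective (τ-step (σ-target s)) (σ-step s)
    helper (no ¬s) = trans (cong τ (σ-id ¬s))
        (τ-id λ { (inj₁ q) → isA-not-b h q ; (inj₂ t) → ¬s (inj₂ t) })

  σ-injective : ∀ {x z} → IsA D x → IsA D z → σ x ≡ σ z → x ≡ z
  σ-injective hx hz q = trans (sym (τσ hx)) (trans (cong τ q) (τσ hz))

  a≢b : a ≢ b
  a≢b = <⇒≢ a<b

  abstract
    ℓ′ : ℕ → Letter
    ℓ′ p with p ≟ a | p ≟ b
    ... | yes _ | _ = B
    ... | no _ | yes _ = A
    ... | no _ | no _ = ℓ D p

    ℓ′-a : ℓ′ a ≡ B
    ℓ′-a with a ≟ a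
    ... | yes _ = refl
    ... | no n = ⊥-elim (n refl)

    ℓ′-b : ℓ′ b ≡ A
    ℓ′-b with b ≟ a | b ≟ b
    ... | yes q | _ = ⊥-elim (a≢b (sym q))
    ... | no _ | yes _ = refl
    ... | no _ | no n = ⊥-elim (n refl)

    ℓ′-other : ∀ {p} → p ≢ a → p ≢ b → ℓ′ p ≡ ℓ D p
    ℓ′-other {p} n m with p ≟ a | p ≟ b
    ... | yes q | _ = ⊥-elim (n q)
    ... | no _ | yes q = ⊥-elim (m q)
    ... | no _ | no _ = refl

    RB′ : ℕ → ℕ
    RB′ p with p ≟ b
    ... | yes _ = a
    ... | no _ = R D B p

    R′B-b : RB′ b ≡ a
    R′B-b with b ≟ b
    ... | yes _ = refl
    ... | no n = ⊥-elim (n refl)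

    R′B-other : ∀ {p} → p ≢ b → RB′ p ≡ R D B p
    R′B-other {p} n with p ≟ b
    ... | yes q = ⊥-elim (n q)
    ... | no _ = refl

  R′ : Letter → ℕ → ℕ
  R′ A p = p
  R′ B p = RB′ p
  R′ C p = R D C (τ p)

  D′ : Diagram
  D′ = record { ℓ = ℓ′ ; R = R′ }

  R′C-σ : ∀ {x} → IsA D x → R′ C (σ x) ≡ R D C x
  R′C-σ h = cong (R D C) (τσ h)

  b-isA′ : IsA D′ b
  b-isA′ = b<N , ℓ′-b

  keep-isA : ∀ {p} → IsA D p → p ≢ a → IsA D′ p
  keep-isA (h , e) n = h , trans (ℓ′-other n (isA-not-b (h , e))) e

  unkeep-isA : ∀ {p} → IsA D′ p → p ≢ b → IsA D p
  unkeep-isA {p} (h , e) n = h , trans (sym (ℓ′-other (λ { refl → A≢arc isB (trans (sym e) ℓ′-a) }) n)) e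

  isA′-not-a : ∀ {p} → IsA D′ p → p ≢ a
  isA′-not-a (h , e) refl = A≢arc isB (trans (sym e) ℓ′-a)

  target-isA′ : ∀ {x} → Target x → IsA D′ x
  target-isA′ (inj₁ refl) = b-isA′
  target-isA′ (inj₂ (h , (l , _) , _)) = keep-isA h (λ q → <⇒≢ l (sym q))

  σ-isA′ : ∀ {x} → IsA D x → IsA D′ (σ x)
  σ-isA′ {x} h with source? x
  ... | yes s = target-isA′ (σ-target s)
  ... | no ¬s = subst (IsA D′) (sym (σ-id ¬s)) (keep-isA h (λ q → ¬s (inj₁ q)))

  τ-isA : ∀ {x} → IsA D′ x → IsA D (τ x)
  τ-isA {x} h with target? x
  ... | yes t = source-isA (τ-source t)
  ... | no ¬t = subst (IsA D) (sym (τ-id ¬t)) (unkeep-isA h (λ q → ¬t (inj₁ q)))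

  στ : ∀ {x} → IsA D′ x → σ (τ x) ≡ x
  στ {x} h = helper (target? x)
    where
    helper : Dec (Target x) → σ (τ x) ≡ x
    helper (yes t) = step-functional (σ-step (τ-source t)) (τ-step t)
    helper (no ¬t) = trans (cong σ (τ-id ¬t))
        (σ-id λ { (inj₁ q) → isA′-not-a h q ; (inj₂ t) → ¬t (inj₂ t) })

  data Kind (x : ℕ) : Set where
    through : Source x → Kind x
    within : ¬ Source x → Inside x → Inside (R D C x) → Kind x
    beyond : ¬ Source x → Outside x → Outside (R D C x) → Kind x

  RC≢ab : ∀ {x} → IsA D x → R D C x ≢ a × R D C x ≢ b
  RC≢ab h = (λ q → A≢R isC h a-isA (sym q)) , λ q → R≢R isB a-isA h (trans Ra (sym q))

  -- The missing fourth combination, A-end outside and C-end inside, is the one that `forward`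
  -- forbids.
  kind : ∀ {x} → IsA D x → Kind x
  kind {x} h with source? x
  ... | yes s = through s
  ... | no ¬s with locate x | locate (R D C x)
  ... | at-a q | _ = ⊥-elim (¬s (inj₁ q))
  ... | at-b q | _ = ⊥-elim (isA-not-b h q)
  ... | _ | at-a q = ⊥-elim (proj₁ (RC≢ab h) q)
  ... | _ | at-b q = ⊥-elim (proj₂ (RC≢ab h) q)
  ... | inside i | inside j = within ¬s i j
  ... | inside i | outside o = ⊥-elim (¬s (inj₂ (h , i , o)))
  ... | outside o | outside o′ = beyond ¬s o o′
  ... | outside o | inside j = ⊥-elim (outside-not-inside o (forward h (proj₁ j) (proj₂ j)))

  data BKind (p : ℕ) : Set where
    base : p ≡ a → BKind p
    within : Inside p → Inside (R D B p) → BKind p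
    beyond : Outside p → Outside (R D B p) → BKind p

  bkind : ∀ {p} → IsA D p → BKind p
  bkind {p} h with p ≟ a
  ... | yes q = base q
  ... | no n with locate p | locate (R D B p)
                | subst (λ z → cyc a p z ≡ cyc a (R D B p) z) Ra (Matching.noncrossing (wf isB) a-isA h
                    (λ q → n (sym q)))
  ... | at-a q | _ | _ = ⊥-elim (n q)
  ... | at-b q | _ | _ = ⊥-elim (isA-not-b h q)
  ... | _ | at-a q | _ = ⊥-elim (A≢R isB h a-isA (sym q))
  ... | _ | at-b q | _ = ⊥-elim (n (R-injective isB h a-isA (trans q (sym Ra))))
  ... | inside i | inside j | _ = within i j
  ... | outside o | outside o′ | _ = beyond o o′
  ... | inside i | outside o | e with trans (sym (inside-cyc i)) (trans e (outside-cyc o))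
  ... | ()
  bkind {p} h | no n | outside o | inside i | e with trans (sym (inside-cyc i))
      (trans (sym e) (outside-cyc o))
  ... | ()

  -- Separating an endpoint of a new C-chord is the same as separating the
  -- endpoint of the old one, for the B-chords on one side of a → b.
  beyond-side : ∀ {p u v} → IsA D p → Outside p → Closed u → Closed v → side D B p u ≡ side D B p v
  beyond-side hp o with bkind hp
  ... | base refl = ⊥-elim (outside-not-closed o a-closed)
  ... | within i _ = ⊥-elim (outside-not-inside o i)
  ... | beyond o o′ = outside-chord (A≢R isB hp hp) o o′

  within-side : ∀ {p u v} → IsA D p → Inside p → Coclosed u → Coclosed v → side D B p u ≡ side D B p v
  within-side hp i with bkind hp
  ... | base refl = ⊥-elim (<-irrefl refl (proj₁ i))
  ... | within i i′ = inside-chord (A≢R isB hp hp) i i′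
  ... | beyond o _ = ⊥-elim (outside-not-inside o i)

  σ-beyond-side : ∀ {p x} → IsA D p → Outside p → side D B p (σ x) ≡ side D B p x
  σ-beyond-side {x = x} hp o with source? x
  ... | yes s = beyond-side hp o (σ-closed s) (source-closed s)
  ... | no ¬s = cong (side D B _) (σ-id ¬s)

  -- For sources x < z the point z is itself a target after x, whence σ x ≤ z < σ z.
  σ-monotone : ∀ {x z} → Source x → Source z → (σ x <ᵇ σ z) ≡ (x <ᵇ z)
  σ-monotone {x} {z} s t with <-cmp x z
  ... | tri≈ _ refl _ = solve 2 (λ x y → ⊢ x <′ x ≈ y <′ y) refl (σ x ∷ x ∷ [])
  ... | tri< h n _ = solve 4 (λ x z x′ z′ → x ≺ z ⊢ x′ ≼ z ⊢ z ≺ z′ ⊢ ⊢ x′ <′ z′ ≈ x <′ z) refl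
      (x ∷ z ∷ σ x ∷ σ z ∷ [])
      h (≮⇒≥ λ l → Step.gap (σ-step s) z h l (through-of t)) (Step.x<z (σ-step t))
    where through-of : Source z → Through z
          through-of (inj₂ t) = t
          through-of (inj₁ refl) = ⊥-elim (<⇒≱ h (proj₁ (source-closed s)))
  ... | tri> _ n h = solve 4 (λ x z x′ z′ → z ≺ x ⊢ z′ ≼ x ⊢ x ≺ x′ ⊢ ⊢ x′ <′ z′ ≈ x <′ z) refl
      (x ∷ z ∷ σ x ∷ σ z ∷ [])
      h (≮⇒≥ λ l → Step.gap (σ-step t) x h l (through-of s)) (Step.x<z (σ-step s))
    where through-of : Source x → Through x
          through-of (inj₂ t) = t
          through-of (inj₁ refl) = ⊥-elim (<⇒≱ h (proj₁ (source-closed t)))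

  noncrossing-B : ∀ {p r} → IsA D′ p → IsA D′ r → p ≢ r → side D′ B p r ≡ side D′ B p (R D′ B r)
  noncrossing-B {p} {r} hp hr n = helper (p ≟ b) (r ≟ b)
    where
    helper : Dec (p ≡ b) → Dec (r ≡ b) → cyc p r (R′ B p) ≡ cyc p (R′ B r) (R′ B p)
    helper (yes q) (yes q′) = ⊥-elim (n (trans q (sym q′)))
    helper (yes refl) (no m) rewrite R′B-b | R′B-other m with bkind (unkeep-isA hr m)
    ... | base q = ⊥-elim (isA′-not-a hr q)
    ... | within i j = trans (inside-cyc′ i) (sym (inside-cyc′ j))
    ... | beyond o o′ = trans (outside-cyc′ o) (sym (outside-cyc′ o′))
    helper (no m) (yes refl) rewrite R′B-b | R′B-other m with bkind (unkeep-isA hp m)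
    ... | base q = ⊥-elim (isA′-not-a hp q)
    ... | within i j = inside-chord (A≢R isB (unkeep-isA hp m) (unkeep-isA hp m)) i j b-coclosed
        a-coclosed
    ... | beyond o o′ = outside-chord (A≢R isB (unkeep-isA hp m) (unkeep-isA hp m)) o o′ b-closed
        a-closed
    helper (no m) (no m′) rewrite R′B-other m | R′B-other m′ =
      Matching.noncrossing (wf isB) (unkeep-isA hp m) (unkeep-isA hr m′) n

  -- If σ r = b then the C-chord of r is moved to b, otherwise to the A-point σ r of
  -- a chord of D leaving the interval.
  target-side : ∀ {p t} → IsA D p → ¬ Source p → Inside p → Inside (R D C p) → Target t →
                ∀ {y} → Outside y → cyc p t (R D C p) ≡ cyc p y (R D C p)
  target-side hp ¬s i j (inj₁ refl) oy =
      inside-chord (A≢R isC hp hp) i j b-coclosed (outside-coclosed oy)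
  target-side {p} {t} hp ¬s i j (inj₂ th@(ht , _ , o)) oy =
    trans (Matching.noncrossing (wf isC) hp ht (λ { refl → ¬s (inj₂ th) }))
          (inside-chord (A≢R isC hp hp) i j (outside-coclosed o) (outside-coclosed oy))

  -- Two leaving chords keep their order since `σ` is monotone on their A-ends. A chord within the
  -- interval does not separate σ p from the outside: σ p is b, or it starts an old C-chord that
  -- leaves the interval without crossing the given one. For chords beyond, the whole interval
  -- behaves like a single point.
  noncrossing-C : ∀ {p r} → IsA D p → IsA D r → p ≢ r →
      cyc (σ p) (σ r) (R D C p) ≡ cyc (σ p) (R D C r) (R D C p)
  noncrossing-C {p} {r} hp hr n = helper (kind hp) (kind hr)
    where
    y = R D C p
    y′ = R D C r
    old : cyc p r y ≡ cyc p y′ y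
    old = Matching.noncrossing (wf isC) hp hr n
    helper : Kind p → Kind r → cyc (σ p) (σ r) y ≡ cyc (σ p) y′ y
    helper (through s) (through t) = begin
      cyc (σ p) (σ r) y ≡⟨ through-inner (σ-closed s) (σ-closed t) (source-far s) ⟩
      (σ p <ᵇ σ r)      ≡⟨ σ-monotone s t ⟩
      (p <ᵇ r)          ≡⟨ sym (through-inner (source-closed s) (source-closed t) (source-far s)) ⟩
      cyc p r y         ≡⟨ old ⟩
      cyc p y′ y        ≡⟨ through-outer (source-closed s) (σ-closed s) (source-far t) (source-far s) ⟩
      cyc (σ p) y′ y    ∎
      where open ≡-Reasoning
    helper (through s) (within ¬t i j) rewrite σ-id ¬t =
      trans (through-inner (σ-closed s) (inside-closed i) (source-far s))
      (trans (solve 6 (λ a b r y t o → cyc′ r t y ≈ cyc′ r o y ⊢ a ≺ r ⊢ r ≺ b ⊢ a ≺ y ⊢ y ≺ b ⊢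
          (o <′ a ∨′ b <′ o) ≈ true′ ⊢
                 r ≄ t ⊢ y ≄ t ⊢ a ≺ t ⊢ t ≼ b ⊢ r ≄ y ⊢ ⊢ t <′ r ≈ t <′ y) refl
                     (a ∷ b ∷ r ∷ y′ ∷ σ p ∷ y ∷ [])
               (target-side hr ¬t i j (σ-target s) (source-far s)) (proj₁ i) (proj₂ i) (proj₁ j)
                   (proj₂ j) (source-far s)
               r≢σp y≢σp (a<target (σ-target s)) (proj₂ (σ-closed s)) (A≢R isC hr hr))
             (sym (through-inner (σ-closed s) (inside-closed j) (source-far s))))
      where
      r≢σp : r ≢ σ p
      r≢σp q with σ-target s
      ... | inj₁ q′ = isA-not-b hr (trans q q′)
      ... | inj₂ t = ¬t (inj₂ (subst Through (sym q) t))
      y≢σp : y′ ≢ σ p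
      y≢σp q with σ-target s
      ... | inj₁ q′ = proj₂ (RC≢ab hr) (trans q q′)
      ... | inj₂ (h , _) = A≢R isC hr h (sym q)
    helper (through s) (beyond ¬t o o′) rewrite σ-id ¬t =
      trans (through-outer (σ-closed s) (source-closed s) o (source-far s))
      (trans old (through-outer (source-closed s) (σ-closed s) o′ (source-far s)))
    helper (within ¬s i j) (through t) rewrite σ-id ¬s =
        target-side hp ¬s i j (σ-target t) (source-far t)
    helper (beyond ¬s o o′) (through t) rewrite σ-id ¬s =
      trans (outside-chord (A≢R isC hp hp) o o′ (σ-closed t) (source-closed t)) old
    helper (within ¬s _ _) (within ¬t _ _) rewrite σ-id ¬s | σ-id ¬t = old
    helper (within ¬s _ _) (beyond ¬t _ _) rewrite σ-id ¬s | σ-id ¬t = old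
    helper (beyond ¬s _ _) (within ¬t _ _) rewrite σ-id ¬s | σ-id ¬t = old
    helper (beyond ¬s _ _) (beyond ¬t _ _) rewrite σ-id ¬s | σ-id ¬t = old

  switched-wellFormed : WellFormed D′
  switched-wellFormed isB = record { target = target ; source = source ; noncrossing = noncrossing-B }
    where
    target : ∀ {p} → IsA D′ p → R′ B p < N × ℓ′ (R′ B p) ≡ B
    target {p} h = helper (p ≟ b)
      where
      helper : Dec (p ≡ b) → R′ B p < N × ℓ′ (R′ B p) ≡ B
      helper (yes refl) rewrite R′B-b = proj₁ a-isA , ℓ′-a
      helper (no n) rewrite R′B-other n =
        R<N isB h′ , trans (ℓ′-other (λ q → A≢R isB h′ a-isA (sym q))
                       (λ q → isA′-not-a h (R-injective isB h′ a-isA (trans q (sym Ra))))) (ℓR isB h′)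
        where h′ = unkeep-isA h n
    source : ∀ {j} → j < N → ℓ′ j ≡ B → Σ ℕ λ p → IsA D′ p × R′ B p ≡ j
    source {j} h e = helper (j ≟ a) (j ≟ b)
      where
      helper : Dec (j ≡ a) → Dec (j ≡ b) → Σ ℕ λ p → IsA D′ p × R′ B p ≡ j
      helper (yes refl) _ = b , b-isA′ , R′B-b
      helper (no n) (yes refl) = ⊥-elim (A≢arc isB (trans (sym ℓ′-b) e))
      helper (no n) (no m) with Matching.source (wf isB) h (trans (sym (ℓ′-other n m)) e)
      ... | p , hp , q = p , keep-isA hp (λ { refl → m (trans (sym q) Ra) }) , trans
          (R′B-other (isA-not-b hp)) q
  switched-wellFormed isC = record { target = target ; source = source ; noncrossing = noncrossing }
    where
    target : ∀ {p} → IsA D′ p → R′ C p < N × ℓ′ (R′ C p) ≡ C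
    target {p} h = R<N isC h′ , trans (ℓ′-other (proj₁ (RC≢ab h′)) (proj₂ (RC≢ab h′))) (ℓR isC h′)
      where h′ = τ-isA h
    source : ∀ {j} → j < N → ℓ′ j ≡ C → Σ ℕ λ p → IsA D′ p × R′ C p ≡ j
    source {j} h e with Matching.source (wf isC) h
      (trans (sym (ℓ′-other (λ { refl → ε≢swap isB (trans (sym ℓ′-a) e) })
          (λ { refl → A≢arc isC (trans (sym ℓ′-b) e) }))) e)
    ... | p , hp , q = σ p , σ-isA′ hp , trans (R′C-σ hp) q
    noncrossing : ∀ {p r} → IsA D′ p → IsA D′ r → p ≢ r → side D′ C p r ≡ side D′ C p (R′ C r)
    noncrossing {p} {r} hp hr n = subst₂ (λ u v → cyc u v (R′ C p) ≡ cyc u (R′ C r) (R′ C p)) (στ hp)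
        (στ hr)
      (noncrossing-C (τ-isA hp) (τ-isA hr) (λ q → n (trans (sym (στ hp)) (trans (cong σ q) (στ hr)))))

-- Switching preserves the web

xor-same : ∀ {x y} → x ≡ y → (x xor y) ≡ true → ⊥
xor-same {false} refl ()
xor-same {true} refl ()

module SwitchIso {N D a b} (sw : Switchable N D a b) where
  open Diagrams N
  open Switchable sw
  open Switch sw
  module New = WellFormedProperties switched-wellFormed

  through-not-a : ∀ {x} → Through x → x ≢ a
  through-not-a (_ , (h , _) , _) refl = <-irrefl refl h

  inside-not-a : ∀ {x} → Inside x → x ≢ a
  inside-not-a (h , _) refl = <-irrefl refl h

  outside-not-a : ∀ {x} → Outside x → x ≢ a
  outside-not-a o refl = outside-not-closed o a-closed

  outside-not-b : ∀ {x} → Outside x → x ≢ b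
  outside-not-b o refl = outside-not-closed o b-closed

  outside-σ : ∀ {x} → Outside x → σ x ≡ x
  outside-σ o = σ-id λ s → outside-not-closed o (source-closed s)

  not-target : ∀ {x} → IsA D x → ¬ Source x → ¬ Target x
  not-target h ¬s (inj₁ q) = isA-not-b h q
  not-target h ¬s (inj₂ t) = ¬s (inj₂ t)

  R′C-target : ∀ {x} → Target x → Outside (R′ C x)
  R′C-target t = source-far (τ-source t)

  R′C-keep : ∀ {x} → IsA D x → ¬ Source x → R′ C x ≡ R D C x
  R′C-keep h ¬s = cong (R D C) (τ-id (not-target h ¬s))

  side-keep : ∀ {p u} → IsA D p → side D′ B p u ≡ side D B p u
  side-keep hp = cong (cyc _ _) (R′B-other (isA-not-b hp))

  sideB-a : ∀ {u} → side D B a u ≡ cyc a u b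
  sideB-a = cong (cyc _ _) Ra

  sideB′-b : ∀ {u} → side D′ B b u ≡ cyc b u a
  sideB′-b = cong (cyc _ _) R′B-b

  crosses-a : ∀ {x} → IsA D x → Crosses D B a x → Through x
  crosses-a {x} hx (n , c) with kind hx
  ... | through (inj₁ q) = ⊥-elim (n (sym q))
  ... | through (inj₂ t) = t
  ... | within _ i j = ⊥-elim
      (xor-same (trans sideB-a (trans (trans (inside-cyc i) (sym (inside-cyc j))) (sym sideB-a))) c)
  ... | beyond _ i j = ⊥-elim
      (xor-same (trans sideB-a (trans (trans (outside-cyc i) (sym (outside-cyc j))) (sym sideB-a))) c)

  through-crosses-a : ∀ {x} → Through x → Crosses D B a x
  through-crosses-a t@(h , i , o) = (λ q → through-not-a t (sym q)) ,
    cong₂ _xor_ (trans sideB-a (inside-cyc i)) (trans sideB-a (outside-cyc o))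

  crosses-b′ : ∀ {x} → IsA D′ x → Crosses D′ B b x → Through x
  crosses-b′ {x} hx (n , c) with kind (unkeep-isA hx (λ q → n (sym q)))
  ... | through (inj₁ q) = ⊥-elim (isA′-not-a hx q)
  ... | through (inj₂ t) = t
  ... | within ¬s i j =
      ⊥-elim (xor-same (trans sideB′-b (trans (trans (inside-cyc′ i) (sym (inside-cyc′ j′)))
          (sym sideB′-b))) c)
    where j′ = subst Inside (sym (R′C-keep (unkeep-isA hx (λ q → n (sym q))) ¬s)) j
  ... | beyond ¬s i j =
      ⊥-elim (xor-same (trans sideB′-b (trans (trans (outside-cyc′ i) (sym (outside-cyc′ j′)))
          (sym sideB′-b))) c)
    where j′ = subst Outside (sym (R′C-keep (unkeep-isA hx (λ q → n (sym q))) ¬s)) j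

  through-crosses-b′ : ∀ {x} → Through x → Crosses D′ B b x
  through-crosses-b′ t@(h , i , o) = (λ q → isA-not-b h (sym q)) ,
    cong₂ _xor_ (trans sideB′-b (inside-cyc′ i)) (trans sideB′-b (outside-cyc′ (R′C-target (inj₂ t))))

  within-crosses : ∀ {p x} → IsA D p → Inside p → IsA D x → Crosses D B p x → Inside x
  within-crosses hp i hx (n , c) with kind hx
  ... | through (inj₁ refl) = ⊥-elim (xor-same (within-side hp i a-coclosed (outside-coclosed a-far)) c)
  ... | through (inj₂ (_ , j , _)) = j
  ... | within _ j _ = j
  ... | beyond _ o o′ = ⊥-elim (xor-same (within-side hp i (outside-coclosed o) (outside-coclosed o′)) c)

  within-R′ : ∀ {p x} → IsA D p → Inside p → IsA D x → Inside x →
      side D B p (R′ C x) ≡ side D B p (R D C x)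
  within-R′ {p} hp i hx j with kind hx
  ... | through (inj₁ refl) = ⊥-elim (<-irrefl refl (proj₁ j))
  ... | through (inj₂ t) = within-side hp i (outside-coclosed (R′C-target (inj₂ t)))
      (outside-coclosed (proj₂ (proj₂ t)))
  ... | within ¬s _ _ = cong (side D B p) (R′C-keep hx ¬s)
  ... | beyond _ o _ = ⊥-elim (outside-not-inside o j)

  within-on : ∀ {p x} → IsA D p → Inside p → On D B p x → On D′ B p x × Inside x
  within-on hp i (hx , c) = (keep-isA hx (inside-not-a j) , proj₁ c ,
    trans (cong₂ _xor_ (side-keep hp) (trans (side-keep hp) (within-R′ hp i hx j))) (proj₂ c)) , j
    where j = within-crosses hp i hx c

  -- The only new A-point is b, and its C-chord has no end in the open interval, so it cannot meet a
  -- B-chord lying there.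
  within-on′ : ∀ {p x} → IsA D p → Inside p → On D′ B p x → On D B p x × Inside x
  within-on′ {p} {x} hp i (hx , n , c) with x ≟ b
  ... | yes refl = ⊥-elim
      (xor-same (trans (side-keep hp)
          (trans (within-side hp i b-coclosed (outside-coclosed (R′C-target (inj₁ refl))))
              (sym (side-keep hp)))) c)
  ... | no m with kind (unkeep-isA hx m)
  ... | through (inj₁ q) = ⊥-elim (isA′-not-a hx q)
  ... | through (inj₂ t) =
      (unkeep-isA hx m , n , trans
          (sym (cong₂ _xor_ (side-keep hp)
              (trans (side-keep hp) (within-R′ hp i (unkeep-isA hx m) (proj₁ (proj₂ t)))))) c) , proj₁
                  (proj₂ t)
  ... | within ¬s j _ =
      (unkeep-isA hx m , n , trans
          (sym (cong₂ _xor_ (side-keep hp) (trans (side-keep hp) (within-R′ hp i (unkeep-isA hx m) j))))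
              c) , j
  ... | beyond ¬s o o′ =
      ⊥-elim (xor-same (trans (side-keep hp) (trans (within-side hp i (outside-coclosed o)
           (outside-coclosed (subst Outside (sym (R′C-keep (unkeep-isA hx m) ¬s)) o′)))
               (sym (side-keep hp)))) c)

  -- The C-chords meeting a B-chord lying beyond a → b.
  Spread : ℕ → Set
  Spread x = Source x ⊎ (¬ Source x × Outside x × Outside (R D C x))

  spread-far : ∀ {x} → Spread x → Outside (R D C x)
  spread-far (inj₁ s) = source-far s
  spread-far (inj₂ (_ , _ , o)) = o

  beyond-crosses : ∀ {p x} → IsA D p → Outside p → IsA D x → Crosses D B p x → Spread x
  beyond-crosses hp o hx (n , c) with kind hx
  ... | through s = inj₁ s
  ... | within _ i j = ⊥-elim (xor-same (beyond-side hp o (inside-closed i) (inside-closed j)) c)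
  ... | beyond ¬s o o′ = inj₂ (¬s , o , o′)

  beyond-σ : ∀ {p x} → IsA D p → Outside p → IsA D x →
    (side D′ B p (σ x) xor side D′ B p (R′ C (σ x))) ≡ (side D B p x xor side D B p (R D C x))
  beyond-σ {p} hp o hx = cong₂ _xor_ (trans (side-keep hp) (σ-beyond-side hp o))
    (trans (side-keep hp) (cong (side D B p) (R′C-σ hx)))

  beyond-on : ∀ {p x} → IsA D p → Outside p → On D B p x → On D′ B p (σ x)
  beyond-on hp o (hx , n , c) = σ-isA′ hx , (λ q → n (σ-injective hp hx (trans (outside-σ o) q))) , trans
      (beyond-σ hp o hx) c

  beyond-off : ∀ {p x} → IsA D p → Outside p → IsA D x → Crosses D′ B p (σ x) → Crosses D B p x
  beyond-off hp o hx (n , c) =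
      (λ q → n (trans (sym (outside-σ o)) (cong σ q))) , trans (sym (beyond-σ hp o hx)) c

  beyond-on′ : ∀ {p w} → IsA D p → Outside p → On D′ B p w → Σ ℕ λ x → w ≡ σ x × On D B p x
  beyond-on′ {p} {w} hp o (hw , c) = τ w , sym (στ hw) , τ-isA hw ,
    beyond-off hp o (τ-isA hw) (subst (Crosses D′ B p) (sym (στ hw)) c)

  sideC-in : ∀ {x u} → IsA D x → Inside x → Closed u → side D′ C x u ≡ side D C x u
  sideC-in {x} {u} hx i hu with kind hx
  ... | through (inj₁ refl) = ⊥-elim (<-irrefl refl (proj₁ i))
  ... | through (inj₂ t@(_ , _ , o)) = trans (through-inner (inside-closed i) hu (R′C-target (inj₂ t)))
                                             (sym (through-inner (inside-closed i) hu o))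
  ... | within ¬s _ _ = cong (cyc x u) (R′C-keep hx ¬s)
  ... | beyond _ o _ = ⊥-elim (outside-not-inside o i)

  sideC-out : ∀ {x u} → IsA D x → Spread x → Outside u → side D′ C (σ x) u ≡ side D C x u
  sideC-out {x} {u} hx (inj₁ s) o = trans (cong (cyc (σ x) u) (R′C-σ hx))
    (through-outer (σ-closed s) (source-closed s) o (source-far s))
  sideC-out {x} {u} hx (inj₂ (¬s , _)) o =
      trans (cong (cyc (σ x) u) (R′C-σ hx)) (cong (λ z → cyc z u (R D C x)) (σ-id ¬s))

  within-before-bits : ∀ {p x z} → Inside p → IsA D x → Inside x → Inside z →
    (side D′ C x p xor side D′ C x z) ≡ (side D C x p xor side D C x z)
  within-before-bits i hx j k = cong₂ _xor_ (sideC-in hx j (inside-closed i)) (sideC-in hx j (inside-closed k))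

  within-before : ∀ {p x z} → Inside p → IsA D x → Inside x → Inside z → Before D B p x z →
      Before D′ B p x z
  within-before i hx j k (inj₁ q) = inj₁ q
  within-before i hx j k (inj₂ (n , c)) = inj₂ (n , trans (within-before-bits i hx j k) c)

  within-before′ : ∀ {p x z} → Inside p → IsA D x → Inside x → Inside z → Before D′ B p x z →
      Before D B p x z
  within-before′ i hx j k (inj₁ q) = inj₁ q
  within-before′ i hx j k (inj₂ (n , c)) = inj₂ (n , trans (sym (within-before-bits i hx j k)) c)

  -- The A-end of z moves but its far end stays. Noncrossing in the new diagram replaces the one by
  -- the other, and noncrossing in the old diagram goes back.
  beyond-before-bits : ∀ {p x z} → Outside p → IsA D x → Spread x → IsA D z → Spread z → x ≢ z →
    (side D′ C (σ x) p xor side D′ C (σ x) (σ z)) ≡ (side D C x p xor side D C x z)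
  beyond-before-bits {p} {x} {z} o hx sx hz sz n = cong₂ _xor_ (sideC-out hx sx o) (begin
    side D′ C (σ x) (σ z)        ≡⟨ Matching.noncrossing (switched-wellFormed isC) (σ-isA′ hx)
        (σ-isA′ hz) (λ q → n (σ-injective hx hz q)) ⟩
    side D′ C (σ x) (R′ C (σ z)) ≡⟨ cong (side D′ C (σ x)) (R′C-σ hz) ⟩
    side D′ C (σ x) (R D C z)    ≡⟨ sideC-out hx sx (spread-far sz) ⟩
    side D C x (R D C z)         ≡⟨ sym (Matching.noncrossing (wf isC) hx hz n) ⟩
    side D C x z ∎)
    where open ≡-Reasoning

  beyond-before : ∀ {p x z} → Outside p → IsA D x → Spread x → IsA D z → Spread z → Before D B p x z →
      Before D′ B p (σ x) (σ z)
  beyond-before o hx sx hz sz (inj₁ refl) = inj₁ (outside-σ o)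
  beyond-before o hx sx hz sz (inj₂ (n , c)) =
      inj₂ ((λ q → n (σ-injective hx hz q)) , trans (beyond-before-bits o hx sx hz sz n) c)

  beyond-before′ : ∀ {p x z} → Outside p → IsA D p → IsA D x → Spread x → IsA D z → Spread z →
      Before D′ B p (σ x) (σ z) → Before D B p x z
  beyond-before′ o hp hx sx hz sz (inj₁ q) = inj₁ (σ-injective hx hp (trans q (sym (outside-σ o))))
  beyond-before′ o hp hx sx hz sz (inj₂ (n , c)) =
      inj₂ ((λ q → n (cong σ q)) , trans (sym (beyond-before-bits o hx sx hz sz (λ q → n (cong σ q)))) c)

  start-within : ∀ {p x} → IsA D p → Inside p → x ≡ p ⊎ On D B p x →
      IsA D x × Inside x × (x ≡ p ⊎ On D′ B p x)
  start-within hp i (inj₁ refl) = hp , i , inj₁ refl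
  start-within hp i (inj₂ o) = proj₁ o , proj₂ (within-on hp i o) , inj₂ (proj₁ (within-on hp i o))

  within-succ : ∀ {p x z} → Inside p → Succ D B p x z → Succ D′ B p x z
  within-succ {p} {x} {z} i (mkSucc hp s on bf im) =
      mkSucc (keep-isA hp (inside-not-a i)) s′ on′ (within-before i hx j k bf) im′
    where
    hx = proj₁ (start-within hp i s)
    j = proj₁ (proj₂ (start-within hp i s))
    s′ = proj₂ (proj₂ (start-within hp i s))
    on′ = proj₁ (within-on hp i on)
    k = proj₂ (within-on hp i on)
    im′ : ∀ w → On D′ B p w → Before D′ B p x w → Before D′ B p w z → ⊥
    im′ w ow b₁ b₂ with within-on′ hp i ow
    ... | o , l = im w o (within-before′ i hx j l b₁) (within-before′ i (proj₁ o) l k b₂)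

  within-last : ∀ {p x} → Inside p → Last D B p x → Last D′ B p x
  within-last {p} {x} i (mkLast hp s mx) = mkLast (keep-isA hp (inside-not-a i)) s′ mx′
    where
    hx = proj₁ (start-within hp i s)
    j = proj₁ (proj₂ (start-within hp i s))
    s′ = proj₂ (proj₂ (start-within hp i s))
    mx′ : ∀ w → On D′ B p w → Before D′ B p x w → ⊥
    mx′ w ow b₁ with within-on′ hp i ow
    ... | o , l = mx w o (within-before′ i hx j l b₁)

  start-beyond : ∀ {p x} → IsA D p → Outside p → x ≡ p ⊎ On D B p x →
      IsA D x × Spread x × (σ x ≡ p ⊎ On D′ B p (σ x))
  start-beyond hp o (inj₁ refl) = hp , sp , inj₁ (outside-σ o)
    where
    sp : Spread _
    sp with kind hp
    ... | through s = inj₁ s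
    ... | within _ i _ = ⊥-elim (outside-not-inside o i)
    ... | beyond ¬s o o′ = inj₂ (¬s , o , o′)
  start-beyond hp o (inj₂ on) = proj₁ on , beyond-crosses hp o (proj₁ on) (proj₂ on) , inj₂
      (beyond-on hp o on)

  beyond-succ : ∀ {p x z} → Outside p → Succ D B p x z → Succ D′ B p (σ x) (σ z)
  beyond-succ {p} {x} {z} o (mkSucc hp s on bf im) =
    mkSucc (keep-isA hp (outside-not-a o)) s′ (beyond-on hp o on)
        (beyond-before o hx sx (proj₁ on) sz bf) im′
    where
    hx = proj₁ (start-beyond hp o s)
    sx = proj₁ (proj₂ (start-beyond hp o s))
    s′ = proj₂ (proj₂ (start-beyond hp o s))
    sz = beyond-crosses hp o (proj₁ on) (proj₂ on)
    im′ : ∀ w → On D′ B p w → Before D′ B p (σ x) w → Before D′ B p w (σ z) → ⊥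
    im′ w ow b₁ b₂ with beyond-on′ hp o ow
    ... | u , refl , ou = im u ou (beyond-before′ o hp hx sx (proj₁ ou) su b₁)
        (beyond-before′ o hp (proj₁ ou) su (proj₁ on) sz b₂)
      where su = beyond-crosses hp o (proj₁ ou) (proj₂ ou)

  beyond-last : ∀ {p x} → Outside p → Last D B p x → Last D′ B p (σ x)
  beyond-last {p} {x} o (mkLast hp s mx) = mkLast (keep-isA hp (outside-not-a o)) s′ mx′
    where
    hx = proj₁ (start-beyond hp o s)
    sx = proj₁ (proj₂ (start-beyond hp o s))
    s′ = proj₂ (proj₂ (start-beyond hp o s))
    mx′ : ∀ w → On D′ B p w → Before D′ B p (σ x) w → ⊥
    mx′ w ow b₁ with beyond-on′ hp o ow
    ... | u , refl , ou =
        mx u ou (beyond-before′ o hp hx sx (proj₁ ou) (beyond-crosses hp o (proj₁ ou) (proj₂ ou)) b₁)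

  -- The chords met by a → b all leave the interval, so the chord from x has a and z on different
  -- sides exactly when z lies after x. Along b → a the same chords are met in the opposite order,
  -- as in `before-b`.
  before-a : ∀ {x z} → Source x → Through z → Before D B a x z → x < z
  before-a s t (inj₁ refl) = proj₁ (proj₁ (proj₂ t))
  before-a {x} {z} s t (inj₂ (n , c)) = solve 3 (λ a x z → a ≼ x ⊢ (x <′ a xor′ x <′ z) ≈ true′ ⊢ ⊢
      x ≺ z) refl (a ∷ x ∷ z ∷ [])
    (proj₁ (source-closed s))
    (trans (sym (cong₂ _xor_ (through-inner (source-closed s) a-closed (source-far s))
        (through-inner (source-closed s) (inside-closed (proj₁ (proj₂ t))) (source-far s)))) c)

  before-a⁻ : ∀ {x z} → Source x → Through z → x < z → Before D B a x z
  before-a⁻ {x} {z} s t l =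
      inj₂ (<⇒≢ l , trans (cong₂ _xor_ (through-inner (source-closed s) a-closed (source-far s))
          (through-inner (source-closed s) (inside-closed (proj₁ (proj₂ t))) (source-far s)))
    (solve 3 (λ a x z → a ≼ x ⊢ x ≺ z ⊢ ⊢ (x <′ a xor′ x <′ z) ≈ true′) refl (a ∷ x ∷ z ∷ [])
        (proj₁ (source-closed s)) l))

  start-a : ∀ {x} → x ≡ a ⊎ On D B a x → Source x
  start-a (inj₁ q) = inj₁ q
  start-a (inj₂ (h , c)) = inj₂ (crosses-a h c)

  succ-a : ∀ {x z} → Succ D B a x z → Step x z × Through z
  succ-a {x} {z} (mkSucc _ s (hz , c) bf im) = mkStep (start-a s) (inj₂ t) (before-a (start-a s) t bf)
    (λ w l l′ tw → im w (proj₁ tw , through-crosses-a tw) (before-a⁻ (start-a s) tw l)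
        (before-a⁻ (inj₂ tw) t l′)) , t
    where t = crosses-a hz c

  last-a : ∀ {x} → Last D B a x → Source x × σ x ≡ b
  last-a {x} (mkLast _ s mx) =
      start-a s , σ-unique (mkStep (start-a s) (inj₁ refl) (source<b (start-a s))
    (λ w l l′ tw → mx w (proj₁ tw , through-crosses-a tw) (before-a⁻ (start-a s) tw l)))

  before-b : ∀ {x z} → Target x → Through z → Before D′ B b x z → z < x
  before-b s t (inj₁ refl) = proj₂ (proj₁ (proj₂ t))
  before-b {x} {z} s t (inj₂ (n , c)) = solve 3 (λ b x z → x ≼ b ⊢ z ≺ b ⊢ x ≄ z ⊢
      (x <′ b xor′ x <′ z) ≈ true′ ⊢ ⊢ z ≺ x) refl (b ∷ x ∷ z ∷ [])
    (proj₂ (target-closed s)) (proj₂ (proj₁ (proj₂ t))) n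
    (trans (sym (cong₂ _xor_ (through-inner (target-closed s) b-closed (R′C-target s))
        (through-inner (target-closed s) (inside-closed (proj₁ (proj₂ t))) (R′C-target s)))) c)

  before-b⁻ : ∀ {x z} → Target x → Through z → z < x → Before D′ B b x z
  before-b⁻ (inj₁ q) t l = inj₁ q
  before-b⁻ {x} {z} s@(inj₂ tx) t l =
      inj₂ ((λ q → <⇒≢ l (sym q)) , trans
          (cong₂ _xor_ (through-inner (target-closed s) b-closed (R′C-target s))
              (through-inner (target-closed s) (inside-closed (proj₁ (proj₂ t))) (R′C-target s)))
    (solve 3 (λ b x z → x ≺ b ⊢ z ≺ x ⊢ ⊢ (x <′ b xor′ x <′ z) ≈ true′) refl (b ∷ x ∷ z ∷ [])
        (proj₂ (proj₁ (proj₂ tx))) l))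

  start-b : ∀ {x} → Target x → x ≡ b ⊎ On D′ B b x
  start-b (inj₁ q) = inj₁ q
  start-b (inj₂ t) = inj₂ (target-isA′ (inj₂ t) , through-crosses-b′ t)

  -- The chord is now traversed from b to a, so a step of the shift read backwards is a step along
  -- it.
  succ-b : ∀ {x z} → Step x z → Through x → Succ D′ B b z x
  succ-b {x} {z} (mkStep _ t l g) tx =
      mkSucc b-isA′ (start-b t) (target-isA′ (inj₂ tx) , through-crosses-b′ tx) (before-b⁻ t tx l)
    λ w (hw , cw) b₁ b₂ → let tw = crosses-b′ hw cw in g w (before-b (inj₂ tw) tx b₂) (before-b t tw b₁) tw

  last-b : ∀ {z} → Step a z → Last D′ B b z
  last-b {z} (mkStep _ t l g) = mkLast b-isA′ (start-b t)
    λ w (hw , cw) b₁ → let tw = crosses-b′ hw cw in g w (proj₁ (proj₁ (proj₂ tw))) (before-b t tw b₁) tw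

  onC : ∀ {z p} → IsA D z → On D C z p → Crosses D B p z
  onC hz (hp , c) = crosses-sym isC hz hp c

  onC⁻ : ∀ {z p} → IsA D z → IsA D p → Crosses D B p z → On D C z p
  onC⁻ hz hp c = hp , crosses-sym isB hp hz c

  onC′ : ∀ {z p} → IsA D′ z → On D′ C z p → Crosses D′ B p z
  onC′ hz (hp , c) = New.crosses-sym isC hz hp c

  onC′⁻ : ∀ {z p} → IsA D′ z → IsA D′ p → Crosses D′ B p z → On D′ C z p
  onC′⁻ hz hp c = hp , New.crosses-sym isB hp hz c

  beforeC : ∀ {z p r} → IsA D p → Before D C z p r → Before D′ C z p r
  beforeC hp (inj₁ q) = inj₁ q
  beforeC hp (inj₂ (n , c)) = inj₂ (n , trans (cong₂ _xor_ (side-keep hp) (side-keep hp)) c)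

  beforeC′ : ∀ {z p r} → IsA D p → Before D′ C z p r → Before D C z p r
  beforeC′ hp (inj₁ q) = inj₁ q
  beforeC′ hp (inj₂ (n , c)) = inj₂ (n , trans (sym (cong₂ _xor_ (side-keep hp) (side-keep hp))) c)

  -- A C-chord whose ends stay fixed meets neither a → b nor its reversal, and every other B-chord
  -- is the same before and after.
  module Unmoved {z} (hz : IsA D z) (¬s : ¬ Source z) where
    z≢a : z ≢ a
    z≢a q = ¬s (inj₁ q)

    hz′ : IsA D′ z
    hz′ = keep-isA hz z≢a

    bits : ∀ {p} → IsA D p →
        (side D′ B p z xor side D′ B p (R′ C z)) ≡ (side D B p z xor side D B p (R D C z))
    bits {p} hp = cong₂ _xor_ (side-keep hp) (trans (side-keep hp) (cong (side D B p) (R′C-keep hz ¬s)))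

    not-a : ∀ {p} → On D C z p → p ≢ a
    not-a o refl = ¬s (inj₂ (crosses-a hz (onC hz o)))

    on : ∀ {p} → On D C z p → On D′ C z p
    on o@(hp , _) = onC′⁻ hz′ (keep-isA hp (not-a o)) (proj₁ (onC hz o) , trans (bits hp)
        (proj₂ (onC hz o)))

    on′ : ∀ {p} → On D′ C z p → On D C z p
    on′ {p} o@(hp′ , _) = onC⁻ hz hp (proj₁ c , trans (sym (bits hp)) (proj₂ c))
      where
      c = onC′ hz′ o
      hp = unkeep-isA hp′ λ { refl → ¬s (inj₂ (crosses-b′ hz′ c)) }

    start-isA : ∀ {p} → p ≡ z ⊎ On D C z p → IsA D p × p ≢ a × (p ≡ z ⊎ On D′ C z p)
    start-isA (inj₁ refl) = hz , z≢a , inj₁ refl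
    start-isA (inj₂ o) = proj₁ o , not-a o , inj₂ (on o)

    succ : ∀ {p r} → Succ D C z p r → Succ D′ C z p r
    succ (mkSucc _ s o bf im) with start-isA s
    ... | hp , _ , s′ = mkSucc hz′ s′ (on o) (beforeC hp bf) λ w ow b₁ b₂ →
        im w (on′ ow) (beforeC′ hp b₁) (beforeC′ (proj₁ (on′ ow)) b₂)

    last : ∀ {p} → Last D C z p → Last D′ C z p
    last (mkLast _ s mx) with start-isA s
    ... | hp , _ , s′ = mkLast hz′ s′ λ w ow b₁ → mx w (on′ ow) (beforeC′ hp b₁)

  -- The B-chord, in the old and in the new diagram, from which the part of a leaving C-chord
  -- outside the interval is followed: either the switched chord, renamed from a to b, or a chord
  -- beyond it, which keeps its name.
  data Corner : ℕ → ℕ → Set where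
    base : Corner a b
    keep : ∀ {p} → IsA D p → Outside p → Corner p p

  -- The new C-chord σ z consists of the old chord σ z up to its crossing with a → b and
  -- of the old chord z from there on.
  module Moved {z} (hz : IsA D z) (s : Source z) where
    hσ : IsA D′ (σ z)
    hσ = σ-isA′ hz

    outer-on : ∀ {p} → IsA D p → Outside p → On D C z p → On D′ C (σ z) p
    outer-on hp o on = onC′⁻ hσ (keep-isA hp (outside-not-a o)) (proj₂ (beyond-on hp o (hz , onC hz on))
        )

    outer-start : ∀ {p p′} → Corner p p′ → p ≡ z ⊎ On D C z p → p′ ≡ σ z ⊎ On D′ C (σ z) p′
    outer-start base _ with σ-target s
    ... | inj₁ q = inj₁ (sym q)
    ... | inj₂ t = inj₂ (onC′⁻ hσ b-isA′ (through-crosses-b′ t))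
    outer-start (keep hp o) (inj₁ refl) = ⊥-elim (outside-not-closed o (source-closed s))
    outer-start (keep hp o) (inj₂ on) = inj₂ (outer-on hp o on)

    outer-before : ∀ {p r p′} → Corner p p′ → Outside r → Before D C z p r → Before D′ C (σ z) p′ r
    outer-before {r = r} base o _ with σ-target s
    ... | inj₁ q = inj₁ (sym q)
    ... | inj₂ t = inj₂ ((λ q → outside-not-b o (sym q)) , cong₂ _xor_
        (trans sideB′-b (inside-cyc′ (proj₁ (proj₂ t)))) (trans sideB′-b (outside-cyc′ o)))
    outer-before (keep hp o) o′ (inj₁ refl) = ⊥-elim (outside-not-closed o (source-closed s))
    outer-before (keep hp o) o′ (inj₂ (n , c)) =
        inj₂ (n , trans (cong₂ _xor_ (trans (side-keep hp) (σ-beyond-side hp o)) (side-keep hp)) c)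

    outer-before′ : ∀ {p r} → IsA D p → Outside p → Before D′ C (σ z) p r → Before D C z p r
    outer-before′ hp o (inj₁ refl) = ⊥-elim (outside-not-closed o (σ-closed s))
    outer-before′ hp o (inj₂ (n , c)) =
        inj₂ (n , trans (sym (cong₂ _xor_ (trans (side-keep hp) (σ-beyond-side hp o)) (side-keep hp))) c)

    before-outer : ∀ {w} → Outside w → Before D C z a w
    before-outer {w} o = helper s
      where
      helper : Source z → Before D C z a w
      helper (inj₁ q) = inj₁ (sym q)
      helper (inj₂ t) = inj₂ ((λ q → outside-not-a o (sym q)) , cong₂ _xor_
          (trans sideB-a (inside-cyc (proj₁ (proj₂ t)))) (trans sideB-a (outside-cyc o)))

    -- A chord beyond a → b does not separate any two points of the closed interval, and the
    -- reversed chord b → a none of the open one, so on the new C-chord no crossing with b or with a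
    -- chord within can come after the corner.
    after-outer : ∀ {p p′} → Corner p p′ → ∀ w → On D′ C (σ z) w → Before D′ C (σ z) p′ w →
                  Outside w × On D C z w × Before D C z p w
    after-outer {p} {p′} cr w ow@(hw , cw) bf with locate w
    ... | at-a q = ⊥-elim (isA′-not-a hw q)
    ... | outside o = o , onC⁻ hz hw′ (beyond-off hw′ o hz (onC′ hσ ow)) , bef cr bf
      where
      hw′ = unkeep-isA hw (outside-not-b o)
      bef : ∀ {p p′} → Corner p p′ → Before D′ C (σ z) p′ w → Before D C z p w
      bef base _ = before-outer o
      bef (keep hp op) bf = outer-before′ hp op bf
    after-outer base w ow@(hw , cw) (inj₁ q) | at-b q′ = ⊥-elim (proj₁ cw (trans (sym q) (sym q′)))
    after-outer base w ow@(hw , cw) (inj₂ (n , c)) | at-b q′ = ⊥-elim (n (sym q′))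
    after-outer (keep hp o) w ow@(hw , cw) (inj₁ refl) | at-b q′ =
        ⊥-elim (outside-not-closed o (σ-closed s))
    after-outer (keep hp o) w ow@(hw , cw) (inj₂ (n , c)) | at-b refl =
      ⊥-elim (xor-same (trans (side-keep hp) (trans (beyond-side hp o (σ-closed s) b-closed)
          (sym (side-keep hp)))) c)
    after-outer base w ow@(hw , cw) bf | inside i with within-on′
        (unkeep-isA hw (λ { refl → <-irrefl refl (proj₂ i) })) i (hσ , onC′ hσ ow) | bf
    ... | _ , j | inj₁ q = ⊥-elim (<-irrefl (sym q) (proj₂ j))
    ... | _ , j | inj₂ (n , c) =
        ⊥-elim (xor-same (trans sideB′-b (trans (trans (inside-cyc′ j) (sym (inside-cyc′ i)))
            (sym sideB′-b))) c)
    after-outer (keep hp o) w ow@(hw , cw) (inj₁ refl) | inside i =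
        ⊥-elim (outside-not-closed o (σ-closed s))
    after-outer (keep hp o) w ow@(hw , cw) (inj₂ (n , c)) | inside i =
      ⊥-elim (xor-same (trans (side-keep hp) (trans (beyond-side hp o (σ-closed s) (inside-closed i))
          (sym (side-keep hp)))) c)

    outer-succ : ∀ {p p′ r} → Corner p p′ → Outside r → Succ D C z p r → Succ D′ C (σ z) p′ r
    outer-succ {p} {p′} {r} cr o (mkSucc _ st on bf im) =
        mkSucc hσ (outer-start cr st) (outer-on (proj₁ on) o on) (outer-before cr o bf) im′
      where
      im′ : ∀ w → On D′ C (σ z) w → Before D′ C (σ z) p′ w → Before D′ C (σ z) w r → ⊥
      im′ w ow b₁ b₂ with after-outer cr w ow b₁
      ... | o′ , on′ , b₁′ = im w on′ b₁′ (outer-before′ (proj₁ on′) o′ b₂)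

    outer-last : ∀ {p p′} → Corner p p′ → Last D C z p → Last D′ C (σ z) p′
    outer-last {p} {p′} cr (mkLast _ st mx) = mkLast hσ (outer-start cr st) mx′
      where
      mx′ : ∀ w → On D′ C (σ z) w → Before D′ C (σ z) p′ w → ⊥
      mx′ w ow b₁ with after-outer cr w ow b₁
      ... | _ , on′ , b₁′ = mx w on′ b₁′

    module Inner (t : Through z) where
      hz′ : IsA D′ z
      hz′ = target-isA′ (inj₂ t)

      zi : Inside z
      zi = proj₁ (proj₂ t)

      inner-on : ∀ {p} → Inside p → On D C z p → On D′ C z p
      inner-on i o@(hp , _) =
          onC′⁻ hz′ (keep-isA hp (inside-not-a i)) (proj₂ (proj₁ (within-on hp i (hz , onC hz o))))

      inner-on′ : ∀ {p} → Inside p → On D′ C z p → On D C z p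
      inner-on′ i o@(hp , _) = onC⁻ hz hp′ (proj₂ (proj₁ (within-on′ hp′ i (hz′ , onC′ hz′ o))))
        where hp′ = unkeep-isA hp (λ { refl → <-irrefl refl (proj₂ i) })

      inner-start : ∀ {p} → Inside p → p ≡ z ⊎ On D C z p → IsA D p × (p ≡ z ⊎ On D′ C z p)
      inner-start i (inj₁ refl) = hz , inj₁ refl
      inner-start i (inj₂ o) = proj₁ o , inj₂ (inner-on i o)

      outside-not-before : ∀ {w u} → IsA D w → Outside w → Closed u → Before D′ C z w u → ⊥
      outside-not-before hw o hu (inj₁ refl) = outside-not-inside o zi
      outside-not-before hw o hu (inj₂ (n , c)) =
        xor-same (trans (side-keep hw) (trans (beyond-side hw o (inside-closed zi) hu)
            (sym (side-keep hw)))) c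

      inner-succ : ∀ {p r} → Inside p → Inside r → Succ D C z p r → Succ D′ C z p r
      inner-succ {p} {r} i j (mkSucc _ st on bf im) with inner-start i st
      ... | hp , st′ = mkSucc hz′ st′ (inner-on j on) (beforeC hp bf) im′
        where
        im′ : ∀ w → On D′ C z w → Before D′ C z p w → Before D′ C z w r → ⊥
        im′ w ow@(hw , _) b₁ b₂ with locate w
        ... | at-a q = isA′-not-a hw q
        ... | inside k = im w (inner-on′ k ow) (beforeC′ hp b₁) (beforeC′ (proj₁ (inner-on′ k ow)) b₂)
        ... | outside o = outside-not-before (unkeep-isA hw (outside-not-b o)) o (inside-closed j) b₂
        ... | at-b refl with b₂
        ... | inj₁ q = <-irrefl (sym q) (proj₂ zi)
        ... | inj₂ (n , c) = xor-same
            (trans sideB′-b (trans (trans (inside-cyc′ zi) (sym (inside-cyc′ j))) (sym sideB′-b))) c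

      -- The crossing that ends the inner part is renamed from a to b. The orders agree because a
      -- B-chord within the interval has a and b on the same side.
      inner-succ-a : ∀ {p} → Inside p → Succ D C z p a → Succ D′ C z p b
      inner-succ-a {p} i (mkSucc _ st on bf im) with inner-start i st
      ... | hp , st′ = mkSucc hz′ st′ (onC′⁻ hz′ b-isA′ (through-crosses-b′ t)) bf′ im′
        where
        bf′ : Before D′ C z p b
        bf′ = helper bf
          where
          helper : Before D C z p a → Before D′ C z p b
          helper (inj₁ q) = inj₁ q
          helper (inj₂ (n , c)) =
              inj₂ (isA-not-b hp , trans
                  (cong₂ _xor_ (side-keep hp)
                      (trans (side-keep hp) (within-side hp i b-coclosed a-coclosed))) c)
        im′ : ∀ w → On D′ C z w → Before D′ C z p w → Before D′ C z w b → ⊥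
        im′ w ow@(hw , _) b₁ b₂ with locate w
        ... | at-a q = isA′-not-a hw q
        ... | outside o = outside-not-before (unkeep-isA hw (outside-not-b o)) o b-closed b₂
        ... | at-b refl with b₂
        ... | inj₁ q = <-irrefl (sym q) (proj₂ zi)
        ... | inj₂ (n , _) = n refl
        im′ w ow@(hw , _) b₁ b₂ | inside k = im w (inner-on′ k ow) (beforeC′ hp b₁) (b₂′ b₂)
          where
          hw′ = proj₁ (inner-on′ k ow)
          b₂′ : Before D′ C z w b → Before D C z w a
          b₂′ (inj₁ q) = inj₁ q
          b₂′ (inj₂ (n , c)) = inj₂
              (inside-not-a k , trans
                  (sym (cong₂ _xor_ (side-keep hw′)
                      (trans (side-keep hw′) (within-side hw′ k b-coclosed a-coclosed)))) c)

  abstract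
    -- After A and B are exchanged along a → b, the black vertex that used to follow the crossing
    -- with x is paired with the white vertex at the next crossing; hence `σ` on black vertices
    -- only. On chords within, the second index is kept, since the inner part of a C-chord keeps its
    -- A-end; on chords beyond, the crossing belongs to the continuation, which now starts at `σ x`.
    image : Bool → (p x : ℕ) → Dec (p ≡ a) → Dec (Inside p) → Vertex
    image c p x (yes _) _ = c , b , (if c then σ x else x)
    image c p x (no _) (yes _) = c , p , x
    image c p x (no _) (no _) = c , p , σ x

    preimage : Bool → (p x : ℕ) → Dec (p ≡ b) → Dec (Inside p) → Vertex
    preimage c p x (yes _) _ = c , a , (if c then τ x else x)
    preimage c p x (no _) (yes _) = c , p , x
    preimage c p x (no _) (no _) = c , p , τ x

    f g : Vertex → Vertex
    f (c , p , x) = image c p x (p ≟ a) (inside? p)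
    g (c , p , x) = preimage c p x (p ≟ b) (inside? p)

    f-base : ∀ c x → f (c , a , x) ≡ (c , b , (if c then σ x else x))
    f-base c x with a ≟ a
    ... | yes _ = refl
    ... | no n = ⊥-elim (n refl)

    f-within : ∀ c {p} x → Inside p → f (c , p , x) ≡ (c , p , x)
    f-within c {p} x i with p ≟ a | inside? p
    ... | yes q | _ = ⊥-elim (inside-not-a i q)
    ... | no _ | yes _ = refl
    ... | no _ | no n = ⊥-elim (n i)

    f-beyond : ∀ c {p} x → Outside p → f (c , p , x) ≡ (c , p , σ x)
    f-beyond c {p} x o with p ≟ a | inside? p
    ... | yes q | _ = ⊥-elim (outside-not-a o q)
    ... | no _ | yes i = ⊥-elim (outside-not-inside o i)
    ... | no _ | no n = refl

    f-colour : ∀ v → proj₁ (f v) ≡ proj₁ v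
    f-colour (c , p , x) with p ≟ a | inside? p
    ... | yes _ | _ = refl
    ... | no _ | yes _ = refl
    ... | no _ | no _ = refl

    g-base : ∀ c x → g (c , b , x) ≡ (c , a , (if c then τ x else x))
    g-base c x with b ≟ b
    ... | yes _ = refl
    ... | no n = ⊥-elim (n refl)

    g-within : ∀ c {p} x → Inside p → g (c , p , x) ≡ (c , p , x)
    g-within c {p} x i with p ≟ b | inside? p
    ... | yes refl | _ = ⊥-elim (<-irrefl refl (proj₂ i))
    ... | no _ | yes _ = refl
    ... | no _ | no n = ⊥-elim (n i)

    g-beyond : ∀ c {p} x → Outside p → g (c , p , x) ≡ (c , p , τ x)
    g-beyond c {p} x o with p ≟ b | inside? p
    ... | yes q | _ = ⊥-elim (outside-not-b o q)
    ... | no _ | yes i = ⊥-elim (outside-not-inside o i)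
    ... | no _ | no n = refl

  f-unmoved : ∀ c {p z} → IsA D p → p ≢ a → ¬ Source z → f (c , p , z) ≡ (c , p , z)
  f-unmoved c {p} {z} hp n ¬s with bkind hp
  ... | base q = ⊥-elim (n q)
  ... | within i _ = f-within c z i
  ... | beyond o _ = trans (f-beyond c z o) (cong (λ x → c , p , x) (σ-id ¬s))

  outside-τ : ∀ {p} → Outside p → τ p ≡ p
  outside-τ o = τ-id λ t → outside-not-closed o (target-closed t)

  valid-source : ∀ {c x} → Valid D (c , a , x) → Source x
  valid-source (_ , _ , inj₁ (_ , refl)) = inj₁ refl
  valid-source (_ , hx , inj₂ c) = inj₂ (crosses-a hx c)

  valid-target : ∀ {c x} → Valid D′ (c , b , x) → Target x
  valid-target (_ , _ , inj₁ (_ , refl)) = inj₁ refl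
  valid-target (_ , hx , inj₂ c) = inj₂ (crosses-b′ hx c)

  white-through : ∀ {x} → Valid D (false , a , x) → Through x
  white-through (_ , hx , inj₂ c) = crosses-a hx c

  white-through′ : ∀ {x} → Valid D′ (false , b , x) → Through x
  white-through′ (_ , hx , inj₂ c) = crosses-b′ hx c

  f-valid : ∀ v → Valid D v → Valid D′ (f v)
  f-valid (c , p , x) (hp , hx , e) with bkind hp
  f-valid (true , p , x) v@(hp , hx , e) | base refl =
      subst (Valid D′) (sym (f-base true x)) (b-isA′ , σ-isA′ hx , helper (σ-target (valid-source v)))
    where
    helper : Target (σ x) → (true ≡ true × b ≡ σ x) ⊎ Crosses D′ B b (σ x)
    helper (inj₁ q) = inj₁ (refl , sym q)
    helper (inj₂ t) = inj₂ (through-crosses-b′ t)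
  f-valid (false , p , x) v@(hp , hx , e) | base refl =
      subst (Valid D′) (sym (f-base false x)) (b-isA′ , target-isA′ (inj₂ t) , inj₂
          (through-crosses-b′ t))
    where t = white-through v
  f-valid (c , p , x) (hp , hx , inj₁ (q , refl)) | within i _ =
    subst (Valid D′) (sym (f-within c x i)) (keep-isA hp (inside-not-a i) , keep-isA hx (inside-not-a i)
        , inj₁ (q , refl))
  f-valid (c , p , x) (hp , hx , inj₂ cr) | within i _ =
    subst (Valid D′) (sym (f-within c x i)) (keep-isA hp (inside-not-a i) , proj₁ on , inj₂ (proj₂ on))
    where on = proj₁ (within-on hp i (hx , cr))
  f-valid (c , p , x) (hp , hx , inj₁ (q , refl)) | beyond o _ =
    subst (Valid D′) (sym (f-beyond c x o)) (keep-isA hp (outside-not-a o) , σ-isA′ hx , inj₁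
        (q , sym (outside-σ o)))
  f-valid (c , p , x) (hp , hx , inj₂ cr) | beyond o _ =
    subst (Valid D′) (sym (f-beyond c x o)) (keep-isA hp (outside-not-a o) , σ-isA′ hx , inj₂
        (proj₂ (beyond-on hp o (hx , cr))))

  data BKind′ (p : ℕ) : Set where
    base : p ≡ b → BKind′ p
    within : IsA D p → Inside p → BKind′ p
    beyond : IsA D p → Outside p → BKind′ p

  bkind′ : ∀ {p} → IsA D′ p → BKind′ p
  bkind′ {p} hp with p ≟ b
  ... | yes q = base q
  ... | no n with bkind (unkeep-isA hp n)
  ... | base q = ⊥-elim (isA′-not-a hp q)
  ... | within i _ = within (unkeep-isA hp n) i
  ... | beyond o _ = beyond (unkeep-isA hp n) o

  g-valid : ∀ v → Valid D′ v → Valid D (g v)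
  g-valid (c , p , x) (hp , hx , e) with bkind′ hp
  g-valid (true , p , x) v@(hp , hx , e) | base refl =
      subst (Valid D) (sym (g-base true x)) (a-isA , τ-isA hx , helper (τ-source (valid-target v)))
    where
    helper : Source (τ x) → (true ≡ true × a ≡ τ x) ⊎ Crosses D B a (τ x)
    helper (inj₁ q) = inj₁ (refl , sym q)
    helper (inj₂ t) = inj₂ (through-crosses-a t)
  g-valid (false , p , x) v@(hp , hx , e) | base refl =
      subst (Valid D) (sym (g-base false x)) (a-isA , proj₁ t , inj₂ (through-crosses-a t))
    where t = white-through′ v
  g-valid (c , p , x) (hp , hx , inj₁ (q , refl)) | within h i =
      subst (Valid D) (sym (g-within c x i)) (h , h , inj₁ (q , refl))
  g-valid (c , p , x) (hp , hx , inj₂ cr) | within h i =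
    subst (Valid D) (sym (g-within c x i)) (h , proj₁ on , inj₂ (proj₂ on))
    where on = proj₁ (within-on′ h i (hx , cr))
  g-valid (c , p , x) (hp , hx , inj₁ (q , refl)) | beyond h o =
    subst (Valid D) (sym (g-beyond c x o)) (h , τ-isA hx , inj₁ (q , sym (outside-τ o)))
  g-valid (c , p , x) (hp , hx , inj₂ cr) | beyond h o =
    subst (Valid D) (sym (g-beyond c x o)) (h , τ-isA hx ,
      inj₂ (beyond-off h o (τ-isA hx) (subst (Crosses D′ B p) (sym (στ hx)) cr)))

  gf : ∀ v → Valid D v → g (f v) ≡ v
  gf (c , p , x) (hp , hx , e) with bkind hp
  gf (true , p , x) (hp , hx , e) | base refl =
      trans (cong g (f-base true x)) (trans (g-base true (σ x)) (cong (λ x → true , a , x) (τσ hx)))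
  gf (false , p , x) (hp , hx , e) | base refl = trans (cong g (f-base false x)) (g-base false x)
  ... | within i _ = trans (cong g (f-within c x i)) (g-within c x i)
  ... | beyond o _ = trans (cong g (f-beyond c x o))
      (trans (g-beyond c (σ x) o) (cong (λ x → c , p , x) (τσ hx)))

  fg : ∀ v → Valid D′ v → f (g v) ≡ v
  fg (c , p , x) (hp , hx , e) with bkind′ hp
  fg (true , p , x) (hp , hx , e) | base refl =
      trans (cong f (g-base true x)) (trans (f-base true (τ x)) (cong (λ x → true , b , x) (στ hx)))
  fg (false , p , x) (hp , hx , e) | base refl = trans (cong f (g-base false x)) (f-base false x)
  ... | within _ i = trans (cong f (g-within c x i)) (f-within c x i)
  ... | beyond _ o = trans (cong f (g-beyond c x o))
      (trans (f-beyond c (τ x) o) (cong (λ x → c , p , x) (στ hx)))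

  exchange : Letter → Letter
  exchange A = B
  exchange B = A
  exchange C = C

  abstract
    π : Vertex → Letter → Letter
    π (_ , p , _) c with p ≟ a
    ... | yes _ = exchange c
    ... | no _ = c

    π-base : ∀ {k x} c → π (k , a , x) c ≡ exchange c
    π-base c with a ≟ a
    ... | yes _ = refl
    ... | no n = ⊥-elim (n refl)

    π-other : ∀ {k p x} c → p ≢ a → π (k , p , x) c ≡ c
    π-other {p = p} c n with p ≟ a
    ... | yes q = ⊥-elim (n q)
    ... | no _ = refl

    π-C : ∀ v → π v C ≡ C
    π-C (_ , p , _) with p ≟ a
    ... | yes _ = refl
    ... | no _ = refl

  Turns : Vertex → Set
  Turns v = ∀ c → π v (orient (sign D v) c) ≡ orient (sign D′ (f v)) (π v c)

  -- On a → b the C-chords concerned have their far ends outside, so `sign` is false before and true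
  -- after; this compensates the exchange of A and B. At all other vertices both the colours and
  -- `sign` are kept.
  turn : ∀ v → Valid D v → Turns v
  turn (k , p , x) (hp , hx , e) with bkind hp
  turn (k , p , x) v@(hp , hx , e) | base refl = λ c → begin
      π (k , a , x) (orient (sign D (k , a , x)) c) ≡⟨ π-base _ ⟩
      exchange (orient (sign D (k , a , x)) c)      ≡⟨ cong (λ s → exchange (orient s c))
          (trans sideB-a (outside-cyc (source-far (valid-source v)))) ⟩
      exchange (orient false c)                     ≡⟨ orient-exchange c ⟩
      orient true (exchange c)                      ≡⟨ cong₂ orient
          (sym (trans (cong (sign D′) (f-base k x)) (trans sideB′-b (outside-cyc′ (far k v)))))
              (sym (π-base c)) ⟩
      orient (sign D′ (f (k , a , x))) (π (k , a , x) c) ∎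
    where
    open ≡-Reasoning
    orient-exchange : ∀ c → exchange (orient false c) ≡ orient true (exchange c)
    orient-exchange A = refl
    orient-exchange B = refl
    orient-exchange C = refl
    far : ∀ k → Valid D (k , a , x) → Outside (R′ C (if k then σ x else x))
    far true v = R′C-target (σ-target (valid-source v))
    far false v = R′C-target (inj₂ (white-through v))
  ... | within i _ = λ c → trans (π-other _ (inside-not-a i)) (cong₂ orient
      (sym (trans (cong (sign D′) (f-within k x i))
          (trans (side-keep hp) (within-R′ hp i hx (inner e))))) (sym (π-other c (inside-not-a i))))
    where
    inner : (k ≡ true × p ≡ x) ⊎ Crosses D B p x → Inside x
    inner (inj₁ (_ , refl)) = i
    inner (inj₂ cr) = within-crosses hp i hx cr
  ... | beyond o _ = λ c → trans (π-other _ (outside-not-a o)) (cong₂ orient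
      (sym (trans (cong (sign D′) (f-beyond k x o))
          (trans (side-keep hp) (cong (side D B p) (R′C-σ hx))))) (sym (π-other c (outside-not-a o))))

  start-isA : ∀ {z p} → IsA D z → p ≡ z ⊎ On D C z p → IsA D p
  start-isA hz (inj₁ refl) = hz
  start-isA hz (inj₂ o) = proj₁ o

  beyond-not-before : ∀ {z p r} → Source z → IsA D p → Outside p → Closed r → Before D C z p r → ⊥
  beyond-not-before s hp o hr (inj₁ refl) = outside-not-closed o (source-closed s)
  beyond-not-before s hp o hr (inj₂ (n , c)) = xor-same (beyond-side hp o (source-closed s) hr) c

  inside-start : ∀ {z p} → IsA D z → Inside p → p ≡ z ⊎ On D C z p → Inside z
  inside-start hz i (inj₁ refl) = i
  inside-start hz i (inj₂ o) = within-crosses (proj₁ o) i hz (onC hz o)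

  source-through : ∀ {z} → Source z → Inside z → Through z
  source-through (inj₁ refl) i = ⊥-elim (inside-not-a i refl)
  source-through (inj₂ t) _ = t

  SuccImage : ℕ → ℕ → ℕ → Set
  SuccImage z p r = Σ ℕ λ z′ → Σ ℕ λ p′ → Σ ℕ λ r′ →
    f (true , p , z) ≡ (true , p′ , z′) × f (false , r , z) ≡ (false , r′ , z′) × Succ D′ C z′ p′ r′

  -- A leaving C-chord meets first the chords within, then a → b, then the chords beyond. Of the
  -- nine positions of p and r only four are compatible with this; a direct step from within to
  -- beyond would omit the crossing with a → b, contradicting `immediate`.
  succ-image : ∀ {z p r} → Succ D C z p r → SuccImage z p r
  succ-image {z} {p} {r} sc@(mkSucc hz st on bf im) = helper (kind hz)
    where
    hp = start-isA hz st
    unmoved : ¬ Source z → SuccImage z p r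
    unmoved ¬s = z , p , r , f-unmoved true hp (proj₁ (proj₂ (U.start-isA st))) ¬s , f-unmoved false
        (proj₁ on) (U.not-a on) ¬s , U.succ sc
      where module U = Unmoved hz ¬s
    from : Source z → BKind p → BKind r → SuccImage z p r
    from s (base refl) (base refl) = ⊥-elim (helper bf)
      where helper : Before D C z a a → ⊥
            helper (inj₁ q) = through-not-a (crosses-a hz (onC hz on)) (sym q)
            helper (inj₂ (n , _)) = n refl
    from s (within i _) (base refl) =
        z , p , b , f-within true z i , f-base false z , Moved.Inner.inner-succ-a hz s
            (crosses-a hz (onC hz on)) i sc
    from s (beyond o _) (base refl) = ⊥-elim (beyond-not-before s hp o a-closed bf)
    from s (base refl) (within j _) = ⊥-elim (helper bf)
      where zi = within-crosses (proj₁ on) j hz (onC hz on)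
            helper : Before D C z a r → ⊥
            helper (inj₁ q) = inside-not-a zi (sym q)
            helper (inj₂ (n , c)) =
                xor-same (trans sideB-a (trans (trans (inside-cyc zi) (sym (inside-cyc j)))
                    (sym sideB-a))) c
    from (inj₁ refl) (within i _) (within j _) =
        ⊥-elim (<-irrefl refl (proj₁ (within-crosses (proj₁ on) j hz (onC hz on))))
    from s@(inj₂ t) (within i _) (within j _) =
        z , p , r , f-within true z i , f-within false z j , Moved.Inner.inner-succ hz s t i j sc
    from s (beyond o _) (within j _) = ⊥-elim (beyond-not-before s hp o (inside-closed j) bf)
    from s (base refl) (beyond o _) = σ z , b , r , f-base true z , f-beyond false z o , Moved.outer-succ
        hz s base o sc
    from s (beyond o _) (beyond o′ _) =
        σ z , p , r , f-beyond true z o , f-beyond false z o′ , Moved.outer-succ hz s (keep hp o) o′ sc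
    from s (within i _) (beyond o _) =
        ⊥-elim (im a (onC⁻ hz a-isA (through-crosses-a t)) (helper bf) (Moved.before-outer hz s o))
      where
      t : Through z
      t = source-through s (inside-start hz i st)
      helper : Before D C z p r → Before D C z p a
      helper (inj₁ q) = inj₁ q
      helper (inj₂ (n , c)) =
          inj₂ (inside-not-a i , trans
              (cong (side D B p z xor_) (within-side hp i a-coclosed (outside-coclosed o))) c)
    helper : Kind z → SuccImage z p r
    helper (through s) = from s (bkind hp) (bkind (proj₁ on))
    helper (within ¬s _ _) = unmoved ¬s
    helper (beyond ¬s _ _) = unmoved ¬s

  LastImage : ℕ → ℕ → Set
  LastImage z p = Σ ℕ λ z′ → Σ ℕ λ p′ → f (true , p , z) ≡ (true , p′ , z′) × Last D′ C z′ p′ × R′ C z′ ≡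
      R D C z

  last-image : ∀ {z p} → Last D C z p → LastImage z p
  last-image {z} {p} ls@(mkLast hz st mx) = helper (kind hz)
    where
    hp = start-isA hz st
    unmoved : ¬ Source z → LastImage z p
    unmoved ¬s = z , p , f-unmoved true hp (proj₁ (proj₂ (U.start-isA st))) ¬s , U.last ls , R′C-keep hz
        ¬s
      where module U = Unmoved hz ¬s
    from : Source z → BKind p → LastImage z p
    from s (base refl) = σ z , b , f-base true z , Moved.outer-last hz s base ls , R′C-σ hz
    from s (beyond o _) = σ z , p , f-beyond true z o , Moved.outer-last hz s (keep hp o) ls , R′C-σ hz
    from s (within i _) = ⊥-elim (mx a (onC⁻ hz a-isA (through-crosses-a t)) (helper st))
      where
      t : Through z
      t = source-through s (inside-start hz i st)
      helper : p ≡ z ⊎ On D C z p → Before D C z p a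
      helper (inj₁ q) = inj₁ q
      helper (inj₂ o) = inj₂ (inside-not-a i ,
        trans (cong (side D B p z xor_) (within-side hp i a-coclosed (outside-coclosed (source-far s))))
            (proj₂ (onC hz o)))
    helper : Kind z → LastImage z p
    helper (through s) = from s (bkind hp)
    helper (within ¬s _ _) = unmoved ¬s
    helper (beyond ¬s _ _) = unmoved ¬s

  target-not-b : ∀ {x} → Through x → b ≢ x
  target-not-b t q = isA-not-b (proj₁ t) (sym q)

  -- Along a → b the constructors are exchanged in pairs: `hub` with `end`, `out` with `bwd` and
  -- `into` with `fwd`. Everywhere else an edge keeps its constructor.
  edge : ∀ v → Valid D v → ∀ c t → Edge D v c t → Edge D′ (f v) (π v c) (mapTarget (λ p → p) f t)
  edge v (hp , hx , e) c t (hub {p}) with bkind hp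
  ... | base refl rewrite f-base true a | π-base {true} {a} A =
    subst (λ q → Edge D′ (true , b , σ a) B (inj₁ q)) R′B-b (end isB (last-b (σ-step (inj₁ refl))))
  ... | within i _ rewrite f-within true p i | π-other {true} {p} {p} A (inside-not-a i) = hub
  ... | beyond o _ rewrite f-beyond true p o | π-other {true} {p} {p} A (outside-not-a o) | outside-σ o =
      hub
  edge v w@(hp , hx , e) c t (out {p} {x} n) with bkind hp
  ... | base refl rewrite f-base false x | f-base true x | π-base {false} {x} A =
    bwd isB (succ-b (σ-step (inj₂ (white-through w))) (white-through w))
  ... | within i _ rewrite f-within false x i | f-within true x i | π-other {false} {p} {x} A
      (inside-not-a i) = out n
  ... | beyond o _ rewrite f-beyond false x o | f-beyond true x o | π-other {false} {p} {x} A
      (outside-not-a o) =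
    out (λ q → n (σ-injective hp hx (trans (outside-σ o) q)))
  edge v w@(hp , hx , e) c t (into {p} {x} n) with bkind hp
  ... | base refl rewrite f-base false x | f-base true x | π-base {true} {x} A =
      fwd isB (succ-b (σ-step (inj₂ th)) th)
    where
    th : Through x
    th with valid-source w
    ... | inj₁ q = ⊥-elim (n (sym q))
    ... | inj₂ t = t
  ... | within i _ rewrite f-within false x i | f-within true x i | π-other {true} {p} {x} A
      (inside-not-a i) = into n
  ... | beyond o _ rewrite f-beyond false x o | f-beyond true x o | π-other {true} {p} {x} A
      (outside-not-a o) =
    into (λ q → n (σ-injective hp hx (trans (outside-σ o) q)))
  edge v w@(hp , hx , e) c t (fwd {p = p} {x} {z} isB sc) with bkind hp
  ... | base refl rewrite f-base false z | f-base true x | π-base {true} {x} B | σ-unique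
      (proj₁ (succ-a sc)) = into (target-not-b (proj₂ (succ-a sc)))
  ... | within i _ rewrite f-within true x i | f-within false z i | π-other {true} {p} {x} B
      (inside-not-a i) = fwd isB (within-succ i sc)
  ... | beyond o _ rewrite f-beyond true x o | f-beyond false z o | π-other {true} {p} {x} B
      (outside-not-a o) = fwd isB (beyond-succ o sc)
  edge v w@(hp , hx , e) c t (bwd {p = p} {x} {z} isB sc) with bkind hp
  ... | base refl rewrite f-base false z | f-base true x | π-base {false} {z} B | σ-unique
      (proj₁ (succ-a sc)) = out (target-not-b (proj₂ (succ-a sc)))
  ... | within i _ rewrite f-within true x i | f-within false z i | π-other {false} {p} {z} B
      (inside-not-a i) = bwd isB (within-succ i sc)
  ... | beyond o _ rewrite f-beyond true x o | f-beyond false z o | π-other {false} {p} {z} B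
      (outside-not-a o) = bwd isB (beyond-succ o sc)
  edge v w@(hp , hx , e) c t (end {p = p} {x} isB ls) with bkind hp
  ... | base refl rewrite f-base true x | π-base {true} {x} B | proj₂ (last-a ls) =
      subst (λ q → Edge D′ (true , b , b) A (inj₁ q)) (sym Ra) hub
  ... | within i _ rewrite f-within true x i | π-other {true} {p} {x} B (inside-not-a i) =
    subst (λ q → Edge D′ (true , p , x) B (inj₁ q)) (R′B-other (isA-not-b hp))
        (end isB (within-last i ls))
  ... | beyond o _ rewrite f-beyond true x o | π-other {true} {p} {x} B (outside-not-a o) =
    subst (λ q → Edge D′ (true , p , σ x) B (inj₁ q)) (R′B-other (isA-not-b hp))
        (end isB (beyond-last o ls))
  edge v _ c t (fwd {p = z} {p} {r} isC sc) with succ-image sc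
  ... | z′ , p′ , r′ , q , q′ , sc′ rewrite q | q′ | π-C (true , p , z) = fwd isC sc′
  edge v _ c t (bwd {p = z} {p} {r} isC sc) with succ-image sc
  ... | z′ , p′ , r′ , q , q′ , sc′ rewrite q | q′ | π-C (false , r , z) = bwd isC sc′
  edge v _ c t (end {p = z} {p} isC ls) with last-image ls
  ... | z′ , p′ , q , ls′ , r rewrite q | π-C (true , p , z) | sym r = end isC ls′

  boundary : ∀ j v → BoundaryEdge D j v → BoundaryEdge D′ j (f v)
  boundary j v (atA hp) with bkind hp
  ... | base refl rewrite f-base true a = subst (λ q → BoundaryEdge D′ q (true , b , σ a)) R′B-b
      (atEnd isB (last-b (σ-step (inj₁ refl))))
  ... | within i _ rewrite f-within true j i = atA (keep-isA hp (inside-not-a i))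
  ... | beyond o _ rewrite f-beyond true j o | outside-σ o = atA (keep-isA hp (outside-not-a o))
  boundary j v (atEnd {p = p} {x} isB ls) with bkind (Last.isA ls)
  ... | base refl rewrite f-base true x | proj₂ (last-a ls) =
      subst (λ q → BoundaryEdge D′ q (true , b , b)) (sym Ra) (atA b-isA′)
  ... | within i _ rewrite f-within true x i =
    subst (λ q → BoundaryEdge D′ q (true , p , x)) (R′B-other (isA-not-b (Last.isA ls)))
        (atEnd isB (within-last i ls))
  ... | beyond o _ rewrite f-beyond true x o =
    subst (λ q → BoundaryEdge D′ q (true , p , σ x)) (R′B-other (isA-not-b (Last.isA ls)))
        (atEnd isB (beyond-last o ls))
  boundary j v (atEnd {p = z} {p} isC ls) with last-image ls
  ... | z′ , p′ , q , ls′ , r rewrite q | sym r = atEnd isC ls′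

  switchIso : Iso (λ p → p) false D D′
  switchIso = record
    { f = f ; g = g ; f-valid = f-valid ; g-valid = g-valid ; gf = gf ; fg = fg
    ; colour = f-colour ; π = π ; turn = turn ; edge = edge ; boundary = boundary }

-- Crossing points of semicircles

≡→T : ∀ {x} → x ≡ true → T x
≡→T refl = tt

T→≡ : ∀ {x} → T x → x ≡ true
T→≡ {true} _ = refl

<→<ᵇ : ∀ {m n} → m < n → (m <ᵇ n) ≡ true
<→<ᵇ p = T→≡ (<⇒<ᵇ p)

<ᵇ→< : ∀ {m n} → (m <ᵇ n) ≡ true → m < n
<ᵇ→< {m} {n} e = <ᵇ⇒< m n (≡→T e)

≥→<ᵇ : ∀ {m n} → n ≤ m → (m <ᵇ n) ≡ false
≥→<ᵇ {m} {n} h with m <ᵇ n in e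
... | false = refl
... | true = ⊥-elim (<⇒≱ (<ᵇ→< e) h)

fractionLt : ℕ × ℕ → ℕ × ℕ → Bool
fractionLt (p , q) (r , s) = p * s <ᵇ r * q

fractionLt-irrefl : ∀ k → fractionLt k k ≡ false
fractionLt-irrefl (p , q) = ≥→<ᵇ {p * q} ≤-refl

fractionLt-asym : ∀ k l → fractionLt k l ≡ true → fractionLt l k ≡ false
fractionLt-asym (p , q) (r , s) h = ≥→<ᵇ {r * q} {p * s} (<⇒≤ (<ᵇ→< {p * s} {r * q} h))

-- The abscissa computed by `key`, but with the chord that is being followed as first argument,
-- whatever its colour.
crossingKey : ℕ → ℕ → ℕ → ℕ → ℕ × ℕ
crossingKey p q x y = if p <ᵇ x then (x * y ∸ p * q , (x + y) ∸ (p + q)) else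
    (p * q ∸ x * y , (p + q) ∸ (x + y))

data Interlaced (p q x y : ℕ) : Set where
  right : p < x → x < q → q < y → Interlaced p q x y
  left  : x < p → p < y → y < q → Interlaced p q x y

innerEnd : ℕ → ℕ → ℕ → ℕ
innerEnd p x y = if p <ᵇ x then x else y

gap : ∀ {m n} → m < n → Σ ℕ λ d → 0 < d × m + d ≡ n
gap {m} {n} h with m≤n⇒∃[o]m+o≡n h
... | d , e = suc d , s≤s z≤n , trans (+-suc m d) e

private
  product : ∀ p q a f → (p + a) * (q + f) ≡ (p * f + a * q + a * f) + p * q
  product = solve-∀

  total : ∀ p q a f → (p + a) + (q + f) ≡ (a + f) + (p + q)
  total = solve-∀

  exceed : ∀ {m n d} → n ≡ m + d → 0 < d → (m <ᵇ n) ≡ true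
  exceed {m} {n} {d} e h = <→<ᵇ (subst (m <_) (sym e) (m<m+n m h))

  pos-* : ∀ {m n} → 0 < m → 0 < n → 0 < m * n
  pos-* {suc m} {suc n} _ _ = s≤s z≤n

  pos-+ˡ : ∀ {m n} → 0 < m → 0 < m + n
  pos-+ˡ {suc m} _ = s≤s z≤n

  pos-+ʳ : ∀ m {n} → 0 < n → 0 < m + n
  pos-+ʳ m {suc n} _ = subst (0 <_) (sym (+-suc m n)) (s≤s z≤n)

  differences : ∀ p q a f →
      ((p + a) * (q + f) ∸ p * q , (p + a) + (q + f) ∸ (p + q)) ≡ (p * f + a * q + a * f , a + f)
  differences p q a f = cong₂ _,_ (trans (cong (_∸ p * q) (product p q a f)) (m+n∸n≡m _ (p * q)))
                                  (trans (cong (_∸ (p + q)) (total p q a f)) (m+n∸n≡m _ (p + q)))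

  if-true : ∀ {X : Set} {b} {x y : X} → b ≡ true → (if b then x else y) ≡ x
  if-true refl = refl

  if-false : ∀ {X : Set} {b} {x y : X} → b ≡ false → (if b then x else y) ≡ y
  if-false refl = refl

-- Parametrising by the gaps between endpoints removes the truncated subtractions, and comparisons
-- of keys become inequalities between polynomials with nonnegative coefficients.
crossingKey-right : ∀ p q a f → 0 < a → crossingKey p q (p + a) (q + f) ≡ (p * f + a * q + a * f , a + f)
crossingKey-right p q a f h = trans (if-true (<→<ᵇ (m<m+n p h))) (differences p q a f)

crossingKey-left : ∀ x y a f → crossingKey (x + a) (y + f) x y ≡ (x * f + a * y + a * f , a + f)
crossingKey-left x y a f = trans (if-false (≥→<ᵇ {x + a} {x} (m≤m+n x a))) (differences x y a f)

-- The three identities below are positivity certificates for the comparison of two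
-- crossing points on a semicircle; consecutive endpoints are p, p + a, p + a + b, ….
private
  rr : ∀ p a b c d e → let q = p + a + b + c in
    (p * d + (a + b) * q + (a + b) * d) * (a + (d + e)) ≡
    (p * (d + e) + a * q + a * (d + e)) * (a + b + d) + ((a + b + c + d) * (b * d + b * e) + a * e * c)
  rr = solve-∀

  ll : ∀ z a b c d e → let x = z + a
                           y = z + a + b + c
                           w = z + a + b + c + d in
    (z * e + (a + b) * w + (a + b) * e) * (b + (d + e)) ≡
    (x * (d + e) + b * y + b * (d + e)) * (a + b + e) + ((e + d + c + b) * (b * d + d * a) + e * a * c)
  ll = solve-∀

  lr : ∀ x a b c d e → let p = x + a
                           y = x + a + b
                           q = x + a + b + c + d in
    (p * e + (b + c) * q + (b + c) * e) * (a + (c + d)) ≡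
    (x * (c + d) + a * y + a * (c + d)) * (b + c + e) + ((b + c) * (c + d) * (a + b + c + d + e) + c * e
        * a)
  lr = solve-∀

  key-rr : ∀ {p x z q w y} → p < x → x < z → z < q → q < w → w < y →
           fractionLt (crossingKey p q x y) (crossingKey p q z w) ≡ true
  key-rr {p} h₁ h₂ h₃ h₄ h₅ with gap h₁ | gap h₂ | gap h₃ | gap h₄ | gap h₅
  ... | a , a⁺ , refl | b , b⁺ , refl | c , c⁺ , refl | d , d⁺ , refl | e , e⁺ , refl =
    subst₂ (λ k l → fractionLt k l ≡ true)
      (sym (trans (cong (crossingKey p q (p + a)) (+-assoc q d e)) (crossingKey-right p q a (d + e) a⁺)))
      (sym (trans (cong (λ z → crossingKey p q z (q + d)) (+-assoc p a b))
          (crossingKey-right p q (a + b) d (pos-+ʳ a b⁺))))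
      (exceed (rr p a b c d e) (pos-+ˡ (pos-* (pos-+ʳ (a + b + c) d⁺) (pos-+ˡ (pos-* b⁺ d⁺)))))
    where q = p + a + b + c

  key-ll : ∀ {z x p y w q} → z < x → x < p → p < y → y < w → w < q →
           fractionLt (crossingKey p q x y) (crossingKey p q z w) ≡ true
  key-ll {z} h₁ h₂ h₃ h₄ h₅ with gap h₁ | gap h₂ | gap h₃ | gap h₄ | gap h₅
  ... | a , a⁺ , refl | b , b⁺ , refl | c , c⁺ , refl | d , d⁺ , refl | e , e⁺ , refl =
    subst₂ (λ k l → fractionLt k l ≡ true)
      (sym (trans (cong (λ q → crossingKey (x + b) q x y) (+-assoc y d e))
          (crossingKey-left x y b (d + e))))
      (sym (trans (cong (λ p → crossingKey p (w + e) z w) (+-assoc z a b))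
          (crossingKey-left z w (a + b) e)))
      (exceed (ll z a b c d e) (pos-+ˡ (pos-* (pos-+ʳ (e + d + c) b⁺) (pos-+ˡ (pos-* b⁺ d⁺)))))
    where x = z + a
          y = z + a + b + c
          w = z + a + b + c + d

  key-lr : ∀ {x p y z q w} → x < p → p < y → y < z → z < q → q < w →
           fractionLt (crossingKey p q x y) (crossingKey p q z w) ≡ true
  key-lr {x} h₁ h₂ h₃ h₄ h₅ with gap h₁ | gap h₂ | gap h₃ | gap h₄ | gap h₅
  ... | a , a⁺ , refl | b , b⁺ , refl | c , c⁺ , refl | d , d⁺ , refl | e , e⁺ , refl =
    subst₂ (λ k l → fractionLt k l ≡ true)
      (sym (trans (cong (λ q → crossingKey p q x y) (+-assoc y c d)) (crossingKey-left x y a (c + d))))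
      (sym (trans (cong (λ z → crossingKey p q z (q + e)) (+-assoc p b c))
          (crossingKey-right p q (b + c) e (pos-+ˡ b⁺))))
      (exceed (lr x a b c d e)
          (pos-+ˡ (pos-* (pos-* (pos-+ʳ b c⁺) (pos-+ʳ c d⁺)) (pos-+ʳ (a + b + c + d) e⁺))))
    where p = x + a
          y = x + a + b
          q = x + a + b + c + d

inner-right : ∀ {p x y} → p < x → innerEnd p x y ≡ x
inner-right h = if-true (<→<ᵇ h)

inner-left : ∀ {p x y} → x < p → innerEnd p x y ≡ y
inner-left h = if-false (≥→<ᵇ (<⇒≤ h))

-- The inner end is the endpoint of the crossing chord below the semicircle being followed. Three
-- cases are the certificates above; in the fourth the order of inner ends would be z < p < x < w <
-- q < y, and the chords from x and z would cross.
crossingKey-mono : ∀ {p q x y z w} → Interlaced p q x y → Interlaced p q z w → x ≢ z →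
    cyc x z y ≡ cyc x w y →
  innerEnd p x y < innerEnd p z w → fractionLt (crossingKey p q x y) (crossingKey p q z w) ≡ true
crossingKey-mono {p} {q} {x} {y} {z} {w} (right h₁ h₂ h₃) (right k₁ k₂ k₃) n nc lt = key-rr h₁ lt′ k₂ k₃
    (solve 5 (λ q x y z w → cyc′ x z y ≈ cyc′ x w y ⊢ x ≺ z ⊢ z ≺ q ⊢ q ≺ w ⊢ q ≺ y ⊢ ⊢ w ≺ y) refl
        (q ∷ x ∷ y ∷ z ∷ w ∷ []) nc lt′ k₂ k₃ h₃)
  where lt′ = subst₂ _<_ (inner-right h₁) (inner-right k₁) lt
crossingKey-mono {p} {q} {x} {y} {z} {w} (left h₁ h₂ h₃) (left k₁ k₂ k₃) n nc lt = key-ll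
    (solve 5 (λ p x y z w → x ≄ z ⊢ cyc′ x z y ≈ cyc′ x w y ⊢ x ≺ p ⊢ p ≺ y ⊢ y ≺ w ⊢ z ≺ p ⊢ ⊢ z ≺ x)
        refl (p ∷ x ∷ y ∷ z ∷ w ∷ []) n nc h₁ h₂ lt′ k₁) h₁ h₂ lt′ k₃
  where lt′ = subst₂ _<_ (inner-left h₁) (inner-left k₁) lt
crossingKey-mono {p} {q} {x} {y} {z} {w} (left h₁ h₂ h₃) (right k₁ k₂ k₃) n nc lt =
  key-lr h₁ h₂ (subst₂ _<_ (inner-left h₁) (inner-right k₁) lt) k₂ k₃
crossingKey-mono {p} {q} {x} {y} {z} {w} (right h₁ h₂ h₃) (left k₁ k₂ k₃) n nc lt = ⊥-elim (<-irrefl refl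
    (solve 6 (λ p q x y z w → cyc′ x z y ≈ cyc′ x w y ⊢ p ≺ x ⊢ x ≺ w ⊢ w ≺ q ⊢ q ≺ y ⊢ z ≺ p ⊢ ⊢ p ≺ p)
        refl (p ∷ q ∷ x ∷ y ∷ z ∷ w ∷ [])
      nc h₁ (subst₂ _<_ (inner-right h₁) (inner-left k₁) lt) k₃ h₃ k₁))

private
  start-r : ∀ p a c f → let q = p + a + c in (p * f + a * q + a * f) * 1 ≡ p * (a + f) + a * (a + c + f)
  start-r = solve-∀

  start-l : ∀ x a b f → let y = x + a + b in (x * f + a * y + a * f) * 1 ≡ (x + a) * (a + f) + a * b
  start-l = solve-∀

  end-r : ∀ p a c f → let q = p + a + c in q * (a + f) ≡ (p * f + a * q + a * f) * 1 + c * f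
  end-r = solve-∀

  end-l : ∀ x a b f → let y = x + a + b in (y + f) * (a + f) ≡ (x * f + a * y + a * f) * 1 + f * (a + b + f)
  end-l = solve-∀

-- The web follows a chord from the fraction p / 1 and looks back from q / 1, so these must lie
-- strictly before and strictly after every crossing.
crossingKey-start : ∀ {p q x y} → Interlaced p q x y → fractionLt (p , 1) (crossingKey p q x y) ≡ true
crossingKey-start {p} (right h₁ h₂ h₃) with gap h₁ | gap h₂ | gap h₃
... | a , a⁺ , refl | c , c⁺ , refl | f , f⁺ , refl =
  subst (λ k → fractionLt (p , 1) k ≡ true) (sym (crossingKey-right p (p + a + c) a f a⁺))
    (exceed (start-r p a c f) (pos-* a⁺ (pos-+ʳ (a + c) f⁺)))
crossingKey-start {x = x} (left h₁ h₂ h₃) with gap h₁ | gap h₂ | gap h₃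
... | a , a⁺ , refl | b , b⁺ , refl | f , f⁺ , refl =
  subst (λ k → fractionLt (x + a , 1) k ≡ true) (sym (crossingKey-left x (x + a + b) a f))
    (exceed (start-l x a b f) (pos-* a⁺ b⁺))

crossingKey-end : ∀ {p q x y} → Interlaced p q x y → fractionLt (crossingKey p q x y) (q , 1) ≡ true
crossingKey-end {p} (right h₁ h₂ h₃) with gap h₁ | gap h₂ | gap h₃
... | a , a⁺ , refl | c , c⁺ , refl | f , f⁺ , refl =
  subst (λ k → fractionLt k (p + a + c , 1) ≡ true) (sym (crossingKey-right p (p + a + c) a f a⁺))
    (exceed (end-r p a c f) (pos-* c⁺ f⁺))
crossingKey-end {x = x} (left h₁ h₂ h₃) with gap h₁ | gap h₂ | gap h₃
... | a , a⁺ , refl | b , b⁺ , refl | f , f⁺ , refl =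
  subst (λ k → fractionLt k (x + a + b + f , 1) ≡ true) (sym (crossingKey-left x (x + a + b) a f))
    (exceed (end-l x a b f) (pos-* f⁺ (pos-+ʳ (a + b) f⁺)))

-- Optimal members of a list, found by folding.

record Best (P : ℕ → Bool) (L : ℕ → ℕ → Bool) (xs : List ℕ) (q : ℕ) : Set where
  constructor mkBest
  field
    member : q ∈ xs
    holds : P q ≡ true
    optimal : ∀ r → r ∈ xs → P r ≡ true → L r q ≡ false

BestOf : (ℕ → Bool) → (ℕ → ℕ → Bool) → List ℕ → Maybe ℕ → Set
BestOf P L xs nothing = ∀ r → r ∈ xs → P r ≡ false
BestOf P L xs (just q) = Best P L xs q

-- The folding functions of `nextOn` and `prevOn` are local to those definitions. With `step`
-- abstract, unification supplies them and `refl` verifies the two equations. Transitivity is asked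
-- for members of the list only, where it is read off from positions.
foldr-best : ∀ (P : ℕ → Bool) (L : ℕ → ℕ → Bool) (step : ℕ → Maybe ℕ → Maybe ℕ) →
  (∀ q → step q nothing ≡ (if P q then just q else nothing)) →
  (∀ q q′ → step q (just q′) ≡ (if P q ∧ L q q′ then just q else just q′)) →
  (∀ q → L q q ≡ false) →
  ∀ xs → (∀ q q′ r → q ∈ xs → q′ ∈ xs → r ∈ xs → L q q′ ≡ true → L r q ≡ true → L r q′ ≡ true) →
  BestOf P L xs (foldr step nothing xs)
foldr-best P L step s₀ s₁ irr [] trans′ = λ _ ()
foldr-best P L step s₀ s₁ irr (x ∷ xs) trans′
  with foldr step nothing xs | foldr-best P L step s₀ s₁ irr xs (λ q q′ r h h′ h″ →
      trans′ q q′ r (there h) (there h′) (there h″))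
... | nothing | ih rewrite s₀ x with P x in e
... | true = mkBest (here refl) e λ { r (here refl) _ → irr x ; r (there h) p →
    ⊥-elim (absurd (trans (sym p) (ih r h))) }
  where absurd : true ≡ false → ⊥
        absurd ()
... | false = λ { r (here refl) → e ; r (there h) → ih r h }
foldr-best P L step s₀ s₁ irr (x ∷ xs) trans′ | just q | mkBest m h o rewrite s₁ x q with P x in e | L x q in e′
... | true | true = mkBest (here refl) e λ { r (here refl) _ → irr x ; r (there k) p → opt r k p }
  where opt : ∀ r → r ∈ xs → P r ≡ true → L r x ≡ false
        opt r k p with L r x in e″
        ... | false = refl
        ... | true = trans (sym (trans′ x q r (here refl) (there m) (there k) e′ e″)) (o r k p)
... | true | false = mkBest (there m) h λ { r (here refl) _ → e′ ; r (there k) p → o r k p }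
... | false | _ = mkBest (there m) h λ { r (here refl) p →
    ⊥-elim (absurd (trans (sym p) e)) ; r (there k) p → o r k p }
  where absurd : true ≡ false → ⊥
        absurd ()

foldr-find : ∀ (P : ℕ → Bool) (step : ℕ → Maybe ℕ → Maybe ℕ) →
    (∀ q r → step q r ≡ (if P q then just q else r)) →
  ∀ xs a → a ∈ xs → P a ≡ true → Σ ℕ λ q → foldr step nothing xs ≡ just q × P q ≡ true
foldr-find P step s (x ∷ xs) a m h rewrite s x (foldr step nothing xs) with P x in e
... | true = x , refl , e
foldr-find P step s (x ∷ xs) .x (here refl) h | false with trans (sym e) h
... | ()
foldr-find P step s (x ∷ xs) a (there m) h | false = foldr-find P step s xs a m h

-- The bump diagram of a word

∧-intro : ∀ {x y} → x ≡ true → y ≡ true → x ∧ y ≡ true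
∧-intro refl h = h

∧-elim : ∀ {x y} → x ∧ y ≡ true → x ≡ true × y ≡ true
∧-elim {true} h = refl , h

∨-elim : ∀ {x y} → x ∨ y ≡ true → x ≡ true ⊎ y ≡ true
∨-elim {true} _ = inj₁ refl
∨-elim {false} h = inj₂ h

∨-introʳ : ∀ x {y} → y ≡ true → x ∨ y ≡ true
∨-introʳ true _ = refl
∨-introʳ false h = h

true≢false : true ≡ false → ⊥
true≢false ()

≡ᵇ-refl : ∀ m → (m ≡ᵇ m) ≡ true
≡ᵇ-refl m = T→≡ (≡⇒≡ᵇ m m refl)

≡ᵇ-true : ∀ {m n} → (m ≡ᵇ n) ≡ true → m ≡ n
≡ᵇ-true {m} {n} h = ≡ᵇ⇒≡ m n (≡→T h)

≢→≡ᵇ : ∀ {m n} → m ≢ n → (m ≡ᵇ n) ≡ false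
≢→≡ᵇ {m} {n} h with m ≡ᵇ n in e
... | false = refl
... | true = ⊥-elim (h (≡ᵇ-true e))

==L-sound : ∀ {x y} → (x ==L y) ≡ true → x ≡ y
==L-sound {A} {A} _ = refl
==L-sound {B} {B} _ = refl
==L-sound {C} {C} _ = refl

wordDiagram : ℕ → List Letter → Diagram
wordDiagram n w = record { ℓ = nth w ; R = WebCon.R n w }

Forward : ℕ → Diagram → Set
Forward N D = ∀ {ε p} → ArcColour ε → Diagrams.IsA N D p → p < R D ε p

-- This links the two descriptions of the order along a chord: separation by the chord from x, as in
-- `Before`, and the inner ends, by which the crossing points of semicircles are sorted.
interlaced-order : ∀ {p q x y z w} → Interlaced p q x y → Interlaced p q z w → y ≢ z → y ≢ w →
    cyc x z y ≡ cyc x w y →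
  (cyc x p y xor cyc x z y) ≡ (innerEnd p x y <ᵇ innerEnd p z w)
interlaced-order {p} {q} {x} {y} {z} {w} (right h₁ h₂ h₃) (right k₁ k₂ k₃) n m nc = trans
  (solve 5 (λ p q x y z → p ≺ x ⊢ x ≺ q ⊢ q ≺ y ⊢ z ≺ q ⊢ ⊢ (cyc′ x p y xor′ cyc′ x z y) ≈ x <′ z) refl
    (p ∷ q ∷ x ∷ y ∷ z ∷ []) h₁ h₂ h₃ k₂)
  (sym (cong₂ _<ᵇ_ (inner-right h₁) (inner-right k₁)))
interlaced-order {p} {q} {x} {y} {z} {w} (right h₁ h₂ h₃) (left k₁ k₂ k₃) n m nc = trans
  (solve 6 (λ p q x y z w → p ≺ x ⊢ x ≺ q ⊢ q ≺ y ⊢ z ≺ p ⊢ p ≺ w ⊢ w ≺ q ⊢ cyc′ x z y ≈ cyc′ x w y ⊢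
      ⊢ (cyc′ x p y xor′ cyc′ x z y) ≈ x <′ w) refl
    (p ∷ q ∷ x ∷ y ∷ z ∷ w ∷ []) h₁ h₂ h₃ k₁ k₂ k₃ nc)
  (sym (cong₂ _<ᵇ_ (inner-right h₁) (inner-left k₁)))
interlaced-order {p} {q} {x} {y} {z} {w} (left h₁ h₂ h₃) (right k₁ k₂ k₃) n m nc = trans
  (solve 4 (λ p x y z → x ≺ p ⊢ p ≺ y ⊢ p ≺ z ⊢ y ≄ z ⊢ ⊢ (cyc′ x p y xor′ cyc′ x z y) ≈ y <′ z) refl
    (p ∷ x ∷ y ∷ z ∷ []) h₁ h₂ k₁ n)
  (sym (cong₂ _<ᵇ_ (inner-left h₁) (inner-right k₁)))
interlaced-order {p} {q} {x} {y} {z} {w} (left h₁ h₂ h₃) (left k₁ k₂ k₃) n m nc = trans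
  (solve 5 (λ p x y z w → x ≺ p ⊢ p ≺ y ⊢ p ≺ w ⊢ y ≄ w ⊢ cyc′ x z y ≈ cyc′ x w y ⊢ ⊢
      (cyc′ x p y xor′ cyc′ x z y) ≈ y <′ w) refl
    (p ∷ x ∷ y ∷ z ∷ w ∷ []) h₁ h₂ k₂ m nc)
  (sym (cong₂ _<ᵇ_ (inner-left h₁) (inner-left k₁)))

inner-above : ∀ {p q x y} → Interlaced p q x y → p < innerEnd p x y
inner-above (right h _ _) = subst (_ <_) (sym (inner-right h)) h
inner-above (left h k _) = subst (_ <_) (sym (inner-left h)) k

inner-below : ∀ {p q x y} → Interlaced p q x y → innerEnd p x y < q
inner-below (right h k _) = subst (_< _) (sym (inner-right h)) k
inner-below (left h _ k) = subst (_< _) (sym (inner-left h)) k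

module Concrete (n : ℕ) (w : List Letter)
                (wf : Diagrams.WellFormed (3 * n) (wordDiagram n w)) (fw : Forward (3 * n) (wordDiagram n w)) where
  open Diagrams (3 * n)
  private
    D : Diagram
    D = wordDiagram n w
    N : ℕ
    N = 3 * n
  open WellFormedProperties wf
  module W = WebCon n w

  isAb-complete : ∀ {p} → IsA D p → W.isAb p ≡ true
  isAb-complete {p} (h , e) rewrite e = <→<ᵇ h

  isAb-sound : ∀ {p} → W.isAb p ≡ true → IsA D p
  isAb-sound h = <ᵇ→< (proj₂ (∧-elim h)) , ==L-sound (proj₁ (∧-elim h))

  interlaced : ∀ {ε p x} → ArcColour ε → IsA D p → On D ε p x →
      Interlaced p (R D ε p) x (R D (swapLetter ε) x)
  interlaced {ε} {p} {x} e hp (hx , m , c) with <-cmp p x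
  ... | tri≈ _ q _ = ⊥-elim (m q)
  ... | tri< l _ _ = right l
    (solve 4 (λ p q x y → (cyc′ p x q xor′ cyc′ p y q) ≈ true′ ⊢ p ≺ q ⊢ x ≺ y ⊢ p ≺ x ⊢ x ≄ q ⊢ ⊢ x ≺ q)
        refl args c (fw e hp) (fw (swapColour e) hx) l (A≢R e hp hx))
    (solve 4 (λ p q x y → (cyc′ p x q xor′ cyc′ p y q) ≈ true′ ⊢ p ≺ q ⊢ x ≺ y ⊢ p ≺ x ⊢ q ≄ y ⊢ ⊢ q ≺ y)
        refl args c (fw e hp) (fw (swapColour e) hx) l (R≢R e hp hx))
    where args = p ∷ R D ε p ∷ x ∷ R D (swapLetter ε) x ∷ []
  ... | tri> _ _ l = left l
    (solve 4 (λ p q x y → (cyc′ p x q xor′ cyc′ p y q) ≈ true′ ⊢ p ≺ q ⊢ x ≺ y ⊢ x ≺ p ⊢ p ≄ y ⊢ ⊢ p ≺ y)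
        refl args c (fw e hp) (fw (swapColour e) hx) l (A≢R (swapColour e) hx hp))
    (solve 4 (λ p q x y → (cyc′ p x q xor′ cyc′ p y q) ≈ true′ ⊢ p ≺ q ⊢ x ≺ y ⊢ x ≺ p ⊢ q ≄ y ⊢ ⊢ y ≺ q)
        refl args c (fw e hp) (fw (swapColour e) hx) l (R≢R e hp hx))
    where args = p ∷ R D ε p ∷ x ∷ R D (swapLetter ε) x ∷ []

  inter-complete : ∀ {i j} → IsA D i → IsA D j → Crosses D B i j → W.inter i j ≡ true
  inter-complete {i} {j} hi hj (m , c) =
    solve 4 (λ p q x y → (cyc′ p x q xor′ cyc′ p y q) ≈ true′ ⊢ p ≺ q ⊢ x ≺ y ⊢ p ≄ x ⊢ q ≄ y ⊢ p ≄ y ⊢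
        x ≄ q ⊢
        ⊢ ((p <′ x ∧′ x <′ q ∧′ q <′ y) ∨′ (x <′ p ∧′ p <′ y ∧′ y <′ q)) ≈ true′) refl
      (i ∷ R D B i ∷ j ∷ R D C j ∷ []) c (fw isB hi) (fw isC hj) m (R≢R isB hi hj) (A≢R isC hj hi)
          (A≢R isB hi hj)

  inter-sound : ∀ {i j} → W.inter i j ≡ true → Crosses D B i j
  inter-sound {i} {j} h =
    solve 4 (λ p q x y → ((p <′ x ∧′ x <′ q ∧′ q <′ y) ∨′ (x <′ p ∧′ p <′ y ∧′ y <′ q)) ≈ true′ ⊢ ⊢
        p ≄ x) refl
      (i ∷ R D B i ∷ j ∷ R D C j ∷ []) h ,
    solve 4 (λ p q x y → ((p <′ x ∧′ x <′ q ∧′ q <′ y) ∨′ (x <′ p ∧′ p <′ y ∧′ y <′ q)) ≈ true′ ⊢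
        ⊢ (cyc′ p x q xor′ cyc′ p y q) ≈ true′) refl
      (i ∷ R D B i ∷ j ∷ R D C j ∷ []) h

  valid-sound : ∀ v → W.valid v ≡ true → Valid D v
  valid-sound (c , i , j) h with ∧-elim {W.isAb i} h
  ... | hi , h′ with ∧-elim {W.isAb j} h′
  ... | hj , k = isAb-sound hi , isAb-sound hj , helper c k
    where
    helper : ∀ c → (if c then (i ≡ᵇ j) ∨ W.inter i j else W.inter i j) ≡ true →
        (c ≡ true × i ≡ j) ⊎ Crosses D B i j
    helper false k = inj₂ (inter-sound k)
    helper true k with ∨-elim {i ≡ᵇ j} k
    ... | inj₁ q = inj₁ (refl , ≡ᵇ-true q)
    ... | inj₂ q = inj₂ (inter-sound q)

  valid-complete : ∀ v → Valid D v → W.valid v ≡ true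
  valid-complete (c , i , j) (hi , hj , k) =
      ∧-intro (isAb-complete hi) (∧-intro (isAb-complete hj) (helper c k))
    where
    helper : ∀ c → (c ≡ true × i ≡ j) ⊎ Crosses D B i j →
        (if c then (i ≡ᵇ j) ∨ W.inter i j else W.inter i j) ≡ true
    helper true (inj₁ (_ , refl)) rewrite ≡ᵇ-refl i = refl
    helper true (inj₂ x) = ∨-introʳ (i ≡ᵇ j) (inter-complete hi hj x)
    helper false (inj₂ x) = inter-complete hi hj x

  inter-place : ∀ {ε p x} → ArcColour ε → IsA D p → On D ε p x →
      W.inter (proj₁ (place ε p x)) (proj₂ (place ε p x)) ≡ true
  inter-place isB hp (hx , c) = inter-complete hp hx c
  inter-place isC hp (hx , c) = inter-complete hx hp (crosses-sym isC hp hx c)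

  place-inter : ∀ {ε p x} → ArcColour ε → IsA D p → IsA D x →
      W.inter (proj₁ (place ε p x)) (proj₂ (place ε p x)) ≡ true → Crosses D ε p x
  place-inter isB hp hx h = inter-sound h
  place-inter isC hp hx h = crosses-sym isB hx hp (inter-sound h)

  crossings-complete : ∀ {ε p x} → ArcColour ε → IsA D p → On D ε p x → x ∈ W.crossings ε p
  crossings-complete {ε} {p} {x} e hp o@(hx , m , _) = ∈-filter⁺ (λ q → T? _) (∈-upTo⁺ (proj₁ hx))
    (≡→T (∧-intro (isAb-complete hx) (∧-intro (cong not (≢→≡ᵇ (λ q → m (sym q)))) (inter-place e hp o))))

  crossings-sound : ∀ {ε p x} → ArcColour ε → IsA D p → x ∈ W.crossings ε p → On D ε p x
  crossings-sound {ε} {p} {x} e hp h with ∧-elim {W.isAb x}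
      (T→≡ (proj₂ (∈-filter⁻ (λ q → T? _) {xs = upTo N} h)))
  ... | hx , k = isAb-sound hx , place-inter e hp (isAb-sound hx) (proj₂ (∧-elim {not (x ≡ᵇ p)} k))

  keyOn-crossingKey : ∀ {ε p x} → ArcColour ε → p ≢ x →
      W.keyOn ε p x ≡ crossingKey p (R D ε p) x (R D (swapLetter ε) x)
  keyOn-crossingKey isB m = refl
  keyOn-crossingKey {p = p} {x} isC m with <-cmp p x
  ... | tri≈ _ q _ = ⊥-elim (m q)
  ... | tri< l _ _ rewrite <→<ᵇ l | ≥→<ᵇ (<⇒≤ l) = refl
  ... | tri> _ _ l rewrite <→<ᵇ l | ≥→<ᵇ (<⇒≤ l) = refl

  abstract
    -- The chords meeting the chord from p are ordered by their endpoints below it.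
    position : Letter → ℕ → ℕ → ℕ
    position ε p x = if x ≡ᵇ p then p else innerEnd p x (R D (swapLetter ε) x)

    position-start : ∀ {ε p} → position ε p p ≡ p
    position-start {p = p} rewrite ≡ᵇ-refl p = refl

    position-on : ∀ {ε p x} → On D ε p x → position ε p x ≡ innerEnd p x (R D (swapLetter ε) x)
    position-on (_ , m , _) rewrite ≢→≡ᵇ (λ q → m (sym q)) = refl

  module Chord {ε p} (e : ArcColour ε) (hp : IsA D p) where
    pos : ℕ → ℕ
    pos = position ε p

    Start : ℕ → Set
    Start x = x ≡ p ⊎ On D ε p x

    p<pos : ∀ {x} → On D ε p x → p < pos x
    p<pos o = subst (p <_) (sym (position-on o)) (inner-above (interlaced e hp o))

    pos<R : ∀ {x} → On D ε p x → pos x < R D ε p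
    pos<R o = subst (_< R D ε p) (sym (position-on o)) (inner-below (interlaced e hp o))

    pos-injective : ∀ {x z} → On D ε p x → On D ε p z → pos x ≡ pos z → x ≡ z
    pos-injective o@(hx , _) o′@(hz , _) q =
        helper {hx = hx} {hz} (interlaced e hp o) (interlaced e hp o′)
            (trans (sym (position-on o)) (trans q (position-on o′)))
      where
      helper : ∀ {x z} {hx : IsA D x} {hz : IsA D z} → Interlaced p (R D ε p) x (R D (swapLetter ε) x) →
          Interlaced p (R D ε p) z (R D (swapLetter ε) z) →
               innerEnd p x (R D (swapLetter ε) x) ≡ innerEnd p z (R D (swapLetter ε) z) → x ≡ z
      helper (right h _ _) (right k _ _) q = trans (sym (inner-right h)) (trans q (inner-right k))
      helper {hx = hx} {hz} (right h _ _) (left k _ _) q =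
          ⊥-elim (A≢R (swapColour e) hz hx (trans (sym (inner-right h)) (trans q (inner-left k))))
      helper {hx = hx} {hz} (left h _ _) (right k _ _) q =
          ⊥-elim (A≢R (swapColour e) hx hz (trans (sym (inner-right k)) (trans (sym q) (inner-left h))))
      helper {hx = hx} {hz} (left h _ _) (left k _ _) q =
          R-injective (swapColour e) hx hz (trans (sym (inner-left h)) (trans q (inner-left k)))

    bits : ∀ {x z} → On D ε p x → On D ε p z → x ≢ z →
      (side D (swapLetter ε) x p xor side D (swapLetter ε) x z) ≡ (pos x <ᵇ pos z)
    bits o@(hx , _) o′@(hz , _) m = trans
      (interlaced-order (interlaced e hp o) (interlaced e hp o′) (λ q → A≢R e′ hx hz (sym q))
          (λ q → m (R-injective e′ hx hz q)) (Matching.noncrossing (wf e′) hx hz m))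
      (sym (cong₂ _<ᵇ_ (position-on o) (position-on o′)))
      where e′ = swapColour e

    before→ : ∀ {x z} → Start x → On D ε p z → Before D ε p x z → pos x < pos z
    before→ (inj₁ refl) o′ _ rewrite position-start {ε} {p} = p<pos o′
    before→ (inj₂ o) o′ (inj₁ q) = ⊥-elim (proj₁ (proj₂ o) (sym q))
    before→ (inj₂ o) o′ (inj₂ (m , c)) = <ᵇ→< (trans (sym (bits o o′ m)) c)

    →before : ∀ {x z} → Start x → On D ε p z → pos x < pos z → Before D ε p x z
    →before (inj₁ q) o′ l = inj₁ q
    →before (inj₂ o) o′ l = inj₂ (m , trans (bits o o′ m) (<→<ᵇ l))
      where m = λ { refl → <-irrefl refl l }

    key : ℕ → ℕ × ℕ
    key = W.keyOn ε p

    key-mono : ∀ {x z} → On D ε p x → On D ε p z → pos x < pos z → W.ltK (key x) (key z) ≡ true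
    key-mono {x} {z} o@(hx , mx , _) o′@(hz , mz , _) l = subst₂ (λ k l → fractionLt k l ≡ true)
      (sym (keyOn-crossingKey e mx)) (sym (keyOn-crossingKey e mz))
      (crossingKey-mono (interlaced e hp o) (interlaced e hp o′) m
          (Matching.noncrossing (wf (swapColour e)) hx hz m)
        (subst₂ _<_ (position-on o) (position-on o′) l))
      where m : x ≢ z
            m refl = <-irrefl refl l

    -- m is the position of the point with key k.
    record Represents (k : ℕ × ℕ) (m : ℕ) : Set where
      field
        below : ∀ {z} → On D ε p z → W.ltK k (key z) ≡ (m <ᵇ pos z)
        above : ∀ {z} → On D ε p z → W.ltK (key z) k ≡ (pos z <ᵇ m)
    open Represents

    key-represents : ∀ {x} → On D ε p x → Represents (key x) (pos x)
    key-represents o = record { below = compare o ; above = λ o′ → compare o′ o }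
      where
      compare : ∀ {x z} → On D ε p x → On D ε p z → W.ltK (key x) (key z) ≡ (pos x <ᵇ pos z)
      compare {x} {z} o o′ with <-cmp (pos x) (pos z)
      ... | tri< l _ _ rewrite <→<ᵇ l = key-mono o o′ l
      ... | tri> _ _ l rewrite ≥→<ᵇ (<⇒≤ l) = fractionLt-asym (key z) (key x) (key-mono o′ o l)
      ... | tri≈ _ q _ rewrite pos-injective o o′ q | ≥→<ᵇ {pos z} ≤-refl = fractionLt-irrefl (key z)

    start-represents : Represents (p , 1) p
    start-represents = record
      { below = λ o → trans (k o) (sym (<→<ᵇ (p<pos o)))
      ; above = λ {z} o → trans (fractionLt-asym (p , 1) (key z) (k o)) (sym (≥→<ᵇ (<⇒≤ (p<pos o)))) }
      where
      k : ∀ {z} → On D ε p z → W.ltK (p , 1) (key z) ≡ true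
      k o = subst (λ k → fractionLt (p , 1) k ≡ true) (sym (keyOn-crossingKey e (proj₁ (proj₂ o))))
          (crossingKey-start (interlaced e hp o))

    end-represents : Represents (R D ε p , 1) (R D ε p)
    end-represents = record
      { above = λ o → trans (k o) (sym (<→<ᵇ (pos<R o)))
      ; below = λ {z} o → trans (fractionLt-asym (key z) (R D ε p , 1) (k o))
          (sym (≥→<ᵇ (<⇒≤ (pos<R o)))) }
      where
      k : ∀ {z} → On D ε p z → W.ltK (key z) (R D ε p , 1) ≡ true
      k o = subst (λ k → fractionLt k (R D ε p , 1) ≡ true) (sym (keyOn-crossingKey e (proj₁ (proj₂ o))))
          (crossingKey-end (interlaced e hp o))

    private
      sound : ∀ {x} → x ∈ W.crossings ε p → On D ε p x
      sound = crossings-sound e hp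

      -- Keys of crossings compare like positions, which are natural numbers, so no arithmetic with
      -- denominators is needed.
      transitive : ∀ q q′ r → q ∈ W.crossings ε p → q′ ∈ W.crossings ε p → r ∈ W.crossings ε p →
        W.ltK (key q) (key q′) ≡ true → W.ltK (key r) (key q) ≡ true → W.ltK (key r) (key q′) ≡ true
      transitive q q′ r h h′ h″ l l′ = trans (below (key-represents (sound h″)) (sound h′)) (<→<ᵇ
        (<-trans {pos r} {pos q} {pos q′}
            (<ᵇ→< (trans (sym (below (key-represents (sound h″)) (sound h))) l′))
                 (<ᵇ→< (trans (sym (below (key-represents (sound h)) (sound h′))) l))))

    next-best : ∀ k → BestOf (λ q → W.ltK k (key q)) (λ q q′ → W.ltK (key q) (key q′)) (W.crossings ε p)
        (W.nextOn ε p k)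
    next-best k = foldr-best _ _ _ (λ _ → refl) (λ _ _ → refl) (λ q → fractionLt-irrefl (key q))
        (W.crossings ε p) transitive

    prev-best : ∀ k → BestOf (λ q → W.ltK (key q) k) (λ q q′ → W.ltK (key q′) (key q)) (W.crossings ε p)
        (W.prevOn ε p k)
    prev-best k = foldr-best _ _ _ (λ _ → refl) (λ _ _ → refl) (λ q → fractionLt-irrefl (key q))
        (W.crossings ε p)
      (λ q q′ r h h′ h″ l l′ → transitive q r q′ h h″ h′ l′ l)

    After : ℕ → ROut → Set
    After x t = (Σ ℕ λ z → t ≡ nd (false , place ε p z) × Succ D ε p x z) ⊎
        (t ≡ bdy (R D ε p) × Last D ε p x)

    after : ∀ {k x} → Start x → Represents k (pos x) → After x (W.afterArc ε p k)
    after {k} {x} st rep with W.nextOn ε p k | next-best k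
    ... | just z | mkBest m h o =
        inj₁ (z , refl , mkSucc hp st oz (→before st oz (<ᵇ→< (trans (sym (below rep oz)) h)))
      λ w ow b₁ b₂ → true≢false
          (trans (sym (trans (below (key-represents ow) oz) (<→<ᵇ (before→ (inj₂ ow) oz b₂))))
         (o w (crossings-complete e hp ow) (trans (below rep ow) (<→<ᵇ (before→ st ow b₁))))))
      where oz = sound m
    ... | nothing | none = inj₂ (refl , mkLast hp st λ w ow b₁ →
      true≢false (trans (sym (trans (below rep ow) (<→<ᵇ (before→ st ow b₁))))
          (none w (crossings-complete e hp ow))))

    record Prior (m : ℕ) (t : ROut) : Set where
      field
        prior : ℕ
        target : t ≡ nd (true , place ε p prior)
        start : Start prior
        lower : pos prior < m
        none : ∀ w → On D ε p w → pos prior < pos w → pos w < m → ⊥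

    prior-of : ∀ {k m} → Represents k m → p < m → Prior m (W.beforeArc ε p k)
    prior-of {k} {m} rep l with W.prevOn ε p k | prev-best k
    ... | just z | mkBest mem h o = record
      { prior = z ; target = refl ; start = inj₂ oz ; lower = <ᵇ→< (trans (sym (above rep oz)) h)
      ; none = λ w ow l₁ l₂ → true≢false (trans (sym (trans (below (key-represents oz) ow) (<→<ᵇ l₁)))
                 (o w (crossings-complete e hp ow) (trans (above rep ow) (<→<ᵇ l₂)))) }
      where oz = sound mem
    ... | nothing | none = record
      { prior = p ; target = cong (λ v → nd (true , v)) (same e) ; start = inj₁ refl ; lower =
          subst (_< m) (sym (position-start {ε} {p})) l
      ; none = λ w ow l₁ l₂ →
          true≢false (trans (sym (trans (above rep ow) (<→<ᵇ l₂))) (none w (crossings-complete e hp ow)))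
              }
      where
      same : ∀ {ε} → ArcColour ε → (p , p) ≡ place ε p p
      same isB = refl
      same isC = refl

    before-succ : ∀ {x} → On D ε p x → Σ ℕ λ z →
        W.beforeArc ε p (key x) ≡ nd (true , place ε p z) × Succ D ε p z x
    before-succ {x} o = prior , target , mkSucc hp start o (→before start o lower)
      λ w ow b₁ b₂ → none w ow (before→ start ow b₁) (before→ (inj₂ ow) o b₂)
      where open Prior (prior-of (key-represents o) (p<pos o))

    before-last : Σ ℕ λ z → W.beforeArc ε p (R D ε p , 1) ≡ nd (true , place ε p z) × Last D ε p z
    before-last = prior , target , mkLast hp start λ w ow b₁ → none w ow (before→ start ow b₁) (pos<R ow)
      where open Prior (prior-of end-represents (fw e hp))

    pos-start-injective : ∀ {x z} → Start x → Start z → pos x ≡ pos z → x ≡ z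
    pos-start-injective (inj₁ refl) (inj₁ refl) q = refl
    pos-start-injective (inj₁ refl) (inj₂ o) q =
        ⊥-elim (<⇒≢ (p<pos o) (trans (sym (position-start {ε} {p})) q))
    pos-start-injective (inj₂ o) (inj₁ refl) q =
        ⊥-elim (<⇒≢ (p<pos o) (trans (sym (position-start {ε} {p})) (sym q)))
    pos-start-injective (inj₂ o) (inj₂ o′) q = pos-injective o o′ q

    start-above : ∀ {x z} → Start x → Start z → pos x < pos z → On D ε p z
    start-above st (inj₂ o) l = o
    start-above (inj₁ refl) (inj₁ refl) l = ⊥-elim (<-irrefl refl l)
    start-above (inj₂ o) (inj₁ refl) l =
        ⊥-elim (<-asym (p<pos o) (subst (pos _ <_) (position-start {ε} {p}) l))

    succ-functional : ∀ {x z z′} → Succ D ε p x z → Succ D ε p x z′ → z ≡ z′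
    succ-functional {x} {z} {z′} s s′ with <-cmp (pos z) (pos z′)
    ... | tri≈ _ q _ = pos-injective (Succ.on s) (Succ.on s′) q
    ... | tri< l _ _ = ⊥-elim (Succ.immediate s′ z (Succ.on s) (Succ.before s)
        (→before (inj₂ (Succ.on s)) (Succ.on s′) l))
    ... | tri> _ _ l = ⊥-elim (Succ.immediate s z′ (Succ.on s′) (Succ.before s′)
        (→before (inj₂ (Succ.on s′)) (Succ.on s) l))

    pred-functional : ∀ {x x′ z} → Succ D ε p x z → Succ D ε p x′ z → x ≡ x′
    pred-functional {x} {x′} {z} s s′ with <-cmp (pos x) (pos x′)
    ... | tri≈ _ q _ = pos-start-injective (Succ.start s) (Succ.start s′) q
    ... | tri< l _ _ = ⊥-elim (Succ.immediate s x′ o (→before (Succ.start s) o l) (Succ.before s′))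
      where o = start-above (Succ.start s) (Succ.start s′) l
    ... | tri> _ _ l = ⊥-elim (Succ.immediate s′ x o (→before (Succ.start s′) o l) (Succ.before s))
      where o = start-above (Succ.start s′) (Succ.start s) l

    succ-not-last : ∀ {x z} → Succ D ε p x z → Last D ε p x → ⊥
    succ-not-last s l = Last.maximal l _ (Succ.on s) (Succ.before s)

    last-functional : ∀ {x x′} → Last D ε p x → Last D ε p x′ → x ≡ x′
    last-functional {x} {x′} s s′ with <-cmp (pos x) (pos x′)
    ... | tri≈ _ q _ = pos-start-injective (Last.start s) (Last.start s′) q
    ... | tri< l _ _ = ⊥-elim (Last.maximal s x′ o (→before (Last.start s) o l))
      where o = start-above (Last.start s) (Last.start s′) l
    ... | tri> _ _ l = ⊥-elim (Last.maximal s′ x o (→before (Last.start s′) o l))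
      where o = start-above (Last.start s′) (Last.start s) l

-- From diagrams back to webs

Cyclic : Bool → (Fin 3 → Letter) → Set
Cyclic s κ = κ (fs fz) ≡ orient s (κ fz) × κ (fs (fs fz)) ≡ orient s (κ (fs fz))

orient-cube : ∀ s c → orient s (orient s (orient s c)) ≡ c
orient-cube false A = refl
orient-cube false B = refl
orient-cube false C = refl
orient-cube true A = refl
orient-cube true B = refl
orient-cube true C = refl

orient-inverse : ∀ s c → orient s (orient (not s) c) ≡ c
orient-inverse false A = refl
orient-inverse false B = refl
orient-inverse false C = refl
orient-inverse true A = refl
orient-inverse true B = refl
orient-inverse true C = refl

orient-transitive : ∀ s c d → c ≡ d ⊎ orient s c ≡ d ⊎ orient s (orient s c) ≡ d
orient-transitive s A A = inj₁ refl
orient-transitive s B B = inj₁ refl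
orient-transitive s C C = inj₁ refl
orient-transitive false A B = inj₂ (inj₁ refl)
orient-transitive false A C = inj₂ (inj₂ refl)
orient-transitive false B A = inj₂ (inj₂ refl)
orient-transitive false B C = inj₂ (inj₁ refl)
orient-transitive false C A = inj₂ (inj₁ refl)
orient-transitive false C B = inj₂ (inj₂ refl)
orient-transitive true A B = inj₂ (inj₂ refl)
orient-transitive true A C = inj₂ (inj₁ refl)
orient-transitive true B A = inj₂ (inj₁ refl)
orient-transitive true B C = inj₂ (inj₂ refl)
orient-transitive true C A = inj₂ (inj₂ refl)
orient-transitive true C B = inj₂ (inj₁ refl)

-- This is the source of the shift in `nbrEq`: two listings of the three colours in the same cyclic
-- order differ by the rotation that brings the first colour of one to the first place of the other.
align : ∀ {s κ κ′} → Cyclic s κ → Cyclic s κ′ → Σ (Fin 3) λ t → ∀ k → κ (shiftF (toℕ t) k) ≡ κ′ k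
align {s} {κ} {κ′} (c₁ , c₂) (d₁ , d₂) with orient-transitive s (κ fz) (κ′ fz)
... | inj₁ q = fz , λ { fz → q
                      ; (fs fz) → k₁
                      ; (fs (fs fz)) → trans c₂ (trans (cong (orient s) k₁) (sym d₂)) }
  where k₁ = trans c₁ (trans (cong (orient s) q) (sym d₁))
... | inj₂ (inj₁ q) = fs fz , λ { fz → k₀
                                ; (fs fz) → k₁
                                ; (fs (fs fz)) → trans (sym (orient-cube s (κ fz)))
                                    (trans (cong (λ c → orient s (orient s c)) q)
                                        (trans (cong (orient s) (sym d₁)) (sym d₂))) }
  where k₀ = trans c₁ q
        k₁ = trans c₂ (trans (cong (orient s) k₀) (sym d₁))
... | inj₂ (inj₂ q) = fs (fs fz) , λ { fz → k₀
                                     ; (fs fz) → trans (sym (orient-cube s (κ fz)))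
                                         (trans (cong (orient s) q) (sym d₁))
                                     ; (fs (fs fz)) → trans c₁
                                         (trans (cong (orient s) (trans (sym (orient-cube s (κ fz)))
                                             (cong (orient s) q)))
                                                        (trans (cong (orient s) (sym d₁)) (sym d₂))) }
  where k₀ = trans c₂ (trans (cong (orient s) c₁) q)

toTarget : ROut → ℕ ⊎ Vertex
toTarget (bdy p) = inj₁ p
toTarget (nd v) = inj₂ v

if-either : ∀ {X : Set} b {x y : X} → (if b then x else y) ≡ x ⊎ (if b then x else y) ≡ y
if-either true = inj₁ refl
if-either false = inj₂ refl

module Realisation (n : ℕ) (w : List Letter)
                   (wf : Diagrams.WellFormed (3 * n) (wordDiagram n w)) (fw : Forward (3 * n) (wordDiagram n w)) where
  open Diagrams (3 * n)
  private
    D : Diagram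
    D = wordDiagram n w
    N : ℕ
    N = 3 * n
  open WellFormedProperties wf
  open Concrete n w wf fw

  -- It follows the clauses of `nbrRaw`. Neighbours are compared by colour, which an isomorphism
  -- carries along through `π`, and slot numbers are recovered from the colours by `align`.
  slotColour : Vertex → Fin 3 → Letter
  slotColour (c , i , j) k = if c ∧ (i ≡ᵇ j) then hubColour k else crossColour k
    where
    hubColour crossColour : Fin 3 → Letter
    hubColour fz = A
    hubColour (fs fz) = if W.R B i <ᵇ W.R C i then B else C
    hubColour (fs (fs fz)) = if W.R B i <ᵇ W.R C i then C else B
    crossColour fz = proj₁ (W.arcX i j)
    crossColour (fs fz) = proj₁ (W.arcY i j)
    crossColour (fs (fs fz)) = A

  white-slot : ∀ {i j} → IsA D i → IsA D j → Crosses D B i j → ∀ a → a ≡ (B , i) ⊎ a ≡ (C , j) →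
    Edge D (false , i , j) (proj₁ a) (toTarget (W.beforeArc (proj₁ a) (proj₂ a) (W.key i j)))
  white-slot {i} {j} hi hj c _ (inj₁ refl) with Chord.before-succ isB hi (hj , c)
  ... | z , q , s = subst (λ t → Edge D (false , i , j) B (toTarget t)) (sym q) (bwd isB s)
  white-slot {i} {j} hi hj c _ (inj₂ refl) with Chord.before-succ isC hj (hi , crosses-sym isB hi hj c)
  ... | z , q , s = subst (λ t → Edge D (false , i , j) C (toTarget t)) (sym q) (bwd isC s)

  after-edge : ∀ {ε p x t} (e : ArcColour ε) (hp : IsA D p) → Chord.After e hp x t →
      Edge D (true , place ε p x) ε (toTarget t)
  after-edge e hp (inj₁ (z , refl , s)) = fwd e s
  after-edge e hp (inj₂ (refl , l)) = end e l

  black-slot : ∀ {i j} → IsA D i → IsA D j → Crosses D B i j → ∀ a → a ≡ (B , i) ⊎ a ≡ (C , j) →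
    Edge D (true , i , j) (proj₁ a) (toTarget (W.afterArc (proj₁ a) (proj₂ a) (W.key i j)))
  black-slot {i} {j} hi hj c _ (inj₁ refl) =
      after-edge isB hi (after (inj₂ (hj , c)) (key-represents (hj , c)))
    where open Chord isB hi
  black-slot {i} {j} hi hj c _ (inj₂ refl) =
      after-edge isC hj (after (inj₂ (hi , c′)) (key-represents (hi , c′)))
    where open Chord isC hj
          c′ = crosses-sym isB hi hj c

  hub-slot : ∀ {i} → IsA D i → ∀ ε → ε ≡ B ⊎ ε ≡ C →
      Edge D (true , i , i) ε (toTarget (W.afterArc ε i (i , 1)))
  hub-slot hi _ (inj₁ refl) =
      after-edge isB hi (after (inj₁ refl) (subst (Represents _) (sym (position-start {B}))
          start-represents))
    where open Chord isB hi
  hub-slot hi _ (inj₂ refl) =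
      after-edge isC hi (after (inj₁ refl) (subst (Represents _) (sym (position-start {C}))
          start-represents))
    where open Chord isC hi

  swap-⊎ : ∀ {X Y : Set} → X ⊎ Y → Y ⊎ X
  swap-⊎ (inj₁ x) = inj₂ x
  swap-⊎ (inj₂ x) = inj₁ x

  slot-edge : ∀ v → Valid D v → ∀ k → Edge D v (slotColour v k) (toTarget (W.nbrRaw v k))
  slot-edge (false , i , j) (hi , hj , inj₂ c) fz = white-slot hi hj c _ (if-either (i <ᵇ j))
  slot-edge (false , i , j) (hi , hj , inj₂ c) (fs fz) =
      white-slot hi hj c _ (swap-⊎ (if-either (i <ᵇ j)))
  slot-edge (false , i , j) (hi , hj , inj₂ c) (fs (fs fz)) = out (proj₁ c)
  slot-edge (true , i , .i) (hi , _ , inj₁ (_ , refl)) fz rewrite ≡ᵇ-refl i = hub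
  slot-edge (true , i , .i) (hi , _ , inj₁ (_ , refl)) (fs fz) rewrite ≡ᵇ-refl i =
      hub-slot hi _ (if-either (W.R B i <ᵇ W.R C i))
  slot-edge (true , i , .i) (hi , _ , inj₁ (_ , refl)) (fs (fs fz)) rewrite ≡ᵇ-refl i =
      hub-slot hi _ (swap-⊎ (if-either (W.R B i <ᵇ W.R C i)))
  slot-edge (true , i , j) (hi , hj , inj₂ c) fz rewrite ≢→≡ᵇ (proj₁ c) =
      black-slot hi hj c _ (if-either (i <ᵇ j))
  slot-edge (true , i , j) (hi , hj , inj₂ c) (fs fz) rewrite ≢→≡ᵇ (proj₁ c) =
      black-slot hi hj c _ (swap-⊎ (if-either (i <ᵇ j)))
  slot-edge (true , i , j) (hi , hj , inj₂ c) (fs (fs fz)) rewrite ≢→≡ᵇ (proj₁ c) = into (proj₁ c)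

  -- The arc starting further left comes first in `nbrRaw`, so the slots read B, C, A if i < j and
  -- C, B, A otherwise; these are the two values of `sign`.
  crossing-cyclic : ∀ {b i j} → IsA D i → IsA D j → Crosses D B i j → (b ∧ (i ≡ᵇ j)) ≡ false →
    Cyclic (sign D (b , i , j)) (slotColour (b , i , j))
  crossing-cyclic {b} {i} {j} hi hj c q rewrite q with interlaced isB hi (hj , c)
  ... | right l l′ l″ rewrite <→<ᵇ l | solve 4 (λ i j q y → i ≺ j ⊢ j ≺ q ⊢ q ≺ y ⊢ ⊢
      cyc′ i y q ≈ not′ true′) refl
          (i ∷ j ∷ R D B i ∷ R D C j ∷ []) l l′ l″ = refl , refl
  ... | left l l′ l″ rewrite ≥→<ᵇ (<⇒≤ l) | solve 4 (λ i j q y → j ≺ i ⊢ i ≺ y ⊢ y ≺ q ⊢ ⊢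
      cyc′ i y q ≈ true′) refl
          (i ∷ j ∷ R D B i ∷ R D C j ∷ []) l l′ l″ = refl , refl

  slot-cyclic : ∀ v → Valid D v → Cyclic (sign D v) (slotColour v)
  slot-cyclic (false , i , j) (hi , hj , inj₂ c) = crossing-cyclic {false} hi hj c refl
  slot-cyclic (true , i , j) (hi , hj , inj₂ c) = crossing-cyclic {true} hi hj c (≢→≡ᵇ (proj₁ c))
  slot-cyclic (true , i , .i) (hi , _ , inj₁ (_ , refl)) rewrite ≡ᵇ-refl i with <-cmp (R D B i) (R D C i)
  ... | tri≈ _ q _ = ⊥-elim (R≢R isB hi hi q)
  ... | tri< l _ _ rewrite <→<ᵇ l | solve 3 (λ i q y → i ≺ q ⊢ q ≺ y ⊢ ⊢ cyc′ i y q ≈ not′ true′) refl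
          (i ∷ R D B i ∷ R D C i ∷ []) (fw isB hi) l = refl , refl
  ... | tri> _ _ l rewrite ≥→<ᵇ (<⇒≤ l) | solve 3 (λ i q y → i ≺ y ⊢ y ≺ q ⊢ ⊢ cyc′ i y q ≈ true′) refl
          (i ∷ R D B i ∷ R D C i ∷ []) (fw isC hi) l = refl , refl

  TargetValid : ℕ ⊎ Vertex → Set
  TargetValid (inj₁ p) = p < N
  TargetValid (inj₂ v) = Valid D v

  crossing-valid : ∀ {ε p x} b → ArcColour ε → IsA D p → On D ε p x → Valid D (b , place ε p x)
  crossing-valid b isB hp (hx , c) = hp , hx , inj₂ c
  crossing-valid b isC hp (hx , c) = hx , hp , inj₂ (crosses-sym isC hp hx c)

  start-valid : ∀ {ε p x} → ArcColour ε → IsA D p → x ≡ p ⊎ On D ε p x → Valid D (true , place ε p x)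
  start-valid isB hp (inj₁ refl) = hp , hp , inj₁ (refl , refl)
  start-valid isC hp (inj₁ refl) = hp , hp , inj₁ (refl , refl)
  start-valid e hp (inj₂ o) = crossing-valid true e hp o

  edge-valid : ∀ {v c t} → Valid D v → Edge D v c t → TargetValid t
  edge-valid (hp , _) hub = proj₁ hp
  edge-valid {false , _} (hp , hx , inj₂ c) (out _) = hp , hx , inj₂ c
  edge-valid (hp , hx , inj₂ c) (into _) = hp , hx , inj₂ c
  edge-valid (hp , hx , inj₁ (_ , q)) (into n) = ⊥-elim (n q)
  edge-valid _ (fwd e s) = crossing-valid false e (Succ.isA s) (Succ.on s)
  edge-valid _ (bwd e s) = start-valid e (Succ.isA s) (Succ.start s)
  edge-valid _ (end e l) = R<N e (Last.isA l)

  -- The clashes between a further crossing and the end of a chord are excluded by maximality in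
  -- `Last`; those between two neighbouring crossings by comparison of positions.
  edge-functional : ∀ {v c t t′} → Edge D v c t → Edge D v c t′ → t ≡ t′
  edge-functional hub hub = refl
  edge-functional hub (into n) = ⊥-elim (n refl)
  edge-functional hub (fwd () _)
  edge-functional hub (end () _)
  edge-functional (into n) hub = ⊥-elim (n refl)
  edge-functional (into _) (into _) = refl
  edge-functional (into _) (fwd () _)
  edge-functional (into _) (end () _)
  edge-functional (out _) (out _) = refl
  edge-functional (out _) (bwd () _)
  edge-functional (fwd isB s) (fwd isB s′) =
      cong (λ z → inj₂ (false , _ , z)) (Chord.succ-functional isB (Succ.isA s) s s′)
  edge-functional (fwd isC s) (fwd isC s′) =
      cong (λ z → inj₂ (false , z , _)) (Chord.succ-functional isC (Succ.isA s) s s′)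
  edge-functional (fwd isB s) (end isB l) = ⊥-elim (Chord.succ-not-last isB (Succ.isA s) s l)
  edge-functional (fwd isC s) (end isC l) = ⊥-elim (Chord.succ-not-last isC (Succ.isA s) s l)
  edge-functional (end isB l) (fwd isB s) = ⊥-elim (Chord.succ-not-last isB (Succ.isA s) s l)
  edge-functional (end isC l) (fwd isC s) = ⊥-elim (Chord.succ-not-last isC (Succ.isA s) s l)
  edge-functional (end isB l) (end isB l′) = refl
  edge-functional (end isC l) (end isC l′) = refl
  edge-functional (bwd isB s) (bwd isB s′) =
      cong (λ z → inj₂ (true , _ , z)) (Chord.pred-functional isB (Succ.isA s) s s′)
  edge-functional (bwd isC s) (bwd isC s′) =
      cong (λ z → inj₂ (true , z , _)) (Chord.pred-functional isC (Succ.isA s) s s′)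

  boundary-functional : ∀ {j j′ v v′} → BoundaryEdge D j v → BoundaryEdge D j′ v′ → j ≡ j′ → v ≡ v′
  boundary-functional (atA _) (atA _) refl = refl
  boundary-functional (atA h) (atEnd e l) refl = ⊥-elim (A≢R e (Last.isA l) h refl)
  boundary-functional (atEnd e l) (atA h) q = ⊥-elim (A≢R e (Last.isA l) h (sym q))
  boundary-functional (atEnd isB l) (atEnd isB l′) q with R-injective isB (Last.isA l) (Last.isA l′) q
  ... | refl = cong (λ z → true , _ , z) (Chord.last-functional isB (Last.isA l) l l′)
  boundary-functional (atEnd isC l) (atEnd isC l′) q with R-injective isC (Last.isA l) (Last.isA l′) q
  ... | refl = cong (λ z → true , z , _) (Chord.last-functional isC (Last.isA l) l l′)
  boundary-functional (atEnd isB l) (atEnd isC l′) q = ⊥-elim (R≢R isB (Last.isA l) (Last.isA l′) q)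
  boundary-functional (atEnd isC l) (atEnd isB l′) q = ⊥-elim (R≢R isC (Last.isA l) (Last.isA l′) q)

  boundary-valid : ∀ {j v} → BoundaryEdge D j v → Valid D v
  boundary-valid (atA h) = h , h , inj₁ (refl , refl)
  boundary-valid (atEnd e l) = start-valid e (Last.isA l) (Last.start l)

  last-boundary : ∀ {ε j} → ArcColour ε → j < N → ℓ D j ≡ ε → Σ Vertex λ v →
      W.lastOn ε j ≡ nd v × BoundaryEdge D j v
  last-boundary {ε} {j} e hj q with Matching.source (wf e) hj q
  ... | p , hp , r with foldr-find (λ a → W.isAb a ∧ (W.R ε a ≡ᵇ j)) (λ a r →
      if W.isAb a ∧ (W.R ε a ≡ᵇ j) then just a else r)
                          (λ _ _ → refl) (upTo N) p (∈-upTo⁺ (proj₁ hp))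
                          (∧-intro (isAb-complete hp) (trans (cong (_≡ᵇ j) r) (≡ᵇ-refl j)))
  ... | a , found , h with isAb-sound {a} (proj₁ (∧-elim h)) | ≡ᵇ-true {W.R ε a}
      (proj₂ (∧-elim {W.isAb a} h))
  ... | ha | refl with Chord.before-last e ha
  ... | z , t , l rewrite found = _ , t , atEnd e l

  bnd-boundary : ∀ {j} → j < N → Σ Vertex λ v → W.bndRaw j ≡ nd v × BoundaryEdge D j v
  bnd-boundary {j} hj with nth w j in q
  ... | A = _ , refl , atA (hj , q)
  ... | B = last-boundary isB hj q
  ... | C = last-boundary isC hj q

  vertex-≡ : ∀ {v v′} {t : T (W.valid v)} {t′ : T (W.valid v′)} → v ≡ v′ →
      _≡_ {A = W.V} (v , t) (v′ , t′)
  vertex-≡ {v} refl = cong (v ,_) (T-irrelevant _ _)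

  toV : ∀ {v} → Valid D v → W.V
  toV {v} h = v , ≡→T (valid-complete v h)

  embed : ∀ t → TargetValid t → Fin N ⊎ W.V
  embed (inj₁ p) h = inj₁ (fromℕ< h)
  embed (inj₂ v) h = inj₂ (toV h)

  conv-embed : ∀ d r (h : TargetValid (toTarget r)) → W.conv d r ≡ embed (toTarget r) h
  conv-embed d (bdy p) h with p <? N
  ... | yes h′ = refl
  ... | no n = ⊥-elim (n h)
  conv-embed d (nd v) h with T? (W.valid v)
  ... | yes t = cong inj₂ (vertex-≡ refl)
  ... | no n = ⊥-elim (n (≡→T (valid-complete v h)))

reflectSlot : Bool → Fin 3 → Fin 3
reflectSlot false k = k
reflectSlot true k = revF k

-- For suitable arguments this is definitionally `rotW` or `flipW`, so that a single transfer
-- argument yields both parts of the theorem.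
transformed : ∀ {m} → (Fin m → Fin m) → (Fin m → Fin m) → Bool → Web m → Web m
transformed ρ ρ⁻¹ o W = record
  { Vtx = Vtx W ; black = black W
  ; nbr = λ v k → map₁ ρ (nbr W v (reflectSlot o k))
  ; bnd = λ j → map₁ ρ (bnd W (ρ⁻¹ j)) }

cyclic-image : ∀ {s κ} o s′ (π : Letter → Letter) → Cyclic s κ →
    (∀ c → π (orient s c) ≡ orient (o xor s′) (π c)) →
  Cyclic s′ (λ k → π (κ (reflectSlot o k)))
cyclic-image false s′ π (c₁ , c₂) turn = trans (cong π c₁) (turn _) , trans (cong π c₂) (turn _)
cyclic-image {s} {κ} true s′ π (c₁ , c₂) turn = back c₀ , back c₂
  where
  c₀ : κ fz ≡ orient s (κ (fs (fs fz)))
  c₀ = trans (sym (orient-cube s (κ fz))) (cong (orient s) (trans (cong (orient s) (sym c₁)) (sym c₂)))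
  back : ∀ {x y} → x ≡ orient s y → π y ≡ orient s′ (π x)
  back {x} {y} q = trans (sym (orient-inverse s′ (π y)))
      (cong (orient s′) (trans (sym (turn y)) (cong π (sym q))))

module Transfer {n : ℕ} {w w′ : List Letter}
                (wf : Diagrams.WellFormed (3 * n) (wordDiagram n w))
                    (fw : Forward (3 * n) (wordDiagram n w))
                (wf′ : Diagrams.WellFormed (3 * n) (wordDiagram n w′))
                    (fw′ : Forward (3 * n) (wordDiagram n w′))
                {ρ : ℕ → ℕ} {o : Bool} (I : Diagrams.Iso (3 * n) ρ o (wordDiagram n w)
                    (wordDiagram n w′))
                (ρF ρ⁻¹F : Fin (3 * n) → Fin (3 * n))
                (toℕ-ρF : ∀ j → toℕ (ρF j) ≡ ρ (toℕ j)) (ρρ⁻¹F : ∀ j → ρ (toℕ (ρ⁻¹F j)) ≡ toℕ j) where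
  open Diagrams (3 * n)
  private
    D D′ : Diagram
    D = wordDiagram n w
    D′ = wordDiagram n w′
  module U = Realisation n w wf fw
  module U′ = Realisation n w′ wf′ fw′
  module K = Concrete n w wf fw
  module K′ = Concrete n w′ wf′ fw′
  open Iso I

  validOf : ∀ (v : K.W.V) → Valid D (proj₁ v)
  validOf (v , t) = K.valid-sound v (T→≡ t)

  validOf′ : ∀ (v : K′.W.V) → Valid D′ (proj₁ v)
  validOf′ (v , t) = K′.valid-sound v (T→≡ t)

  -- The equivalence starts at the web of w′, so its forward map comes from `g`.
  F : K′.W.V → K.W.V
  F v = U.toV (g-valid (proj₁ v) (validOf′ v))

  G : K.W.V → K′.W.V
  G v = U′.toV (f-valid (proj₁ v) (validOf v))

  target-match : ∀ t (h : U.TargetValid t) t′ (h′ : U′.TargetValid t′) → t′ ≡ mapTarget ρ f t →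
    map₁ ρF (U.embed t h) ≡ map₂ F (U′.embed t′ h′)
  target-match (inj₁ p) h _ h′ refl =
      cong inj₁ (toℕ-injective (trans (toℕ-ρF _) (trans (cong ρ (toℕ-fromℕ< h)) (sym (toℕ-fromℕ< h′)))))
  target-match (inj₂ v) h _ h′ refl = cong inj₂ (U.vertex-≡ (sym (gf v h)))

  neighbour-match : ∀ v′ k k′ → π (g (proj₁ v′)) (U.slotColour (g (proj₁ v′)) k) ≡ U′.slotColour
      (proj₁ v′) k′ →
    map₁ ρF (nbr (web n w) (F v′) k) ≡ map₂ F (nbr (web n w′) v′ k′)
  neighbour-match v′ k k′ q = trans (cong (map₁ ρF) (U.conv-embed _ (K.W.nbrRaw v k) tv))
    (trans (target-match _ tv _ tv′
        (U′.edge-functional e′ (subst₂ (λ v c → Edge D′ v c (mapTarget ρ f (toTarget (K.W.nbrRaw v₀ k))))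
            (fg (proj₁ v′) h′) q (edge v h _ _ e))))
           (cong (map₂ F) (sym (U′.conv-embed _ (K′.W.nbrRaw (proj₁ v′) k′) tv′))))
    where
    v = g (proj₁ v′)
    v₀ = v
    h′ = validOf′ v′
    h : Valid D v
    h = g-valid (proj₁ v′) h′
    e = U.slot-edge v h k
    e′ = U′.slot-edge (proj₁ v′) h′ k′
    tv = U.edge-valid h e
    tv′ = U′.edge-valid h′ e′

  boundary-match : ∀ j → map₁ ρF (bnd (web n w) (ρ⁻¹F j)) ≡ map₂ F (bnd (web n w′) j)
  boundary-match j with U.bnd-boundary (toℕ<n (ρ⁻¹F j)) | U′.bnd-boundary (toℕ<n j)
  ... | v , q , b | v′ , q′ , b′ =
      trans (cong (map₁ ρF) (trans (cong (K.W.conv _) q) (U.conv-embed _ (nd v) h)))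
    (trans (target-match (inj₂ v) h (inj₂ v′) h′
        (cong inj₂ (U′.boundary-functional b′ (boundary _ _ b) (sym (ρρ⁻¹F j)))))
           (cong (map₂ F) (sym (trans (cong (K′.W.conv _) q′) (U′.conv-embed _ (nd v′) h′)))))
    where h = U.boundary-valid b
          h′ = U′.boundary-valid b′

  isomorphic : web n w′ ≅ transformed ρF ρ⁻¹F o (web n w)
  isomorphic = record
    { f = F ; g = G
    ; gf = λ v → U′.vertex-≡ (fg (proj₁ v) (validOf′ v))
    ; fg = λ v → U.vertex-≡ (gf (proj₁ v) (validOf v))
    ; col = λ v → trans (sym (colour (g (proj₁ v)))) (cong proj₁ (fg (proj₁ v) (validOf′ v)))
    ; bndEq = boundary-match
    ; nbrEq = rotations }
    where
    rotations : ∀ v′ → Σ (Fin 3) λ s → ∀ k →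
      map₁ ρF (nbr (web n w) (F v′) (reflectSlot o (shiftF (toℕ s) k))) ≡ map₂ F (nbr (web n w′) v′ k)
    rotations v′ with align {κ = λ k → π v (U.slotColour v (reflectSlot o k))}
                        (cyclic-image {κ = U.slotColour v} o _ (π v) (U.slot-cyclic v h)
                          (λ c → trans (turn v h c) (cong (λ u → orient (o xor sign D′ u) (π v c))
                              (fg (proj₁ v′) (validOf′ v′)))))
                        (U′.slot-cyclic (proj₁ v′) (validOf′ v′))
      where v = g (proj₁ v′)
            h = g-valid (proj₁ v′) (validOf′ v′)
    ... | s , match = s , λ k → neighbour-match v′ _ k (match k)

-- Matchings of a Kreweras word

length-counts : ∀ w → count A w + count B w + count C w ≡ length w
length-counts [] = refl
length-counts (A ∷ w) = cong suc (length-counts w)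
length-counts (B ∷ w) = trans (cong (_+ count C w) (+-suc (count A w) (count B w)))
    (cong suc (length-counts w))
length-counts (C ∷ w) = trans (+-suc (count A w + count B w) (count C w)) (cong suc (length-counts w))

kreweras-length : ∀ {n w} → IsKreweras n w → length w ≡ 3 * n
kreweras-length {n} {w} k = trans (sym (length-counts w)) (trans
  (cong₂ _+_ (cong₂ _+_ (IsKreweras.countA k) (IsKreweras.countB k)) (IsKreweras.countC k)) (triple n))
  where
  triple : ∀ n → n + n + n ≡ 3 * n
  triple = solve-∀

count-++ : ∀ x u v → count x (u ++ v) ≡ count x u + count x v
count-++ x [] v = refl
count-++ x (y ∷ u) v with x ==L y
... | true = cong suc (count-++ x u v)
... | false = count-++ x u v

drop-step : ∀ p (w : List Letter) {x xs} → drop p w ≡ x ∷ xs →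
  nth w p ≡ x × drop (suc p) w ≡ xs × p < length w × take (suc p) w ≡ take p w ++ x ∷ []
drop-step zero (x ∷ w) refl = refl , refl , s≤s z≤n , refl
drop-step (suc p) (y ∷ w) e with drop-step p w e
... | q , r , l , t = q , r , s≤s l , cong (y ∷_) t
drop-step (suc p) [] ()

drop-end : ∀ p (w : List Letter) → drop p w ≡ [] → length w ≤ p
drop-end zero [] e = z≤n
drop-end (suc p) [] e = z≤n
drop-end (suc p) (x ∷ w) e = s≤s (drop-end p w e)

count-arc-A : ∀ {ε} → ArcColour ε → count ε (A ∷ []) ≡ 0
count-arc-A isB = refl
count-arc-A isC = refl

count-swap : ∀ {ε} → ArcColour ε → count ε (swapLetter ε ∷ []) ≡ 0 × count A (swapLetter ε ∷ []) ≡ 0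
count-swap isB = refl , refl
count-swap isC = refl , refl

count-self : ∀ {ε} → ArcColour ε → count ε (ε ∷ []) ≡ 1 × count A (ε ∷ []) ≡ 0
count-self isB = refl , refl
count-self isC = refl , refl

-- The scan of matchGo, with the stack of A's still open at position p: an element of
-- the stack with k elements above it is matched when depth suc k returns to zero.
module Matchings (n : ℕ) (w : List Letter) {ε : Letter} (e : ArcColour ε)
                 (ballotε : ∀ k → count ε (take k w) ≤ count A (take k w)) where
  matchGo : ℕ → ℕ → List Letter → ℕ
  matchGo = WebCon.matchGo n w ε

  Rε : ℕ → ℕ
  Rε = WebCon.R n w ε

  matchGo-hit : ∀ p xs → matchGo 1 p (ε ∷ xs) ≡ p
  matchGo-hit p xs = go e
    where go : ∀ {ε} → ArcColour ε → WebCon.matchGo n w ε 1 p (ε ∷ xs) ≡ p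
          go isB = refl
          go isC = refl

  matchGo-pop : ∀ d p xs → matchGo (suc (suc d)) p (ε ∷ xs) ≡ matchGo (suc d) (suc p) xs
  matchGo-pop d p xs = go e
    where go : ∀ {ε} → ArcColour ε → WebCon.matchGo n w ε (suc (suc d)) p (ε ∷ xs) ≡ WebCon.matchGo n w ε (suc d) (suc p) xs
          go isB = refl
          go isC = refl

  matchGo-skip : ∀ d p xs → matchGo d p (swapLetter ε ∷ xs) ≡ matchGo d (suc p) xs
  matchGo-skip d p xs = go e
    where go : ∀ {ε} → ArcColour ε → WebCon.matchGo n w ε d p (swapLetter ε ∷ xs) ≡ WebCon.matchGo n w ε d (suc p) xs
          go isB = refl
          go isC = refl

  matchGo-≥ : ∀ d p xs → p ≤ matchGo d p xs
  matchGo-≥ d p [] = ≤-refl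
  matchGo-≥ d p (x ∷ xs) with x ==L A | x ==L ε | d ≡ᵇ 1
  ... | true | _ | _ = ≤-trans (n≤1+n p) (matchGo-≥ (suc d) (suc p) xs)
  ... | false | true | true = ≤-refl
  ... | false | true | false = ≤-trans (n≤1+n p) (matchGo-≥ (d ∸ 1) (suc p) xs)
  ... | false | false | _ = ≤-trans (n≤1+n p) (matchGo-≥ d (suc p) xs)

  record Open (p k : ℕ) (xs : List Letter) (a : ℕ) : Set where
    constructor mkOpen
    field
      a<p : a < p
      letter : nth w a ≡ A
      match : Rε a ≡ matchGo (suc k) p xs

  data Stack (p : ℕ) (xs : List Letter) : ℕ → List ℕ → Set where
    [] : ∀ {k} → Stack p xs k []
    _∷_ : ∀ {k a s} → Open p k xs a → All (_< a) s × Stack p xs (suc k) s → Stack p xs k (a ∷ s)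

  stack-≥ : ∀ {p xs k s a} → Stack p xs k s → a ∈ s → p ≤ Rε a
  stack-≥ {p} {xs} {k} (o ∷ _) (here refl) = subst (p ≤_) (sym (Open.match o)) (matchGo-≥ (suc k) p xs)
  stack-≥ (_ ∷ (_ , st)) (there m) = stack-≥ st m

  Closed : ℕ → ℕ → Set
  Closed p a = a < Rε a × Rε a < p × nth w (Rε a) ≡ ε

  record State (p : ℕ) (xs : List Letter) (s : List ℕ) : Set where
    field
      stack : Stack p xs 0 s
      closed : ∀ a → a < p → nth w a ≡ A → a ∈ s ⊎ Closed p a
      source : ∀ j → j < p → nth w j ≡ ε → Σ ℕ λ a → a < p × nth w a ≡ A × Rε a ≡ j
      nested : ∀ a c → nth w a ≡ A → nth w c ≡ A → a < c → c < Rε a → Rε a < p → Rε c < Rε a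
      -- With the ballot condition this forbids an ε at empty stack, and with equal totals it
      -- empties the stack at the end of the word.
      height : length s + count ε (take p w) ≡ count A (take p w)

  push-stack : ∀ {p xs k s} → Stack p (A ∷ xs) k s → Stack (suc p) xs (suc k) s
  push-stack [] = []
  push-stack (mkOpen l q m ∷ (b , st)) = mkOpen (m≤n⇒m≤1+n l) q m ∷ (b , push-stack st)

  skip-stack : ∀ {p xs k s} → Stack p (swapLetter ε ∷ xs) k s → Stack (suc p) xs k s
  skip-stack [] = []
  skip-stack {p} {xs} {k} (mkOpen l q m ∷ (b , st)) =
      mkOpen (m≤n⇒m≤1+n l) q (trans m (matchGo-skip (suc k) p xs)) ∷ (b , skip-stack st)

  pop-stack : ∀ {p xs k s} → Stack p (ε ∷ xs) (suc k) s → Stack (suc p) xs k s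
  pop-stack [] = []
  pop-stack {p} {xs} {k} (mkOpen l q m ∷ (b , st)) =
      mkOpen (m≤n⇒m≤1+n l) q (trans m (matchGo-pop k p xs)) ∷ (b , pop-stack st)

  stack-below : ∀ {p xs k s} → Stack p xs k s → All (_< p) s
  stack-below [] = []
  stack-below (o ∷ (_ , st)) = Open.a<p o ∷ stack-below st

  closed-suc : ∀ {p a} → Closed p a → Closed (suc p) a
  closed-suc (h , h′ , q) = h , m≤n⇒m≤1+n h′ , q

  split : ∀ {a p} → a < suc p → a < p ⊎ a ≡ p
  split h = m≤n⇒m<n∨m≡n (≤-pred h)

  count-step : ∀ x p {y} → take (suc p) w ≡ take p w ++ y ∷ [] →
      count x (take (suc p) w) ≡ count x (take p w) + count x (y ∷ [])
  count-step x p {y} t = trans (cong (count x) t) (count-++ x (take p w) (y ∷ []))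

  letter-clash : ∀ {x y p} → x ≢ y → nth w p ≡ x → nth w p ≡ y → ⊥
  letter-clash n q r = n (trans (sym q) r)

  a<R : ∀ a → a < Rε a
  a<R a = matchGo-≥ 1 (suc a) (drop (suc a) w)

  initial : State 0 w []
  initial = record { stack = [] ; closed = λ _ () ; source = λ _ () ; nested =
      λ _ _ _ _ _ _ () ; height = refl }

  -- An A not on the new stack is closed in the old state, or popped at p.
  nested-step : ∀ {p xs xs′ k s s′} → State p xs s → Stack (suc p) xs′ k s′ →
    (∀ a → a ∈ s → a ∈ s′ ⊎ (∀ c → a < c → c < p → nth w c ≡ A → Rε c < p)) →
    ∀ a c → nth w a ≡ A → nth w c ≡ A → a < c → c < Rε a → Rε a < suc p → Rε c < Rε a
  nested-step {p} st new popped a c qa qc l l′ h with split h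
  ... | inj₁ h′ = State.nested st a c qa qc l l′ h′
  ... | inj₂ refl with State.closed st a (a<R a) qa
  ... | inj₂ (_ , h′ , _) = ⊥-elim (<-irrefl refl h′)
  ... | inj₁ m with popped a m
  ... | inj₁ m′ = ⊥-elim (<⇒≱ h (stack-≥ new m′))
  ... | inj₂ below = below c l l′ qc

  step-A : ∀ {p xs s} → drop p w ≡ A ∷ xs → State p (A ∷ xs) s → State (suc p) xs (p ∷ s)
  step-A {p} {xs} {s} d st with drop-step p w d
  ... | q , d′ , _ , t = record
    { stack = new ; closed = closed ; source = source
    ; nested = nested-step st new (λ a m → inj₁ (there m)) ; height = height }
    where
    new : Stack (suc p) xs 0 (p ∷ s)
    new = mkOpen ≤-refl q (cong (matchGo 1 (suc p)) d′) ∷ (stack-below (State.stack st) , push-stack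
        (State.stack st))
    closed : ∀ a → a < suc p → nth w a ≡ A → a ∈ p ∷ s ⊎ Closed (suc p) a
    closed a h qa with split h
    ... | inj₂ refl = inj₁ (here refl)
    ... | inj₁ h′ with State.closed st a h′ qa
    ... | inj₁ m = inj₁ (there m)
    ... | inj₂ c = inj₂ (closed-suc c)
    source : ∀ j → j < suc p → nth w j ≡ ε → Σ ℕ λ a → a < suc p × nth w a ≡ A × Rε a ≡ j
    source j h qj with split h
    ... | inj₂ refl = ⊥-elim (letter-clash (A≢arc e) q qj)
    ... | inj₁ h′ with State.source st j h′ qj
    ... | a , l , r = a , m≤n⇒m≤1+n l , r
    height : suc (length s) + count ε (take (suc p) w) ≡ count A (take (suc p) w)
    height rewrite count-step ε p t | count-step A p t | count-arc-A e | +-identityʳ (count ε (take p w))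
        | sym (State.height st)
      = sym (+-comm _ 1)

  step-skip : ∀ {p xs s} → drop p w ≡ swapLetter ε ∷ xs → State p (swapLetter ε ∷ xs) s →
      State (suc p) xs s
  step-skip {p} {xs} {s} d st with drop-step p w d
  ... | q , d′ , _ , t = record
    { stack = new ; closed = closed ; source = source
    ; nested = nested-step st new (λ a m → inj₁ m) ; height = height }
    where
    new : Stack (suc p) xs 0 s
    new = skip-stack (State.stack st)
    closed : ∀ a → a < suc p → nth w a ≡ A → a ∈ s ⊎ Closed (suc p) a
    closed a h qa with split h
    ... | inj₂ refl = ⊥-elim (letter-clash (A≢arc (swapColour e)) qa q)
    ... | inj₁ h′ with State.closed st a h′ qa
    ... | inj₁ m = inj₁ m
    ... | inj₂ c = inj₂ (closed-suc c)
    source : ∀ j → j < suc p → nth w j ≡ ε → Σ ℕ λ a → a < suc p × nth w a ≡ A × Rε a ≡ j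
    source j h qj with split h
    ... | inj₂ refl = ⊥-elim (letter-clash (ε≢swap e) qj q)
    ... | inj₁ h′ with State.source st j h′ qj
    ... | a , l , r = a , m≤n⇒m≤1+n l , r
    height : length s + count ε (take (suc p) w) ≡ count A (take (suc p) w)
    height rewrite count-step ε p t | count-step A p t | proj₁ (count-swap e) | proj₂ (count-swap e)
      | +-identityʳ (count ε (take p w)) | +-identityʳ (count A (take p w)) = State.height st

  step-ε : ∀ {p xs s} → drop p w ≡ ε ∷ xs → State p (ε ∷ xs) s → Σ (List ℕ) λ s′ → State (suc p) xs s′
  step-ε {p} {xs} {[]} d st with drop-step p w d
  ... | q , d′ , _ , t = ⊥-elim (<-irrefl refl (subst₂ _≤_
          (trans (count-step ε p t) (trans (cong₂ _+_ (State.height st) (proj₁ (count-self e)))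
              (+-comm _ 1)))
          (trans (count-step A p t) (trans (cong (count A (take p w) +_) (proj₂ (count-self e)))
              (+-identityʳ _)))
          (ballotε (suc p))))
  step-ε {p} {xs} {a₀ ∷ s} d st with drop-step p w d | State.stack st
  ... | q , d′ , _ , t | mkOpen l q₀ m₀ ∷ (below , rest) = s , record
    { stack = new ; closed = closed ; source = source
    ; nested = nested-step st new popped ; height = height }
    where
    R₀ : Rε a₀ ≡ p
    R₀ = trans m₀ (matchGo-hit p xs)
    new : Stack (suc p) xs 0 s
    new = pop-stack rest
    closed : ∀ a → a < suc p → nth w a ≡ A → a ∈ s ⊎ Closed (suc p) a
    closed a h qa with split h
    ... | inj₂ refl = ⊥-elim (letter-clash (A≢arc e) qa q)
    ... | inj₁ h′ with State.closed st a h′ qa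
    ... | inj₁ (here refl) = inj₂ (a<R a₀ , s≤s (≤-reflexive R₀) , trans (cong (nth w) R₀) q)
    ... | inj₁ (there m) = inj₁ m
    ... | inj₂ c = inj₂ (closed-suc c)
    source : ∀ j → j < suc p → nth w j ≡ ε → Σ ℕ λ a → a < suc p × nth w a ≡ A × Rε a ≡ j
    source j h qj with split h
    ... | inj₂ refl = a₀ , m≤n⇒m≤1+n l , q₀ , R₀
    ... | inj₁ h′ with State.source st j h′ qj
    ... | a , l , r = a , m≤n⇒m≤1+n l , r
    popped : ∀ a → a ∈ a₀ ∷ s → a ∈ s ⊎ (∀ c → a < c → c < p → nth w c ≡ A → Rε c < p)
    popped a (there m) = inj₁ m
    popped a (here refl) = inj₂ λ c h h′ qc → inner c h (State.closed st c h′ qc)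
      where
      inner : ∀ c → a₀ < c → c ∈ a₀ ∷ s ⊎ Closed p c → Rε c < p
      inner c h (inj₂ (_ , h′ , _)) = h′
      inner c h (inj₁ (here refl)) = ⊥-elim (<-irrefl refl h)
      inner c h (inj₁ (there m)) = ⊥-elim (<-asym h (All.lookup below m))
    height : length s + count ε (take (suc p) w) ≡ count A (take (suc p) w)
    height rewrite count-step ε p t | count-step A p t | proj₁ (count-self e) | proj₂ (count-self e)
      | +-identityʳ (count A (take p w)) | sym (State.height st) =
      trans (sym (+-assoc (length s) _ 1)) (+-comm _ 1)

  run : ∀ xs p s → drop p w ≡ xs → State p xs s → Σ ℕ λ p′ → Σ (List ℕ) λ s′ →
      drop p′ w ≡ [] × State p′ [] s′
  run [] p s d st = p , s , d , st
  run (x ∷ xs) p s d st with drop-step p w d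
  ... | q , d′ , _ = helper e x d st
    where
    helper : ∀ {ε′} → ArcColour ε′ → ∀ x → drop p w ≡ x ∷ xs → State p (x ∷ xs) s → Σ ℕ λ p′ →
        Σ (List ℕ) λ s′ → drop p′ w ≡ [] × State p′ [] s′
    helper _ x d st with x ==L A in eA | x ==L ε in eE | x ==L swapLetter ε in eS
    ... | true | _ | _ with ==L-sound {x} {A} eA
    ... | refl = run xs (suc p) (p ∷ s) d′ (step-A d st)
    helper _ x d st | false | true | _ with ==L-sound {x} {ε} eE
    ... | refl = run xs (suc p) _ d′ (proj₂ (step-ε d st))
    helper _ x d st | false | false | true with ==L-sound {x} {swapLetter ε} eS
    ... | refl = run xs (suc p) s d′ (step-skip d st)
    helper _ x d st | false | false | false = ⊥-elim (exhaust e x eA eE eS)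
      where
      exhaust : ∀ {ε} → ArcColour ε → ∀ x → (x ==L A) ≡ false → (x ==L ε) ≡ false →
          (x ==L swapLetter ε) ≡ false → ⊥
      exhaust isB A () _ _
      exhaust isB B _ () _
      exhaust isB C _ _ ()
      exhaust isC A () _ _
      exhaust isC B _ _ ()
      exhaust isC C _ () _

module _ {n : ℕ} {w : List Letter} (k : IsKreweras n w) where
  open Diagrams (3 * n)

  private
    D : Diagram
    D = wordDiagram n w

    ballots : ∀ {ε} → ArcColour ε → ∀ i → count ε (take i w) ≤ count A (take i w)
    ballots isB = IsKreweras.prefB k
    ballots isC = IsKreweras.prefC k

    totals : ∀ {ε} → ArcColour ε → count ε w ≡ n
    totals isB = IsKreweras.countB k
    totals isC = IsKreweras.countC k

    take-all : ∀ p (u : List Letter) → length u ≤ p → take p u ≡ u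
    take-all p [] h with p
    ... | zero = refl
    ... | suc _ = refl
    take-all (suc p) (x ∷ u) (s≤s h) = cong (x ∷_) (take-all p u h)

    module Final {ε} (e : ArcColour ε) where
      open Matchings n w e (ballots e) public
      final = run w 0 [] refl initial
      p₁ = proj₁ final
      state : State p₁ [] (proj₁ (proj₂ final))
      state = proj₂ (proj₂ (proj₂ final))
      w≤p₁ : length w ≤ p₁
      w≤p₁ = drop-end p₁ w (proj₁ (proj₂ (proj₂ final)))
      empty : ∀ (s : List ℕ) → length s + count ε w ≡ count A w → s ≡ []
      empty [] _ = refl
      empty (x ∷ s) q = ⊥-elim (<⇒≢ (s≤s (m≤n+m n (length s)))
        (sym (trans (cong (suc (length s) +_) (sym (totals e))) (trans q (IsKreweras.countA k)))))
      no-open : _≡_ {A = List ℕ} (proj₁ (proj₂ final)) []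
      no-open = empty _ (subst (λ u → length (proj₁ (proj₂ final)) + count ε u ≡ count A u)
          (take-all p₁ w w≤p₁) (State.height state))
      N≤p₁ : 3 * n ≤ p₁
      N≤p₁ = subst (_≤ p₁) (kreweras-length k) w≤p₁
      closed-all : ∀ {a} → IsA D a → Closed p₁ a
      closed-all {a} (h , q) with State.closed state a (≤-trans h N≤p₁) q
      ... | inj₂ c = c
      ... | inj₁ m with subst (a ∈_) no-open m
      ... | ()

  -- The scan only shows that the end of an arc carries ε. As the default letter is A, that end
  -- cannot lie past the end of the word, which gives the bound in `target`.
  nth-default : ∀ (u : List Letter) p → length u ≤ p → nth u p ≡ A
  nth-default [] p h = refl
  nth-default (x ∷ u) (suc p) (s≤s h) = nth-default u p h

  word-forward : Forward (3 * n) D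
  word-forward e h = proj₁ (Final.closed-all e h)

  word-wellFormed : WellFormed D
  word-wellFormed {ε} e = record { target = target ; source = source ; noncrossing = noncrossing }
    where
    open Final e
    target : ∀ {p} → IsA D p → Rε p < 3 * n × nth w (Rε p) ≡ ε
    target {p} h with closed-all h
    ... | _ , _ , q with Rε p <? 3 * n
    ... | yes l = l , q
    ... | no l = ⊥-elim (A≢arc e
        (trans (sym (nth-default w (Rε p) (subst (_≤ Rε p) (sym (kreweras-length k)) (≮⇒≥ l)))) q))
    source : ∀ {j} → j < 3 * n → nth w j ≡ ε → Σ ℕ λ p → IsA D p × Rε p ≡ j
    source {j} h q with State.source state j (≤-trans h N≤p₁) q
    ... | a , _ , qa , r = a , (<-trans (subst (a <_) r (a<R a)) h , qa) , r
    nest : ∀ {p r} → IsA D p → IsA D r → p < r → r < Rε p → Rε r < Rε p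
    nest {p} {r} hp hr l l′ =
        State.nested state p r (proj₂ hp) (proj₂ hr) l l′ (proj₁ (proj₂ (closed-all hp)))
    r≢Rp : ∀ {p r} → IsA D p → IsA D r → r ≢ Rε p
    r≢Rp hp hr refl = A≢arc e (trans (sym (proj₂ hr)) (proj₂ (target hp)))
    noncrossing : ∀ {p r} → IsA D p → IsA D r → p ≢ r → side D ε p r ≡ side D ε p (Rε r)
    noncrossing {p} {r} hp hr m with <-cmp p r
    ... | tri≈ _ q _ = ⊥-elim (m q)
    ... | tri< l _ _ with <-cmp r (Rε p)
    ... | tri≈ _ q _ = ⊥-elim (r≢Rp hp hr q)
    ... | tri< l′ _ _ = solve 4 (λ p q r s → p ≺ r ⊢ r ≺ q ⊢ r ≺ s ⊢ s ≺ q ⊢ ⊢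
        cyc′ p r q ≈ cyc′ p s q) refl
          (p ∷ Rε p ∷ r ∷ Rε r ∷ []) l l′ (a<R r) (nest hp hr l l′)
    ... | tri> _ _ l′ = solve 4 (λ p q r s → p ≺ q ⊢ q ≺ r ⊢ r ≺ s ⊢ ⊢ cyc′ p r q ≈ cyc′ p s q) refl
          (p ∷ Rε p ∷ r ∷ Rε r ∷ []) (a<R p) l′ (a<R r)
    noncrossing {p} {r} hp hr m | tri> _ _ l with <-cmp p (Rε r)
    ... | tri≈ _ q _ = ⊥-elim (r≢Rp hr hp q)
    ... | tri< l′ _ _ = solve 4 (λ p q r s → r ≺ p ⊢ p ≺ s ⊢ p ≺ q ⊢ q ≺ s ⊢ ⊢
        cyc′ p r q ≈ cyc′ p s q) refl
          (p ∷ Rε p ∷ r ∷ Rε r ∷ []) l l′ (a<R p) (nest hr hp l l′)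
    ... | tri> _ _ l′ = solve 4 (λ p q r s → r ≺ s ⊢ s ≺ p ⊢ p ≺ q ⊢ ⊢ cyc′ p r q ≈ cyc′ p s q) refl
          (p ∷ Rε p ∷ r ∷ Rε r ∷ []) (a<R r) l′ (a<R p)

module Uniqueness {N : ℕ} {D₁ D₂ : Diagram}
                  (wf₁ : Diagrams.WellFormed N D₁) (wf₂ : Diagrams.WellFormed N D₂)
                  (fw₁ : Forward N D₁) (fw₂ : Forward N D₂)
                  (same : ∀ {p} → p < N → ℓ D₁ p ≡ ℓ D₂ p) where
  open Diagrams N
  private
    -- If a ended earlier in D₁ than in D₂, its end b in D₁ would belong in D₂ to some c, and
    -- noncrossing in D₂ forces a < c < b. By induction c ends at b in D₁ as well, while noncrossing
    -- in D₁ makes it end before b.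
    half : ∀ {D₁ D₂ : Diagram} → WellFormed D₁ → WellFormed D₂ → Forward N D₁ → Forward N D₂ →
      (∀ {p} → p < N → ℓ D₁ p ≡ ℓ D₂ p) → ∀ {ε} → ArcColour ε → ∀ {a} → IsA D₁ a → IsA D₂ a →
      (∀ {c} → a < c → IsA D₁ c → R D₁ ε c ≡ R D₂ ε c) → R D₁ ε a < R D₂ ε a → ⊥
    half {D₁} {D₂} wf₁ wf₂ fw₁ fw₂ same {ε} e {a} h₁ h₂ ih l
      with Matching.source (wf₂ e) (WellFormedProperties.R<N wf₁ e h₁)
             (trans (sym (same (WellFormedProperties.R<N wf₁ e h₁))) (WellFormedProperties.ℓR wf₁ e h₁))
    ... | c , hc₂ , q = <-irrefl (trans (ih a<c hc₁) q) Rc<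
      where
      hc₁ : IsA D₁ c
      hc₁ = proj₁ hc₂ , trans (same (proj₁ hc₂)) (proj₂ hc₂)
      c<b : c < R D₁ ε a
      c<b = subst (c <_) q (fw₂ e hc₂)
      a≢c : a ≢ c
      a≢c refl = <⇒≢ l (sym q)
      a<c : a < c
      a<c = solve 4 (λ a b b′ c → cyc′ a c b′ ≈ cyc′ a b b′ ⊢ a ≺ b ⊢ b ≺ b′ ⊢ c ≺ b ⊢ ⊢
          a ≺ c) refl (a ∷ R D₁ ε a ∷ R D₂ ε a ∷ c ∷ [])
        (subst (λ b → cyc a c (R D₂ ε a) ≡ cyc a b (R D₂ ε a)) q
            (Matching.noncrossing (wf₂ e) h₂ hc₂ a≢c)) (fw₁ e h₁) l c<b
      Rc< : R D₁ ε c < R D₁ ε a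
      Rc< = solve 4 (λ a b c d → cyc′ a c b ≈ cyc′ a d b ⊢ a ≺ c ⊢ c ≺ b ⊢ ⊢
          d ≺ b) refl (a ∷ R D₁ ε a ∷ c ∷ R D₁ ε c ∷ [])
        (Matching.noncrossing (wf₁ e) h₁ hc₁ a≢c) a<c c<b

  -- Chords obtained by switching and relabelling are never compared with `matchGo` directly: equal
  -- letters and the forward direction suffice. The induction runs downwards from N, since `half`
  -- appeals to A-points further right.
  chords-agree : ∀ {ε} → ArcColour ε → ∀ {a} → IsA D₁ a → R D₁ ε a ≡ R D₂ ε a
  chords-agree {ε} e {a} h = go N a h (m≤n+m N a)
    where
    go : ∀ k a → IsA D₁ a → N ≤ a + k → R D₁ ε a ≡ R D₂ ε a
    go zero a h b = ⊥-elim (<⇒≱ (proj₁ h) (subst (N ≤_) (+-identityʳ a) b))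
    go (suc k) a h b with <-cmp (R D₁ ε a) (R D₂ ε a)
    ... | tri≈ _ q _ = q
    ... | tri< l _ _ = ⊥-elim (half wf₁ wf₂ fw₁ fw₂ same e h h′ (λ l′ hc → go k _ hc (bound l′)) l)
      where h′ = proj₁ h , trans (sym (same (proj₁ h))) (proj₂ h)
            bound : ∀ {c} → a < c → N ≤ c + k
            bound {c} l′ = ≤-trans b (≤-trans (≤-reflexive (+-suc a k)) (+-monoˡ-≤ k l′))
    ... | tri> _ _ l = ⊥-elim (half wf₂ wf₁ fw₂ fw₁ (λ h → sym (same h)) e h′ h
          (λ l′ hc → sym (go k _ (proj₁ hc , trans (same (proj₁ hc)) (proj₂ hc)) (bound l′))) l)
      where h′ = proj₁ h , trans (sym (same (proj₁ h))) (proj₂ h)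
            bound : ∀ {c} → a < c → N ≤ c + k
            bound {c} l′ = ≤-trans b (≤-trans (≤-reflexive (+-suc a k)) (+-monoˡ-≤ k l′))

-- Promotion and sweeps of words

-- Moves the initial A of a word rightwards until a B or C can no longer be passed;
-- that letter is replaced by A and returned. The word is given without its initial A,
-- and a b c count the letters read so far including that A.
slide : ℕ → ℕ → ℕ → List Letter → List Letter × Letter
slide a b c [] = [] , A
slide a b c (A ∷ xs) = A ∷ proj₁ (slide (suc a) b c xs) , proj₂ (slide (suc a) b c xs)
slide a b c (B ∷ xs) =
  if a ≡ᵇ suc b then (A ∷ xs , B) else (B ∷ proj₁ (slide a (suc b) c xs) , proj₂ (slide a (suc b) c xs))
slide a b c (C ∷ xs) =
  if a ≡ᵇ suc c then (A ∷ xs , C) else (C ∷ proj₁ (slide a b (suc c) xs) , proj₂ (slide a b (suc c) xs))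

ballot-++ : ∀ a b c u v → ballot a b c (u ++ v) ≡ ballot a b c u ∧ ballot (a + count A u) (b + count B u)
    (c + count C u) v
ballot-++ a b c [] v rewrite +-identityʳ a | +-identityʳ b | +-identityʳ c = refl
ballot-++ a b c (A ∷ u) v rewrite +-suc a (count A u) = ballot-++ (suc a) b c u v
ballot-++ a b c (B ∷ u) v rewrite +-suc b (count B u) with suc b ≤ᵇ a
... | true = ballot-++ a (suc b) c u v
... | false = refl
ballot-++ a b c (C ∷ u) v rewrite +-suc c (count C u) with suc c ≤ᵇ a
... | true = ballot-++ a b (suc c) u v
... | false = refl

≤→≤ᵇ : ∀ {m n} → m ≤ n → (m ≤ᵇ n) ≡ true
≤→≤ᵇ h = T→≡ (≤⇒≤ᵇ h)

≤ᵇ→≤ : ∀ {m n} → (m ≤ᵇ n) ≡ true → m ≤ n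
≤ᵇ→≤ {m} h = ≤ᵇ⇒≤ m _ (≡→T h)

ballot-sound : ∀ a b c w → b ≤ a → c ≤ a → ballot a b c w ≡ true → ∀ k →
  b + count B (take k w) ≤ a + count A (take k w) × c + count C (take k w) ≤ a + count A (take k w)
ballot-sound a b c w hb hc h zero = +-mono-≤ hb z≤n , +-mono-≤ hc z≤n
ballot-sound a b c [] hb hc h (suc k) = +-mono-≤ hb z≤n , +-mono-≤ hc z≤n
ballot-sound a b c (A ∷ w) hb hc h (suc k) rewrite +-suc a (count A (take k w)) =
  ballot-sound (suc a) b c w (m≤n⇒m≤1+n hb) (m≤n⇒m≤1+n hc) h k
ballot-sound a b c (B ∷ w) hb hc h (suc k) rewrite +-suc b (count B (take k w)) with ∧-elim {suc b ≤ᵇ a}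
    h
... | l , h′ = ballot-sound a (suc b) c w (≤ᵇ→≤ l) hc h′ k
ballot-sound a b c (C ∷ w) hb hc h (suc k) rewrite +-suc c (count C (take k w)) with ∧-elim {suc c ≤ᵇ a}
    h
... | l , h′ = ballot-sound a b (suc c) w hb (≤ᵇ→≤ l) h′ k

ballot-complete : ∀ a b c w → (∀ k → b + count B (take k w) ≤ a + count A (take k w)) →
  (∀ k → c + count C (take k w) ≤ a + count A (take k w)) → ballot a b c w ≡ true
ballot-complete a b c [] hb hc = refl
ballot-complete a b c (A ∷ w) hb hc = ballot-complete (suc a) b c w
  (λ k → subst (b + count B (take k w) ≤_) (+-suc a _) (hb (suc k))) (λ k →
      subst (c + count C (take k w) ≤_) (+-suc a _) (hc (suc k)))
ballot-complete a b c (B ∷ w) hb hc = ∧-intro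
  (≤→≤ᵇ (subst₂ _≤_ (+-comm b 1) (+-identityʳ a) (hb 1)))
  (ballot-complete a (suc b) c w (λ k → subst (_≤ a + count A (take k w)) (+-suc b _) (hb (suc k)))
      (λ k → hc (suc k)))
ballot-complete a b c (C ∷ w) hb hc = ∧-intro
  (≤→≤ᵇ (subst₂ _≤_ (+-comm c 1) (+-identityʳ a) (hc 1)))
  (ballot-complete a b (suc c) w (λ k → hb (suc k)) (λ k → subst (_≤ a + count A (take k w)) (+-suc c _)
      (hc (suc k))))

isKrewB-complete : ∀ {n w} → IsKreweras n w → isKrewB n w ≡ true
isKrewB-complete {n} {w} k rewrite IsKreweras.countA k | IsKreweras.countB k | IsKreweras.countC k |
    ≡ᵇ-refl n =
  ballot-complete 0 0 0 w (IsKreweras.prefB k) (IsKreweras.prefC k)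

isKrewB-split : ∀ {n w} → isKrewB n w ≡ true →
  (count A w ≡ n × count B w ≡ n × count C w ≡ n) × ballot 0 0 0 w ≡ true
isKrewB-split {n} {w} h with ∧-elim {count A w ≡ᵇ n} h
... | hA , h′ with ∧-elim {count B w ≡ᵇ n} h′
... | hB , h″ with ∧-elim {count C w ≡ᵇ n} h″
... | hC , hb = (≡ᵇ-true hA , ≡ᵇ-true hB , ≡ᵇ-true hC) , hb

isKrewB-sound : ∀ {n w} → isKrewB n w ≡ true → IsKreweras n w
isKrewB-sound {n} {w} h with isKrewB-split {n} {w} h
... | (hA , hB , hC) , hb = record
  { countA = hA ; countB = hB ; countC = hC
  ; prefB = λ k → proj₁ (ballot-sound 0 0 0 w z≤n z≤n hb k) ; prefC = λ k →
      proj₂ (ballot-sound 0 0 0 w z≤n z≤n hb k) }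

tau-kreweras : ∀ n i w → isKrewB n w ≡ true → isKrewB n (tau n i w) ≡ true
tau-kreweras n i w h with isKrewB n (swapAt (i ∸ 1) w) in e
... | true = e
... | false = h

sweep-kreweras : ∀ n k w → isKrewB n w ≡ true → isKrewB n (sweep n k w) ≡ true
sweep-kreweras n zero w h = h
sweep-kreweras n (suc k) w h = tau-kreweras n (suc k) (sweep n k w) (sweep-kreweras n k w h)

evacGo-kreweras : ∀ n k w → isKrewB n w ≡ true → isKrewB n (evacGo n k w) ≡ true
evacGo-kreweras n zero w h = h
evacGo-kreweras n (suc k) w h = evacGo-kreweras n k (sweep n (suc k) w) (sweep-kreweras n (suc k) w h)

swapAt-++ : ∀ u p q v → swapAt (length u) (u ++ p ∷ q ∷ v) ≡ u ++ q ∷ p ∷ v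
swapAt-++ [] p q v = refl
swapAt-++ (x ∷ u) p q v = cong (x ∷_) (swapAt-++ u p q v)

count-exchange : ∀ x u p q v → count x (u ++ q ∷ p ∷ v) ≡ count x (u ++ p ∷ q ∷ v)
count-exchange x u p q v =
    trans (count-++ x u _) (trans (cong (count x u +_) (lemma p q)) (sym (count-++ x u _)))
  where
  lemma : ∀ p q → count x (q ∷ p ∷ v) ≡ count x (p ∷ q ∷ v)
  lemma p q with x ==L p | x ==L q
  ... | true | true = refl
  ... | true | false = refl
  ... | false | true = refl
  ... | false | false = refl

ballotAfter : List Letter → List Letter → Bool
ballotAfter u v = ballot (count A u) (count B u) (count C u) v

isKrewB-after : ∀ n u v → isKrewB n (u ++ v) ≡ true → ballotAfter u v ≡ true
isKrewB-after n u v h =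
    proj₂ (∧-elim {ballot 0 0 0 u} (trans (sym (ballot-++ 0 0 0 u v))
        (proj₂ (isKrewB-split {n} {u ++ v} h))))

isKrewB-exchange : ∀ n u p q v → isKrewB n (u ++ p ∷ q ∷ v) ≡ true →
  isKrewB n (u ++ q ∷ p ∷ v) ≡ ballotAfter u (q ∷ p ∷ v)
isKrewB-exchange n u p q v h with isKrewB-split {n} {u ++ p ∷ q ∷ v} h
... | (hA , hB , hC) , hb
  rewrite trans (count-exchange A u p q v) hA | trans (count-exchange B u p q v) hB | trans
      (count-exchange C u p q v) hC
        | ≡ᵇ-refl n | ballot-++ 0 0 0 u (q ∷ p ∷ v)
        | proj₁ (∧-elim {ballot 0 0 0 u} (trans (sym (ballot-++ 0 0 0 u (p ∷ q ∷ v))) hb)) = refl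

tau-swaps : ∀ n u p q v → isKrewB n (u ++ p ∷ q ∷ v) ≡ true → ballotAfter u (q ∷ p ∷ v) ≡ true →
  tau n (suc (length u)) (u ++ p ∷ q ∷ v) ≡ u ++ q ∷ p ∷ v
tau-swaps n u p q v h hb rewrite swapAt-++ u p q v | isKrewB-exchange n u p q v h | hb = refl

tau-fixes : ∀ n u p q v → isKrewB n (u ++ p ∷ q ∷ v) ≡ true → ballotAfter u (q ∷ p ∷ v) ≡ false →
  tau n (suc (length u)) (u ++ p ∷ q ∷ v) ≡ u ++ p ∷ q ∷ v
tau-fixes n u p q v h hb rewrite swapAt-++ u p q v | isKrewB-exchange n u p q v h | hb = refl

tau-same : ∀ n u p v → tau n (suc (length u)) (u ++ p ∷ p ∷ v) ≡ u ++ p ∷ p ∷ v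
tau-same n u p v rewrite swapAt-++ u p p v with isKrewB n (u ++ p ∷ p ∷ v)
... | true = refl
... | false = refl

-- `sweep` peels off its last swap; this form peels off the first, as needed for an induction along
-- the word with a finished prefix.
sweepFrom : ℕ → ℕ → ℕ → List Letter → List Letter
sweepFrom n i zero w = w
sweepFrom n i (suc m) w = sweepFrom n (suc i) m (tau n (suc i) w)

sweep-from : ∀ n i m w → sweep n (i + m) w ≡ sweepFrom n i m (sweep n i w)
sweep-from n i zero w rewrite +-identityʳ i = refl
sweep-from n i (suc m) w rewrite +-suc i m = sweep-from n (suc i) m w

snoc-++ : ∀ (u : List Letter) x v → (u ++ x ∷ []) ++ v ≡ u ++ x ∷ v
snoc-++ u x v = ++-assoc u (x ∷ []) v

length-snoc : ∀ (u : List Letter) x → length (u ++ x ∷ []) ≡ suc (length u)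
length-snoc u x = trans (length-++ u) (+-comm (length u) 1)

sweep-next : ∀ n u x m y z → tau n (suc (length u)) y ≡ u ++ x ∷ z →
  sweepFrom n (length u) (suc m) y ≡ sweepFrom n (length (u ++ x ∷ [])) m ((u ++ x ∷ []) ++ z)
sweep-next n u x m y z e rewrite length-snoc u x | snoc-++ u x z | e = refl

snoc-kreweras : ∀ n u x z → isKrewB n (u ++ x ∷ z) ≡ true → isKrewB n ((u ++ x ∷ []) ++ z) ≡ true
snoc-kreweras n u x z h = trans (cong (isKrewB n) (snoc-++ u x z)) h

exchange-kreweras : ∀ n u p q v → isKrewB n (u ++ p ∷ q ∷ v) ≡ true → ballotAfter u (q ∷ p ∷ v) ≡ true →
  isKrewB n ((u ++ q ∷ []) ++ p ∷ v) ≡ true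
exchange-kreweras n u p q v h hb = snoc-kreweras n u q (p ∷ v) (trans (isKrewB-exchange n u p q v h) hb)

-- A B or C is never blocked on its way right: passing an A only raises the number of A's before it,
-- and the ballot conditions for B and C do not interact.
sweep-arc : ∀ {ε} → ArcColour ε → ∀ n u x v → isKrewB n (u ++ ε ∷ x ++ v) ≡ true →
  sweepFrom n (length u) (length x) (u ++ ε ∷ x ++ v) ≡ u ++ x ++ ε ∷ v
sweep-arc e n u [] v h = refl
sweep-arc {ε} e n u (y ∷ x) v h = helper y h (advance e y (isKrewB-after n u (ε ∷ y ∷ x ++ v) h))
  where
  advance : ∀ {ε} → ArcColour ε → ∀ y → ballotAfter u (ε ∷ y ∷ x ++ v) ≡ true →
      y ≡ ε ⊎ ballotAfter u (y ∷ ε ∷ x ++ v) ≡ true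
  advance isB B _ = inj₁ refl
  advance isC C _ = inj₁ refl
  advance isB A h with ∧-elim {suc (count B u) ≤ᵇ count A u} h
  ... | l , k = inj₂ (∧-intro (≤→≤ᵇ (m≤n⇒m≤1+n (≤ᵇ→≤ {suc (count B u)} l))) k)
  advance isC A h with ∧-elim {suc (count C u) ≤ᵇ count A u} h
  ... | l , k = inj₂ (∧-intro (≤→≤ᵇ (m≤n⇒m≤1+n (≤ᵇ→≤ {suc (count C u)} l))) k)
  advance isB C h with ∧-elim {suc (count B u) ≤ᵇ count A u} h
  ... | l , k with ∧-elim {suc (count C u) ≤ᵇ count A u} k
  ... | l′ , k′ = inj₂ (∧-intro l′ (∧-intro l k′))
  advance isC B h with ∧-elim {suc (count C u) ≤ᵇ count A u} h
  ... | l , k with ∧-elim {suc (count B u) ≤ᵇ count A u} k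
  ... | l′ , k′ = inj₂ (∧-intro l′ (∧-intro l k′))
  helper : ∀ y → isKrewB n (u ++ ε ∷ y ∷ x ++ v) ≡ true → y ≡ ε ⊎ ballotAfter u (y ∷ ε ∷ x ++ v) ≡ true →
    sweepFrom n (length u) (suc (length x)) (u ++ ε ∷ y ∷ x ++ v) ≡ u ++ y ∷ x ++ ε ∷ v
  helper y h (inj₁ refl) = trans (sweep-next n u ε (length x) _ (ε ∷ x ++ v) (tau-same n u ε (x ++ v)))
    (trans (sweep-arc e n (u ++ ε ∷ []) x v (snoc-kreweras n u ε (ε ∷ x ++ v) h))
        (snoc-++ u ε (x ++ ε ∷ v)))
  helper y h (inj₂ hb) =
      trans (sweep-next n u y (length x) _ (ε ∷ x ++ v) (tau-swaps n u ε y (x ++ v) h hb))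
    (trans (sweep-arc e n (u ++ y ∷ []) x v (exchange-kreweras n u ε y (x ++ v) h hb))
        (snoc-++ u y (x ++ ε ∷ v)))

∧-falseˡ : ∀ {x y} → x ≡ false → x ∧ y ≡ false
∧-falseˡ refl = refl

-- `suc m` counts the A's including the moving one. Exchanging it with the next letter is judged by
-- m alone, so the ballot condition fails exactly at the stopping test of `slide`.
passes : ∀ {m k} → (suc k ≤ᵇ suc m) ≡ true →
    ((suc m ≡ᵇ suc k) ≡ true × (suc k ≤ᵇ m) ≡ false) ⊎ ((suc m ≡ᵇ suc k) ≡ false × (suc k ≤ᵇ m) ≡ true)
passes {m} {k} h with m ≟ k
... | yes refl = inj₁ (≡ᵇ-refl m , ≥→<ᵇ {m} ≤-refl)
... | no n = inj₂ (≢→≡ᵇ n , ≤→≤ᵇ (≤∧≢⇒< (≤-pred (≤ᵇ→≤ {suc k} h)) (λ q → n (sym q))))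

slideAfter : List Letter → List Letter → List Letter × Letter
slideAfter u x = slide (suc (count A u)) (count B u) (count C u) x

slideAfter-snoc : ∀ u y x → slideAfter (u ++ y ∷ []) x ≡
  slide (suc (count A u + count A (y ∷ []))) (count B u + count B (y ∷ []))
      (count C u + count C (y ∷ [])) x
slideAfter-snoc u y x rewrite count-++ A u (y ∷ []) | count-++ B u (y ∷ []) | count-++ C u (y ∷ []) =
    refl

sweep-A : ∀ n u x v → isKrewB n (u ++ A ∷ x ++ v) ≡ true →
  sweepFrom n (length u) (length x) (u ++ A ∷ x ++ v) ≡ u ++ proj₁ (slideAfter u x) ++ proj₂
      (slideAfter u x) ∷ v
sweep-A n u [] v h = refl
-- The swap of equal letters changes nothing, and the second A takes over as the moving letter.
sweep-A n u (A ∷ x) v h = trans (sweep-next n u A (length x) _ (A ∷ x ++ v) (tau-same n u A (x ++ v)))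
  (trans (sweep-A n (u ++ A ∷ []) x v (snoc-kreweras n u A (A ∷ x ++ v) h))
  (trans (snoc-++ u A _) (cong (λ s → u ++ A ∷ proj₁ s ++ proj₂ s ∷ v)
      (trans (slideAfter-snoc u A x) counts))))
  where
  counts : slide (suc (count A u + 1)) (count B u + 0) (count C u + 0) x ≡ slide (suc (suc (count A u)))
      (count B u) (count C u) x
  counts rewrite +-comm (count A u) 1 | +-identityʳ (count B u) | +-identityʳ (count C u) = refl
sweep-A n u (B ∷ x) v h with ∧-elim {suc (count B u) ≤ᵇ suc (count A u)}
    (isKrewB-after n u (A ∷ B ∷ x ++ v) h)
... | l , k with passes {count A u} {count B u} l
-- The A is blocked and stays; from here on the sweep carries the B to the end.
... | inj₁ (q , f) rewrite q =
  trans (sweep-next n u A (length x) _ (B ∷ x ++ v) (tau-fixes n u A B (x ++ v) h (∧-falseˡ f)))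
  (trans (sweep-arc isB n (u ++ A ∷ []) x v (snoc-kreweras n u A (B ∷ x ++ v) h))
      (snoc-++ u A (x ++ B ∷ v)))
... | inj₂ (q , f) rewrite q =
  trans (sweep-next n u B (length x) _ (A ∷ x ++ v) (tau-swaps n u A B (x ++ v) h hb))
  (trans (sweep-A n (u ++ B ∷ []) x v (exchange-kreweras n u A B (x ++ v) h hb))
  (trans (snoc-++ u B _) (cong (λ s → u ++ B ∷ proj₁ s ++ proj₂ s ∷ v)
      (trans (slideAfter-snoc u B x) counts))))
  where
  hb = ∧-intro f k
  counts : slide (suc (count A u + 0)) (count B u + 1) (count C u + 0) x ≡ slide (suc (count A u))
      (suc (count B u)) (count C u) x
  counts rewrite +-comm (count B u) 1 | +-identityʳ (count A u) | +-identityʳ (count C u) = refl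
sweep-A n u (C ∷ x) v h with ∧-elim {suc (count C u) ≤ᵇ suc (count A u)}
    (isKrewB-after n u (A ∷ C ∷ x ++ v) h)
... | l , k with passes {count A u} {count C u} l
... | inj₁ (q , f) rewrite q =
  trans (sweep-next n u A (length x) _ (C ∷ x ++ v) (tau-fixes n u A C (x ++ v) h (∧-falseˡ f)))
  (trans (sweep-arc isC n (u ++ A ∷ []) x v (snoc-kreweras n u A (C ∷ x ++ v) h))
      (snoc-++ u A (x ++ C ∷ v)))
... | inj₂ (q , f) rewrite q =
  trans (sweep-next n u C (length x) _ (A ∷ x ++ v) (tau-swaps n u A C (x ++ v) h hb))
  (trans (sweep-A n (u ++ C ∷ []) x v (exchange-kreweras n u A C (x ++ v) h hb))
  (trans (snoc-++ u C _) (cong (λ s → u ++ C ∷ proj₁ s ++ proj₂ s ∷ v)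
      (trans (slideAfter-snoc u C x) counts))))
  where
  hb = ∧-intro f k
  counts : slide (suc (count A u + 0)) (count B u + 0) (count C u + 1) x ≡ slide (suc (count A u))
      (count B u) (suc (count C u)) x
  counts rewrite +-comm (count C u) 1 | +-identityʳ (count A u) | +-identityʳ (count B u) = refl

sweep-slide : ∀ n x v → isKrewB n (A ∷ x ++ v) ≡ true →
  sweep n (length x) (A ∷ x ++ v) ≡ proj₁ (slide 1 0 0 x) ++ proj₂ (slide 1 0 0 x) ∷ v
sweep-slide n x v h = trans (sweep-from n 0 (length x) (A ∷ x ++ v)) (sweep-A n [] x v h)

Reordered : ℕ → List Letter → List Letter
Reordered j xs = take j xs ++ (A ∷ drop (suc j) xs) ++ (nth xs j ∷ [])

>→≡ᵇ : ∀ {m n} → n < m → (m ≡ᵇ n) ≡ false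
>→≡ᵇ h = ≢→≡ᵇ (λ q → <⇒≢ h (sym q))

-- Both scans stop at the first prefix in which the A's are no more numerous than the B's or than
-- the C's. Equal totals of A and B guarantee a stop, which rules out the empty list.
iota-slide : ∀ k a b c xs → b < a → c < a → a + count A xs ≡ b + count B xs →
  Σ ℕ λ j → iotaGo k a b c xs ≡ suc (k + j) × Reordered j xs ≡ proj₁ (slide a b c xs) ++ proj₂
      (slide a b c xs) ∷ []
iota-slide k a b c [] hb hc q rewrite +-identityʳ a | +-identityʳ b = ⊥-elim (<⇒≢ hb (sym q))
iota-slide k a b c (A ∷ xs) hb hc q
  rewrite >→≡ᵇ {suc a} {b} (m<n⇒m<1+n hb) | >→≡ᵇ {suc a} {c} (m<n⇒m<1+n hc)
  with iota-slide (suc k) (suc a) b c xs (m<n⇒m<1+n hb) (m<n⇒m<1+n hc) (trans (sym (+-suc a _)) q)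
... | j , r , t = suc j , trans r (cong suc (sym (+-suc k j))) , cong (A ∷_) t
iota-slide k a b c (B ∷ xs) hb hc q with a ≡ᵇ suc b in e
... | true = 0 , cong suc (sym (+-identityʳ k)) , refl
... | false rewrite >→≡ᵇ hc
  with iota-slide (suc k) a (suc b) c xs
      (≤∧≢⇒< hb (λ r → true≢false (trans (sym (trans (cong (a ≡ᵇ_) r) (≡ᵇ-refl a))) e))) hc
          (trans q (+-suc b _))
... | j , r , t = suc j , trans r (cong suc (sym (+-suc k j))) , cong (B ∷_) t
iota-slide k a b c (C ∷ xs) hb hc q rewrite >→≡ᵇ hb with a ≡ᵇ suc c in e
... | true = 0 , cong suc (sym (+-identityʳ k)) , refl
... | false
  with iota-slide (suc k) a b (suc c) xs hb
      (≤∧≢⇒< hc (λ r → true≢false (trans (sym (trans (cong (a ≡ᵇ_) r) (≡ᵇ-refl a))) e))) q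
... | j , r , t = suc j , trans r (cong suc (sym (+-suc k j))) , cong (C ∷_) t

pro-slide : ∀ n x → IsKreweras n (A ∷ x) → pro (A ∷ x) ≡ proj₁ (slide 1 0 0 x) ++ proj₂ (slide 1 0 0 x) ∷
    []
pro-slide n x k with iota-slide 1 1 0 0 x (s≤s z≤n) (s≤s z≤n)
    (trans (IsKreweras.countA k) (sym (IsKreweras.countB k)))
... | j , r , t rewrite r = t

-- The stages of evacuation

-- Position i is where the evacuation has arrived.
Staged : ℕ → ℕ → Diagram → Set
Staged N i D = ∀ {ε p} → ArcColour ε → Diagrams.IsA N D p →
  (i ≤ R D ε p → i ≤ p × p < R D ε p) × (R D ε p < i → R D ε p < p)

module Scan {N : ℕ} {D : Diagram} (wf : Diagrams.WellFormed N D) {i : ℕ}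
            (staged : Staged N i D) (hi : Diagrams.IsA N D i) where
  open Diagrams N
  open WellFormedProperties wf

  Descending : List ℕ → Set
  Descending [] = ⊤
  Descending (c ∷ t) = All (_< c) t × Descending t

  OpenAt : Letter → ℕ → ℕ → Set
  OpenAt ε p c = i ≤ R D ε c → p ≤ R D ε c

  -- t is the stack of A's after i still open at p; a and b count the A's and ε's.
  record Pending (ε : Letter) (p a b : ℕ) (t : List ℕ) : Set where
    constructor mkPending
    field
      counts : a ≡ suc (b + length t)
      members : All (λ c → (i < c × c < p) × IsA D c × OpenAt ε p c) t
      descending : Descending t
      complete : ∀ c → i < c → c < p → IsA D c → c ∈ t ⊎ (i ≤ R D ε c × R D ε c < p)
      base : OpenAt ε p i

  split : ∀ {a p} → a < suc p → a < p ⊎ a ≡ p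
  split h = m≤n⇒m<n∨m≡n (≤-pred h)

  open-suc : ∀ {ε p c} → OpenAt ε p c → R D ε c ≢ p → OpenAt ε (suc p) c
  open-suc h n l = ≤∧≢⇒< (h l) (λ q → n (sym q))

  push : ∀ {ε p a b t} → ArcColour ε → i < p → IsA D p → Pending ε p a b t →
      Pending ε (suc p) (suc a) b (p ∷ t)
  push {ε} {p} {a} {b} {t} e l hp (mkPending q m d k o) = mkPending
    (trans (cong suc q) (cong suc (sym (+-suc b (length t)))))
    (((l , ≤-refl) , hp , λ h → proj₂ (proj₁ (staged e hp) h)) ∷ All.map
        (λ ((l , l′) , hc , o) → (l , m≤n⇒m≤1+n l′) , hc , open-suc o (λ r → A≢R e hc hp (sym r))) m)
    (All.map (λ ((_ , l′) , _) → l′) m , d) complete (open-suc o (λ r → A≢R e hi hp (sym r)))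
    where
    complete : ∀ c → i < c → c < suc p → IsA D c → c ∈ p ∷ t ⊎ (i ≤ R D ε c × R D ε c < suc p)
    complete c h h′ hc with split h′
    ... | inj₂ refl = inj₁ (here refl)
    ... | inj₁ h″ with k c h h″ hc
    ... | inj₁ m = inj₁ (there m)
    ... | inj₂ (x , y) = inj₂ (x , m≤n⇒m≤1+n y)

  skip : ∀ {ε p a b t} → ArcColour ε → i < p → ℓ D p ≡ swapLetter ε → Pending ε p a b t →
      Pending ε (suc p) a b t
  skip {ε} {p} {a} {b} {t} e l hp (mkPending q m d k o) = mkPending q
    (All.map (λ ((l , l′) , hc , o) → (l , m≤n⇒m≤1+n l′) , hc , open-suc o (clash hc)) m)
    d complete (open-suc o (clash hi))
    where
    clash : ∀ {c} → IsA D c → R D ε c ≢ p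
    clash hc r = ε≢swap e (trans (sym (ℓR e hc)) (trans (cong (ℓ D) r) hp))
    complete : ∀ c → i < c → c < suc p → IsA D c → c ∈ t ⊎ (i ≤ R D ε c × R D ε c < suc p)
    complete c h h′ hc with split h′
    ... | inj₂ refl = ⊥-elim (A≢arc (swapColour e) (trans (sym (proj₂ hc)) hp))
    ... | inj₁ h″ with k c h h″ hc
    ... | inj₁ m = inj₁ m
    ... | inj₂ (x , y) = inj₂ (x , m≤n⇒m≤1+n y)

  enclosed : ∀ {ε p c r} → ArcColour ε → IsA D c → R D ε c ≡ p → i ≤ c → IsA D r → c < r → r < p →
      OpenAt ε p r → ⊥
  enclosed {ε} {p} {c} {r} e hc q h hr l l′ o = <⇒≱ r<p (o (<⇒≤ (≤-<-trans h c<r)))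
    where
    nc : cyc c r p ≡ cyc c (R D ε r) p
    nc = subst (λ p → cyc c r p ≡ cyc c (R D ε r) p) q (Matching.noncrossing (wf e) hc hr (<⇒≢ l))
    c<r = solve 4 (λ c r p s → cyc′ c r p ≈ cyc′ c s p ⊢ c ≺ r ⊢ r ≺ p ⊢ ⊢
        c ≺ s) refl (c ∷ r ∷ p ∷ R D ε r ∷ []) nc l l′
    r<p = solve 4 (λ c r p s → cyc′ c r p ≈ cyc′ c s p ⊢ c ≺ r ⊢ r ≺ p ⊢ ⊢
        s ≺ p) refl (c ∷ r ∷ p ∷ R D ε r ∷ []) nc l l′

  -- The ε at p ends a chord from some c ≥ i. With an empty stack c can only be i. Otherwise c is
  -- the top of the stack, because an open A after c would be enclosed by c → p. So the counting
  -- test of `slide`, which detects the empty stack, recognises the end of the chord from i.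
  close : ∀ {ε p a b t} → ArcColour ε → i < p → p < N → ℓ D p ≡ ε → Pending ε p a b t →
    (a ≡ suc b × R D ε i ≡ p) ⊎ (a ≢ suc b × Σ (List ℕ) λ t′ → Pending ε (suc p) a (suc b) t′)
  close {ε} {p} {a} {b} {t} e l l′ hp (mkPending q m d k o) with Matching.source (wf e) l′ hp
  ... | c , hc , r = helper t q m d k (m≤n⇒m<n∨m≡n (proj₁ bounds))
    where
    bounds : i ≤ c × c < p
    bounds with proj₁ (staged e hc) (subst (i ≤_) (sym r) (<⇒≤ l))
    ... | h , h′ = h , subst (c <_) r h′
    i≤Rc : i ≤ R D ε c
    i≤Rc = subst (i ≤_) (sym r) (<⇒≤ l)
    helper : ∀ t → a ≡ suc (b + length t) → All (λ c → (i < c × c < p) × IsA D c × OpenAt ε p c) t →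
        Descending t →
      (∀ c → i < c → c < p → IsA D c → c ∈ t ⊎ (i ≤ R D ε c × R D ε c < p)) → i < c ⊎ i ≡ c →
      (a ≡ suc b × R D ε i ≡ p) ⊎ (a ≢ suc b × Σ (List ℕ) λ t′ → Pending ε (suc p) a (suc b) t′)
    helper [] q m d k (inj₂ refl) = inj₁ (trans q (cong suc (+-identityʳ b)) , r)
    helper [] q m d k (inj₁ h) with k c h (proj₂ bounds) hc
    ... | inj₂ (_ , h′) = ⊥-elim (<⇒≢ h′ r)
    helper (x ∷ t) q (((l₁ , l₂) , hx , ox) ∷ m) d k (inj₂ refl) =
        ⊥-elim (enclosed e hc r (proj₁ bounds) hx l₁ l₂ ox)
    helper (x ∷ t) q ms@(((l₁ , l₂) , hx , ox) ∷ m) (below , d) k (inj₁ h) with k c h (proj₂ bounds) hc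
    ... | inj₂ (_ , h′) = ⊥-elim (<⇒≢ h′ r)
    ... | inj₁ (there mem) = ⊥-elim (enclosed e hc r (proj₁ bounds) hx (All.lookup below mem) l₂ ox)
    ... | inj₁ (here refl) = inj₂ ((λ q′ → <⇒≢ (s≤s (m<m+n b (s≤s z≤n))) (trans (sym q′) q)) , t ,
      mkPending (trans q (cong suc (+-suc b (length t)))) (rest t m below) d complete
        (open-suc o (λ q → <⇒≢ h (R-injective e hi hc (trans q (sym r))))))
      where
      rest : ∀ t → All (λ c → (i < c × c < p) × IsA D c × OpenAt ε p c) t → All (_< c) t →
             All (λ c → (i < c × c < suc p) × IsA D c × OpenAt ε (suc p) c) t
      rest [] [] [] = []
      rest (y ∷ t) (((l₁ , l₂) , hy , oy) ∷ m) (y<c ∷ below) =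
        ((l₁ , m≤n⇒m≤1+n l₂) , hy , open-suc oy (λ q → <⇒≢ y<c (R-injective e hy hc (trans q (sym r)))))
            ∷ rest t m below
      complete : ∀ z → i < z → z < suc p → IsA D z → z ∈ t ⊎ (i ≤ R D ε z × R D ε z < suc p)
      complete z h h′ hz with split h′
      ... | inj₂ refl = ⊥-elim (A≢arc e (trans (sym (proj₂ hz)) hp))
      ... | inj₁ h″ with k z h h″ hz
      ... | inj₁ (here refl) = inj₂ (i≤Rc , s≤s (≤-reflexive r))
      ... | inj₁ (there m) = inj₁ m
      ... | inj₂ (x , y) = inj₂ (x , m≤n⇒m≤1+n y)

  -- In case `none` both chords of i lead back to evacuated positions and the sweep yields an A. In
  -- case `hit` the chord of colour ε leads ahead and ends before the other one, unless that one
  -- leads back.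
  data Outcome (p : ℕ) (xs : List Letter) : List Letter × Letter → Set where
    none : (∀ {ε} → ArcColour ε → R D ε i < i) → Outcome p xs (xs , A)
    hit : ∀ {ε u} → ArcColour ε → p ≤ R D ε i →
        (R D (swapLetter ε) i < i ⊎ R D ε i < R D (swapLetter ε) i) →
      length u ≡ length xs →
          (∀ j → j < length xs → nth u j ≡ (if p + j ≡ᵇ R D ε i then A else nth xs j)) →
      Outcome p xs (u , ε)

  cons-outcome : ∀ {p xs s} x → Outcome (suc p) xs s → Outcome p (x ∷ xs) (x ∷ proj₁ s , proj₂ s)
  cons-outcome x (none h) = none h
  cons-outcome {p} {xs} x (hit {ε} {u} e h o len nths) = hit e (<⇒≤ h) o (cong suc len) letters
    where
    letters : ∀ j → j < suc (length xs) →
        nth (x ∷ u) j ≡ (if p + j ≡ᵇ R D ε i then A else nth (x ∷ xs) j)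
    letters zero _ rewrite +-identityʳ p | ≢→≡ᵇ (<⇒≢ h) = refl
    letters (suc j) (s≤s l) rewrite +-suc p j = nths j l

  hit-here : ∀ {ε p xs} x → ArcColour ε → R D ε i ≡ p → OpenAt (swapLetter ε) p i →
      Outcome p (x ∷ xs) (A ∷ xs , ε)
  hit-here {ε} {p} {xs} x e q o = hit e (≤-reflexive (sym q)) other refl letters
    where
    other : R D (swapLetter ε) i < i ⊎ R D ε i < R D (swapLetter ε) i
    other with R D (swapLetter ε) i <? i
    ... | yes l = inj₁ l
    ... | no l = inj₂ (≤∧≢⇒< (subst (_≤ _) (sym q) (o (≮⇒≥ l))) (R≢R e hi hi))
    letters : ∀ j → j < suc (length xs) →
        nth (A ∷ xs) j ≡ (if p + j ≡ᵇ R D ε i then A else nth (x ∷ xs) j)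
    letters zero _ rewrite +-identityʳ p | q | ≡ᵇ-refl p = refl
    letters (suc j) _ rewrite q | ≢→≡ᵇ {p + suc j} {p} (λ r → <⇒≢ (m<m+n p {suc j} (s≤s z≤n)) (sym r)) =
        refl

  scan : ∀ xs {p a b c tB tC} → i < p → p + length xs ≡ N →
      (∀ j → j < length xs → ℓ D (p + j) ≡ nth xs j) →
    Pending B p a b tB → Pending C p a c tC → Outcome p xs (slide a b c xs)
  scan [] {p} l q agree PB PC = none λ { isB → bound isB (Pending.base PB) ; isC →
      bound isC (Pending.base PC) }
    where
    bound : ∀ {ε} → ArcColour ε → OpenAt ε p i → R D ε i < i
    bound {ε} e o with R D ε i <? i
    ... | yes h = h
    ... | no h = ⊥-elim (<⇒≱ (R<N e hi) (subst (_≤ R D ε i) (trans (sym (+-identityʳ p)) q) (o (≮⇒≥ h))))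
  scan (x ∷ xs) {p} {a} {b} {c} l q agree PB PC = step x refl
    where
    p<N : p < N
    p<N = subst (p <_) q (m<m+n p (s≤s z≤n))
    ℓp : ∀ {y} → x ≡ y → ℓ D p ≡ y
    ℓp r = trans (trans (cong (ℓ D) (sym (+-identityʳ p))) (agree 0 (s≤s z≤n))) r
    q′ : suc p + length xs ≡ N
    q′ = trans (sym (+-suc p (length xs))) q
    agree′ : ∀ j → j < length xs → ℓ D (suc p + j) ≡ nth xs j
    agree′ j h = trans (cong (ℓ D) (sym (+-suc p j))) (agree (suc j) (s≤s h))
    l′ : i < suc p
    l′ = m≤n⇒m≤1+n l
    step : ∀ y → x ≡ y → Outcome p (y ∷ xs) (slide a b c (y ∷ xs))
    step A r = cons-outcome A (scan xs l′ q′ agree′ (push isB l (p<N , ℓp r) PB)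
        (push isC l (p<N , ℓp r) PC))
    step B r with close isB l p<N (ℓp r) PB
    ... | inj₁ (refl , h) rewrite ≡ᵇ-refl b = hit-here B isB h (Pending.base PC)
    ... | inj₂ (m , t , PB′) rewrite ≢→≡ᵇ m =
        cons-outcome B (scan xs l′ q′ agree′ PB′ (skip isC l (ℓp r) PC))
    step C r with close isC l p<N (ℓp r) PC
    ... | inj₁ (refl , h) rewrite ≡ᵇ-refl c = hit-here C isC h (Pending.base PB)
    ... | inj₂ (m , t , PC′) rewrite ≢→≡ᵇ m =
        cons-outcome C (scan xs l′ q′ agree′ (skip isB l (ℓp r) PB) PC′)

  initially : ∀ {ε} → ArcColour ε → Pending ε (suc i) 1 0 []
  initially e = mkPending refl [] tt (λ c h h′ → ⊥-elim (<⇒≱ h (≤-pred h′))) (λ h →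
      proj₂ (proj₁ (staged e hi) h))

  outcome : ∀ xs → suc i + length xs ≡ N → (∀ j → j < length xs → ℓ D (suc i + j) ≡ nth xs j) →
      Outcome (suc i) xs (slide 1 0 0 xs)
  outcome xs q agree = scan xs ≤-refl q agree (initially isB) (initially isC)

record Advanced (N : ℕ) (D : Diagram) (i : ℕ) (ε : Letter) : Set where
  open Diagrams N
  field
    D′ : Diagram
    wf′ : WellFormed D′
    staged′ : Staged N (suc i) D′
    ℓ-at : ℓ D′ i ≡ ε
    ℓ-end : ℓ D′ (R D ε i) ≡ A
    ℓ-other : ∀ {p} → p ≢ i → p ≢ R D ε i → ℓ D′ p ≡ ℓ D p
    iso : Iso (λ p → p) false D D′

module _ {N : ℕ} where
  open Diagrams N

  -- `forward` in `Switchable` comes from `staged`: a C-chord ending after i starts at i or later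
  -- and runs to the right. The chord from i itself is excluded by the last hypothesis.
  advance-B : ∀ {D} → WellFormed D → ∀ {i} → Staged N i D → IsA D i → i < R D B i →
    (R D C i < i ⊎ R D B i < R D C i) → Advanced N D i B
  advance-B {D} wf {i} staged hi l far = record
    { D′ = S.D′ ; wf′ = S.switched-wellFormed ; staged′ = staged′
    ; ℓ-at = S.ℓ′-a ; ℓ-end = S.ℓ′-b ; ℓ-other = S.ℓ′-other
    ; iso = SwitchIso.switchIso sw }
    where
    outside-far : (R D C i < i ⊎ R D B i < R D C i) → ((R D C i <ᵇ i) ∨ (R D B i <ᵇ R D C i)) ≡ true
    outside-far (inj₁ h) rewrite <→<ᵇ h = refl
    outside-far (inj₂ h) = ∨-introʳ (R D C i <ᵇ i) (<→<ᵇ h)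
    not-between : (R D C i < i ⊎ R D B i < R D C i) → i < R D C i → R D C i < R D B i → ⊥
    not-between (inj₁ h) h₁ h₂ = <-asym h h₁
    not-between (inj₂ h) h₁ h₂ = <-asym h h₂
    forward : ∀ {x} → IsA D x → i < R D C x → R D C x < R D B i → i < x × x < R D B i
    forward {x} hx h₁ h₂ with proj₁ (staged isC hx) (<⇒≤ h₁)
    ... | h , h′ = ≤∧≢⇒< h (λ { refl → not-between far h₁ h₂ }) , <-trans h′ h₂
    sw : Switchable N D i (R D B i)
    sw = record { wf = wf ; a-isA = hi ; Ra = refl ; a<b = l ; a-far = outside-far far ; forward =
        forward }
    module S = Switch sw
    open WellFormedProperties wf
    below : ∀ {ε p} → ArcColour ε → IsA D p → R D ε p < suc i → R D ε p < i
    below e hp h = ≤∧≢⇒< (≤-pred h) (λ q → A≢R e hp hi (sym q))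
    staged-C : ∀ {p} → IsA D p →
      (suc i ≤ R D C p → suc i ≤ S.σ p × S.σ p < R D C p) × (R D C p < suc i → R D C p < S.σ p)
    staged-C {p} hp with S.source? p
    -- A moved chord starts after i and at most at `R D B i`; if it leads ahead, its end outside the
    -- interval lies beyond that point.
    ... | yes s = (λ h → S.a<target (S.σ-target s) , ≤-<-trans (proj₂ (S.σ-closed s))
        (far-right h (S.source-far s)))
                , (λ h → <-trans (proj₂ (staged isC hp) (below isC hp h)) (S.Step.x<z (S.σ-step s)))
      where
      far-right : i < R D C p → S.Outside (R D C p) → R D B i < R D C p
      far-right h o = solve 3 (λ a b y → (y <′ a ∨′ b <′ y) ≈ true′ ⊢ a ≺ y ⊢ ⊢
          b ≺ y) refl (i ∷ R D B i ∷ R D C p ∷ []) o h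
    ... | no ¬s rewrite S.σ-id ¬s =
      (λ h → let h′ , h″ = proj₁ (staged isC hp) (<⇒≤ h) in ≤∧≢⇒< h′ (λ q → ¬s (inj₁ (sym q))) , h″)
      , λ h → proj₂ (staged isC hp) (below isC hp h)
    staged′ : Staged N (suc i) S.D′
    staged′ {p = p} isB hp = helper (p ≟ R D B i)
      where
      helper : Dec (p ≡ R D B i) → (suc i ≤ S.RB′ p → suc i ≤ p × p < S.RB′ p) × (S.RB′ p < suc i →
          S.RB′ p < p)
      helper (yes refl) rewrite S.R′B-b = (λ h → ⊥-elim (<-irrefl refl h)) , λ _ → l
      helper (no m) rewrite S.R′B-other m =
        (λ h → let h′ , h″ = proj₁ (staged isB hp′) (<⇒≤ h) in ≤∧≢⇒< h′ (λ q → S.isA′-not-a hp (sym q)) , h″)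
        , λ h → proj₂ (staged isB hp′) (below isB hp′ h)
        where hp′ = S.unkeep-isA hp m
    staged′ {p = p} isC hp =
        subst (λ q → (suc i ≤ R D C (S.τ p) → suc i ≤ q × q < R D C (S.τ p)) ×
            (R D C (S.τ p) < suc i → R D C (S.τ p) < q))
      (S.στ hp) (staged-C (S.τ-isA hp))

  swap-staged : ∀ {D i} → Staged N i D → Staged N i (swapDiagram D)
  swap-staged {D} staged e hp = staged (swapColour e) (Swap.unswap-IsA {D = D} hp)

  advance : ∀ {D} → WellFormed D → ∀ {i ε} → ArcColour ε → Staged N i D → IsA D i → i < R D ε i →
    (R D (swapLetter ε) i < i ⊎ R D ε i < R D (swapLetter ε) i) → Advanced N D i ε
  advance wf isB staged hi l far = advance-B wf staged hi l far
  advance {D} wf {i} isC staged hi l far = record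
    { D′ = swapDiagram D′ ; wf′ = swap-wellFormed {D′} wf′ ; staged′ = swap-staged {D′} staged′
    ; ℓ-at = cong swapLetter ℓ-at ; ℓ-end = cong swapLetter ℓ-end
    ; ℓ-other = λ m m′ → trans (cong swapLetter (ℓ-other m m′)) (swapLetter-involutive _)
    ; iso = swapIso {D} wf ⊙ iso ⊙ swapIso {D′} wf′ }
    where open Advanced (advance-B {swapDiagram D} (swap-wellFormed {D} wf) {i} (swap-staged {D} staged) (Swap.swap-IsA {D = D} hi) l far)

record Stage (n : ℕ) (D₀ : Diagram) (i : ℕ) (word : List Letter) : Set where
  open Diagrams (3 * n)
  field
    D : Diagram
    wf : WellFormed D
    staged : Staged (3 * n) i D
    u v : List Letter
    word-split : word ≡ u ++ v
    length-u : i + length u ≡ 3 * n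
    letters-u : ∀ j → j < length u → ℓ D (i + j) ≡ nth u j
    -- Each sweep puts its final letter in front of v, so v lists the positions from i - 1 down to
    -- 0.
    letters-v : ∀ q → q < i → ℓ D q ≡ nth v (i ∸ suc q)
    iso : Iso (λ p → p) false D₀ D
    kreweras : isKrewB n word ≡ true

module _ {n : ℕ} {D₀ : Diagram} where
  open Diagrams (3 * n)

  next-stage : ∀ {k i word} → Stage n D₀ i word → i + suc k ≡ 3 * n → Stage n D₀ (suc i) (sweep n k word)
  next-stage {k} {i} {word} st i+k = go u refl
    where
    open Stage st
    length-u′ : length u ≡ suc k
    length-u′ = +-cancelˡ-≡ i _ _ (trans length-u (sym i+k))
    i<N : i < 3 * n
    i<N = subst (i <_) i+k (m<m+n i (s≤s z≤n))
    go : ∀ u′ → u ≡ u′ → Stage n D₀ (suc i) (sweep n k word)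
    go [] q with trans (sym length-u′) (cong length q)
    ... | ()
    go (x ∷ xs) refl = from (head x (trans (cong (ℓ D) (sym (+-identityʳ i))) (letters-u 0 (s≤s z≤n))))
      where
      -- A chord ending at i would have to start at i or later and yet before its end.
      head : ∀ x → ℓ D i ≡ x → x ≡ A
      head A _ = refl
      head B q with Matching.source (wf isB) i<N q
      ... | p , hp , r with proj₁ (staged isB hp) (≤-reflexive (sym r))
      ... | h , h′ = ⊥-elim (<⇒≱ h′ (subst (_≤ p) (sym r) h))
      head C q with Matching.source (wf isC) i<N q
      ... | p , hp , r with proj₁ (staged isC hp) (≤-reflexive (sym r))
      ... | h , h′ = ⊥-elim (<⇒≱ h′ (subst (_≤ p) (sym r) h))
      |xs| : length xs ≡ k
      |xs| = suc-injective length-u′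
      letters-xs : ∀ j → j < length xs → ℓ D (suc i + j) ≡ nth xs j
      letters-xs j h = trans (cong (ℓ D) (sym (+-suc i j))) (letters-u (suc j) (s≤s h))
      length-xs : suc i + length xs ≡ 3 * n
      length-xs = trans (sym (+-suc i (length xs))) length-u
      pushed : ∀ {D′ l} → ℓ D′ i ≡ l → (∀ q → q < i → ℓ D′ q ≡ ℓ D q) → ∀ q → q < suc i →
          ℓ D′ q ≡ nth (l ∷ v) (i ∸ q)
      pushed {D′} {l} at old q h with m≤n⇒m<n∨m≡n (≤-pred h)
      ... | inj₂ refl rewrite n∸n≡0 q = at
      ... | inj₁ h′ rewrite sym (m∸n+n≡m h′) | +-∸-assoc (i ∸ suc q) {suc q} {q} (n≤1+n q) | m+n∸n≡m 1 q
          | +-comm (i ∸ suc q) 1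
          | m∸n+n≡m h′ = trans (old q h′) (letters-v q h′)
      from : x ≡ A → Stage n D₀ (suc i) (sweep n k word)
      from refl = build (slide 1 0 0 xs) swept (Scan.outcome wf staged hi xs length-xs letters-xs)
        where
        hi : IsA D i
        hi = i<N , trans (cong (ℓ D) (sym (+-identityʳ i))) (letters-u 0 (s≤s z≤n))
        swept : sweep n k word ≡ proj₁ (slide 1 0 0 xs) ++ proj₂ (slide 1 0 0 xs) ∷ v
        swept = trans (cong₂ (sweep n) (sym |xs|) word-split)
          (sweep-slide n xs v (subst (λ z → isKrewB n z ≡ true) word-split kreweras))
        build : ∀ s → sweep n k word ≡ proj₁ s ++ proj₂ s ∷ v → Scan.Outcome wf staged hi (suc i) xs s →
            Stage n D₀ (suc i) (sweep n k word)
        -- No switch takes place here: the front passes an A whose two chords already run backwards.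
        build _ swept (Scan.none back) = record
          { D = D ; wf = wf ; staged = staged′ ; u = xs ; v = A ∷ v
          ; word-split = swept ; length-u = length-xs ; letters-u = letters-xs
          ; letters-v = pushed {D} (proj₂ hi) (λ _ _ → refl) ; iso = iso ; kreweras =
              sweep-kreweras n k word kreweras }
          where
          open WellFormedProperties wf
          staged′ : Staged (3 * n) (suc i) D
          staged′ {p = p} e hp =
            (λ h → let h′ , h″ = proj₁ (staged e hp) (<⇒≤ h) in ≤∧≢⇒< h′ (λ { refl → <-asym h (back e) }) , h″)
            , λ h → proj₂ (staged e hp) (≤∧≢⇒< (≤-pred h) (λ q → A≢R e hp hi (sym q)))
        build _ swept (Scan.hit {ε} {u′} e h far len letters) = record
          { D = D′ ; wf = wf′ ; staged = staged′ ; u = u′ ; v = ε ∷ v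
          ; word-split = swept ; length-u = trans (cong (suc i +_) len) length-xs
          ; letters-u = λ j h → new-letters j (subst (j <_) len h)
          ; letters-v = pushed {D′} ℓ-at (λ q h′ → ℓ-other (<⇒≢ h′) (<⇒≢ (<-trans h′ h)))
          ; iso = iso ⊙ Advanced.iso adv ; kreweras = sweep-kreweras n k word kreweras }
          where
          adv = advance wf e staged hi h far
          open Advanced adv hiding (iso)
          new-letters : ∀ j → j < length xs → ℓ D′ (suc i + j) ≡ nth u′ j
          new-letters j h′ = trans (helper (suc i + j ≟ R D ε i)) (sym (letters j h′))
            where
            helper : Dec (suc i + j ≡ R D ε i) →
                ℓ D′ (suc i + j) ≡ (if suc i + j ≡ᵇ R D ε i then A else nth xs j)
            helper (yes q) rewrite q | ≡ᵇ-refl (R D ε i) = ℓ-end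
            helper (no m) rewrite ≢→≡ᵇ m = trans (ℓ-other (λ q → <⇒≢ (s≤s (m≤m+n i j)) (sym q)) m)
                (letters-xs j h′)

  last-stage : ∀ k {i word} → Stage n D₀ i word → i + suc k ≡ 3 * n →
      Stage n D₀ (3 * n) (evacGo n k word)
  -- The sweeps of evacuation end with the one of length 1, at position 3n - 2. The last position is
  -- passed with the sweep of length 0, which leaves the word as it is.
  last-stage zero {i} {word} st q = subst (λ m → Stage n D₀ m word) (trans (+-comm 1 i) q)
      (next-stage st q)
  last-stage (suc k) {i} {word} st q = last-stage k (next-stage st q) (trans (sym (+-suc i (suc k))) q)

-- Rotation and reflection

record DiskMap (N : ℕ) (ρ ρ⁻¹ : ℕ → ℕ) (o : Bool) : Set where
  field
    ρ<N : ∀ {p} → p < N → ρ p < N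
    ρ⁻¹<N : ∀ {p} → p < N → ρ⁻¹ p < N
    ρ⁻¹ρ : ∀ {p} → p < N → ρ⁻¹ (ρ p) ≡ p
    ρρ⁻¹ : ∀ {p} → p < N → ρ (ρ⁻¹ p) ≡ p
    cyc-ρ : ∀ {x y z} → x < N → y < N → z < N → x ≢ y → x ≢ z → y ≢ z →
            cyc (ρ x) (ρ y) (ρ z) ≡ o xor cyc x y z

module _ {n : ℕ} {ρ ρ⁻¹ : ℕ → ℕ} {o : Bool} (d : DiskMap (3 * n) ρ ρ⁻¹ o) where
  open Diagrams (3 * n)
  open DiskMap d

  -- The image D″ under ρ is well-formed, has the letters of w and runs forward; uniqueness then
  -- identifies its chords with those that the scan of w finds.
  relabelWord : ∀ {D} → WellFormed D → ∀ {w} → IsKreweras n w →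
    (∀ {p} → p < 3 * n → ℓ D (ρ⁻¹ p) ≡ nth w p) →
    (∀ {ε q} → ArcColour ε → IsA D q → ρ q < ρ (R D ε q)) → Iso ρ o D (wordDiagram n w)
  relabelWord {D} wf {w} k letters forward = Relabel.relabelIso toWord wf
    where
    D″ : Diagram
    D″ = record { ℓ = λ p → ℓ D (ρ⁻¹ p) ; R = λ ε p → ρ (R D ε (ρ⁻¹ p)) }
    toD″ : Relabelling ρ ρ⁻¹ o D D″
    toD″ = record
      { ρ<N = ρ<N ; ρ⁻¹<N = ρ⁻¹<N ; ρ⁻¹ρ = ρ⁻¹ρ ; ρρ⁻¹ = ρρ⁻¹ ; cyc-ρ = cyc-ρ
      ; letter = λ h → cong (ℓ D) (ρ⁻¹ρ h) ; chord = λ {ε} _ h →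
          cong (λ p → ρ (R D ε p)) (ρ⁻¹ρ (proj₁ h)) }
    module L = Relabel toD″ wf
    forward″ : Forward (3 * n) D″
    forward″ {ε} {p} e h = subst (_< ρ (R D ε (ρ⁻¹ p))) (ρρ⁻¹ (proj₁ h)) (forward e (L.ρ⁻¹-IsA h))
    toWord : Relabelling ρ ρ⁻¹ o D (wordDiagram n w)
    toWord = record
      { ρ<N = ρ<N ; ρ⁻¹<N = ρ⁻¹<N ; ρ⁻¹ρ = ρ⁻¹ρ ; ρρ⁻¹ = ρρ⁻¹ ; cyc-ρ = cyc-ρ
      ; letter = λ h → trans (sym (letters (ρ<N h))) (cong (ℓ D) (ρ⁻¹ρ h))
      ; chord = λ e h → trans (sym (Uniqueness.chords-agree L.relabelled-wellFormed (word-wellFormed k)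
          forward″ (word-forward k) letters e (L.ρ-IsA h)))
                              (Relabelling.chord toD″ e h) }

rotate unrotate : ℕ → ℕ → ℕ
rotate M zero = M
rotate M (suc p) = p
unrotate M p with p ≟ M
... | yes _ = 0
... | no _ = suc p

cyc-suc : ∀ x y z → cyc (suc x) (suc y) (suc z) ≡ cyc x y z
cyc-suc x y z = trans (cyc-unfold (suc x) (suc y) (suc z)) (sym (cyc-unfold x y z))

cyc-rotate : ∀ p u q → cyc p u q ≡ cyc u q p
cyc-rotate p u q = solve 3 (λ p u q → ⊢ cyc′ p u q ≈ cyc′ u q p) refl (p ∷ u ∷ q ∷ [])

rotation : ∀ M → DiskMap (suc M) (rotate M) (unrotate M) false
rotation M = record { ρ<N = ρ<N ; ρ⁻¹<N = ρ⁻¹<N ; ρ⁻¹ρ = ρ⁻¹ρ ; ρρ⁻¹ = ρρ⁻¹ ; cyc-ρ = cyc-ρ }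
  where
  ρ<N : ∀ {p} → p < suc M → rotate M p < suc M
  ρ<N {zero} h = ≤-refl
  ρ<N {suc p} h = <-trans (n<1+n p) h
  ρ⁻¹<N : ∀ {p} → p < suc M → unrotate M p < suc M
  ρ⁻¹<N {p} h with p ≟ M
  ... | yes _ = s≤s z≤n
  ... | no n = s≤s (≤∧≢⇒< (≤-pred h) n)
  ρ⁻¹ρ : ∀ {p} → p < suc M → unrotate M (rotate M p) ≡ p
  ρ⁻¹ρ {zero} h with M ≟ M
  ... | yes _ = refl
  ... | no n = ⊥-elim (n refl)
  ρ⁻¹ρ {suc p} h with p ≟ M
  ... | yes refl = ⊥-elim (<-irrefl refl (≤-pred h))
  ... | no _ = refl
  ρρ⁻¹ : ∀ {p} → p < suc M → rotate M (unrotate M p) ≡ p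
  ρρ⁻¹ {p} h with p ≟ M
  ... | yes refl = refl
  ... | no _ = refl
  -- Rotation turns the least point into the greatest, which is invisible to the cyclic order. The
  -- two `refl` record that `suc` preserves the comparison of the other points.
  from-zero : ∀ {y z} → suc y < suc M → suc z < suc M → cyc M y z ≡ cyc 0 (suc y) (suc z)
  from-zero {y} {z} h h′ = solve 6 (λ M y z o y′ z′ → o ≺ y′ ⊢ o ≺ z′ ⊢ y ≺ M ⊢ z ≺ M ⊢
      y′ <′ z′ ≈ y <′ z ⊢ z′ <′ y′ ≈ z <′ y ⊢
    ⊢ cyc′ M y z ≈ cyc′ o y′ z′) refl (M ∷ y ∷ z ∷ 0 ∷ suc y ∷ suc z ∷ []) (s≤s z≤n) (s≤s z≤n) (≤-pred h)
        (≤-pred h′) refl refl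
  cyc-ρ : ∀ {x y z} → x < suc M → y < suc M → z < suc M → x ≢ y → x ≢ z → y ≢ z →
          cyc (rotate M x) (rotate M y) (rotate M z) ≡ cyc x y z
  cyc-ρ {suc x} {suc y} {suc z} _ _ _ _ _ _ = sym (cyc-suc x y z)
  cyc-ρ {zero} {suc y} {suc z} _ hy hz _ _ _ = from-zero hy hz
  cyc-ρ {suc x} {zero} {suc z} hx _ hz _ _ _ =
      trans (cyc-rotate x M z) (trans (from-zero hz hx) (sym (cyc-rotate (suc x) 0 (suc z))))
  cyc-ρ {suc x} {suc y} {zero} hx hy _ _ _ _ =
      trans (sym (cyc-rotate M x y)) (trans (from-zero hx hy) (cyc-rotate 0 (suc x) (suc y)))
  cyc-ρ {zero} {zero} _ _ _ n _ _ = ⊥-elim (n refl)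
  cyc-ρ {zero} {suc y} {zero} _ _ _ _ n _ = ⊥-elim (n refl)
  cyc-ρ {suc x} {zero} {zero} _ _ _ _ _ n = ⊥-elim (n refl)

mirror : ℕ → ℕ → ℕ
mirror N p = N ∸ suc p

mirror-reverses : ∀ {N x y} → x < N → y < N → (mirror N x <ᵇ mirror N y) ≡ (y <ᵇ x)
mirror-reverses {N} {x} {y} hx hy with <-cmp x y
... | tri≈ _ refl _ = solve 2 (λ a x → ⊢ a <′ a ≈ x <′ x) refl (mirror N x ∷ x ∷ [])
... | tri< l _ _ = trans (≥→<ᵇ (∸-monoʳ-≤ N (s≤s (<⇒≤ l)))) (sym (≥→<ᵇ (<⇒≤ l)))
... | tri> _ _ l = trans (<→<ᵇ (∸-monoʳ-< (s≤s l) hx)) (sym (<→<ᵇ l))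

mirror-involutive : ∀ {N p} → p < N → mirror N (mirror N p) ≡ p
mirror-involutive {suc M} {p} (s≤s h) = m∸[m∸n]≡n h

reflection : ∀ N → DiskMap N (mirror N) (mirror N) true
reflection N = record
  { ρ<N = mirror<N ; ρ⁻¹<N = mirror<N ; ρ⁻¹ρ = mirror-involutive ; ρρ⁻¹ = mirror-involutive ; cyc-ρ =
      cyc-ρ }
  where
  mirror<N : ∀ {p} → p < N → mirror N p < N
  mirror<N {p} h = ∸-monoʳ-< {o = 0} (s≤s z≤n) h
  cyc-ρ : ∀ {x y z} → x < N → y < N → z < N → x ≢ y → x ≢ z → y ≢ z →
          cyc (mirror N x) (mirror N y) (mirror N z) ≡ not (cyc x y z)
  cyc-ρ {x} {y} {z} hx hy hz m₁ m₂ m₃ = trans (cyc-unfold _ _ _) (trans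
    (cong₂ _∨_ (cong₂ _∧_ xy yz) (cong₂ _∨_ (cong₂ _∧_ yz zx) (cong₂ _∧_ zx xy)))
    (solve 3 (λ x y z → x ≄ y ⊢ x ≄ z ⊢ y ≄ z ⊢
        ⊢ ((y <′ x ∧′ z <′ y) ∨′ (z <′ y ∧′ x <′ z) ∨′ (x <′ z ∧′ y <′ x)) ≈ not′ (cyc′ x y z)) refl
            (x ∷ y ∷ z ∷ []) m₁ m₂ m₃))
    where xy = mirror-reverses hx hy
          yz = mirror-reverses hy hz
          zx = mirror-reverses hz hx

nth-++ˡ : ∀ u v {j} → j < length u → nth (u ++ v) j ≡ nth u j
nth-++ˡ (x ∷ u) v {zero} h = refl
nth-++ˡ (x ∷ u) v {suc j} (s≤s h) = nth-++ˡ u v h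

nth-++ʳ : ∀ u v j → nth (u ++ v) (length u + j) ≡ nth v j
nth-++ʳ [] v j = refl
nth-++ʳ (x ∷ u) v j = nth-++ʳ u v j

module _ {m : ℕ} {w : List Letter} (k : IsKreweras (suc m) w) where
  private
    n M : ℕ
    n = suc m
    M = 3 * n ∸ 1
    D₀ : Diagram
    D₀ = wordDiagram n w
  open Diagrams (3 * n)

  initial-stage : Stage n D₀ 0 w
  initial-stage = record
    { D = D₀ ; wf = word-wellFormed k ; staged = λ e h → (λ _ → z≤n , word-forward k e h) , λ ()
    ; u = w ; v = [] ; word-split = sym (++-identityʳ w) ; length-u = kreweras-length k
    ; letters-u = λ _ _ → refl ; letters-v = λ _ () ; iso = idIso D₀ ; kreweras = isKrewB-complete k }

  -- Promotion is the first sweep of evacuation, so a single stage suffices for it.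
  pro-sweep : pro w ≡ sweep n M w
  pro-sweep = go w refl
    where
    go : ∀ u → w ≡ u → pro w ≡ sweep n M w
    go [] refl with kreweras-length k
    ... | ()
    go (B ∷ x) refl with IsKreweras.prefB k 1
    ... | ()
    go (C ∷ x) refl with IsKreweras.prefC k 1
    ... | ()
    go (A ∷ x) refl = trans (pro-slide n x k)
      (sym (trans (cong₂ (sweep n) (sym (suc-injective (kreweras-length k)))
          (cong (A ∷_) (sym (++-identityʳ x))))
                  (sweep-slide n x [] (subst (λ y → isKrewB n (A ∷ y) ≡ true) (sym (++-identityʳ x))
                      (isKrewB-complete k)))))

  pro-kreweras : IsKreweras n (pro w)
  pro-kreweras = isKrewB-sound (trans (cong (isKrewB n) pro-sweep)
      (sweep-kreweras n M w (isKrewB-complete k)))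

  evac-kreweras : IsKreweras n (evac n w)
  evac-kreweras = isKrewB-sound (evacGo-kreweras n M w (isKrewB-complete k))

  pro-iso : Iso (rotate M) false D₀ (wordDiagram n (pro w))
  pro-iso = iso ⊙ relabelWord (rotation M) wf pro-kreweras letters forward
    where
    open Stage (next-stage initial-stage refl)
    letters : ∀ {p} → p < 3 * n → ℓ D (unrotate M p) ≡ nth (pro w) p
    letters {p} h = trans (helper h) (cong (λ w → nth w p) (sym (trans pro-sweep word-split)))
      where
      helper : ∀ {p} → p < 3 * n → ℓ D (unrotate M p) ≡ nth (u ++ v) p
      helper {p} h with p ≟ M
      ... | yes refl = trans (letters-v 0 (s≤s z≤n)) (trans (sym (nth-++ʳ u v 0))
              (cong (nth (u ++ v)) (trans (+-identityʳ (length u)) (suc-injective length-u))))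
      ... | no q = trans (letters-u p l) (sym (nth-++ˡ u v l))
        where l = subst (p <_) (sym (suc-injective length-u)) (≤∧≢⇒< (≤-pred h) q)
    -- After one stage the only chords running backwards are those ending at 0, the point that
    -- rotation moves to the far right.
    forward : ∀ {ε q} → ArcColour ε → IsA D q → rotate M q < rotate M (R D ε q)
    forward {ε} {q} e h with R D ε q | staged e h
    ... | zero | _ , back with q | back (s≤s z≤n) | proj₁ h
    ... | suc q′ | _ | l = ≤-pred l
    forward {ε} {q} e h | suc r | ahead , _ with q | ahead (s≤s z≤n)
    ... | suc q′ | _ , l = ≤-pred l

  evac-iso : Iso (mirror (3 * n)) true D₀ (wordDiagram n (evac n w))
  evac-iso = iso ⊙ relabelWord (reflection (3 * n)) wf evac-kreweras letters forward
    where
    open Stage (last-stage M initial-stage refl)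
    no-u : u ≡ []
    no-u with u | +-cancelˡ-≡ (3 * n) (length u) 0 (trans length-u (sym (+-identityʳ (3 * n))))
    ... | [] | _ = refl
    letters : ∀ {p} → p < 3 * n → ℓ D (mirror (3 * n) p) ≡ nth (evac n w) p
    letters {p} h = trans (letters-v (mirror (3 * n) p) (DiskMap.ρ<N (reflection (3 * n)) h))
      (trans (cong (nth v) (mirror-involutive h))
          (cong (λ w → nth w p) (sym (trans word-split (cong (_++ v) no-u)))))
    forward : ∀ {ε q} → ArcColour ε → IsA D q → mirror (3 * n) q < mirror (3 * n) (R D ε q)
    forward {ε} {q} e h = ∸-monoʳ-< (s≤s (proj₂ (staged e h) (WellFormedProperties.R<N wf e h)))
        (proj₁ h)

  toℕ-shiftF : ∀ s (j : Fin (3 * n)) → toℕ (shiftF s j) ≡ (toℕ j + s) % suc M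
  toℕ-shiftF s j = toℕ-fromℕ< (m%n<n (toℕ j + s) (suc M))

  shift-rotate : ∀ j → toℕ (shiftF M j) ≡ rotate M (toℕ j)
  shift-rotate j = trans (toℕ-shiftF M j) (helper (toℕ j) (toℕ<n j))
    where
    helper : ∀ p → p < suc M → (p + M) % suc M ≡ rotate M p
    helper zero h = m<n⇒m%n≡m ≤-refl
    helper (suc p) h = trans (cong (_% suc M) (sym (+-suc p M))) (trans ([m+n]%n≡m%n p (suc M))
        (m<n⇒m%n≡m (<-trans (n<1+n p) h)))

  rotate-shift : ∀ j → rotate M (toℕ (shiftF 1 j)) ≡ toℕ j
  rotate-shift j = trans (cong (rotate M) (toℕ-shiftF 1 j)) (helper (toℕ j) (toℕ<n j))
    where
    helper : ∀ p → p < suc M → rotate M ((p + 1) % suc M) ≡ p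
    helper p h with m≤n⇒m<n∨m≡n (≤-pred h)
    ... | inj₁ l = cong (rotate M) (trans (cong (_% suc M) (+-comm p 1)) (m<n⇒m%n≡m (s≤s l)))
    ... | inj₂ refl = cong (rotate M) (trans (cong (_% suc M) (+-comm p 1)) (n%n≡0 (suc M)))

  promotion : web n (pro w) ≅ rotW (web n w)
  promotion = Transfer.isomorphic (word-wellFormed k) (word-forward k) (word-wellFormed pro-kreweras)
      (word-forward pro-kreweras)
    pro-iso (shiftF M) (shiftF 1) shift-rotate rotate-shift

  evacuation : web n (evac n w) ≅ flipW (web n w)
  evacuation = Transfer.isomorphic (word-wellFormed k) (word-forward k) (word-wellFormed evac-kreweras)
      (word-forward evac-kreweras)
    evac-iso opposite opposite opposite-prop
    (λ j → trans (cong (mirror (3 * n)) (opposite-prop j)) (mirror-involutive (toℕ<n j)))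

theorem1p3 : (n : ℕ) → 1 ≤ n → (w : List Letter) → IsKreweras n w →
    (web n (pro w) ≅ rotW (web n w)) × (web n (evac n w) ≅ flipW (web n w))
theorem1p3 (suc m) (s≤s _) w k = promotion k , evacuation k
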